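{- Let $p$ be an odd prime, $n$ an odd positive integer, $v=v_p(n)$, and write $x^n-1=(x-1)^{p^{v}}r_{1}^{p^{v}}\cdots r_{k}^{p^{v}}$ in $\mathbb{F}_p[x]$ with $r_1,\dots,r_k$ distinct monic prime self-reciprocal polynomials (necessarily of even degree). Then \[ \mathcal{G}^{(p)}_{n}(z)=\sum_{t=0}^n\mathcal{N}^{(p)}_n(n-t)z^t=\left(1+\sum_{j=1}^{\frac{p^{v}+1}{2}}p^{j-1}(p-1)z^{2j-1}\right)\prod_{i=1}^{k}G_i(z), \] where \[ G_i(z)=1+\sum_{j=1}^{p^{v}}\left(p^{\frac{\deg(r_i^{j})}{2}}-p^{\frac{\deg(r_i^{j})-\deg(r_i)}{2}}\right)z^{j\deg(r_i)}. \]
   Context: $\mathrm{Tr}_n:\mathbb{F}_{p^n}\to\mathbb{F}_p$ is the absolute trace, $\epsilon_p=e^{2\pi i/p}$. The Walsh transform of $f:\mathbb{F}_{p^n}\to\mathbb{F}_p$ is $\widehat f(b)=\sum_{x}\epsilon_p^{f(x)-\mathrm{Tr}_n(bx)}$; for an integer $0\le s\le n$, $f$ is $s$-plateaued if $|\widehat f(b)|\in\{0,p^{(n+s)/2}\}$ for all $b$. $\mathcal{D}$ is the set of functions $Q(x)=\mathrm{Tr}_n\big(\sum_{i=0}^{\lfloor n/2\rfloor}a_ix^{p^i+1}\big)$, $a_i\in\mathbb{F}_p$, including the zero function ($n$-plateaued); $\mathcal{N}^{(p)}_n(s)$ is the number of tuples $(a_0,\dots,a_{\lfloor n/2\rfloor})\in\mathbb{F}_p^{\lfloor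 n/2\rfloor+1}$ for which $Q$ is $s$-plateaued. For $f\in\mathbb{F}_p[x]$ with $f(0)\ne0$, $f^*(x)=x^{\deg f}f(1/x)$; $f$ is self-reciprocal if $f^*=f$. A monic $f$ is prime self-reciprocal if either $f$ is irreducible and self-reciprocal, or $f=ugg^*$ with $g$ monic irreducible, $g^*$ not a constant multiple of $g$, $u\in\mathbb{F}_p^*$. -}

module Defs where

open import Data.Nat as ℕ using (ℕ; zero; suc; _∸_; _^_; _≤_; NonZero)
open import Data.Nat.DivMod using (_%_; _/_; m%n<n)
open import Data.Fin as Fin using (Fin; toℕ; fromℕ<)
open import Data.Fin.Properties using (all?)
open import Data.Integer as ℤ using (ℤ; +_)
open import Data.Bool using (if_then_else_)
open import Data.List as List using (List; []; _∷_; _++_; map; foldr; length; filter; upTo; allFin; replicate; reverse)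
open import Data.List.Membership.Propositional using (_∈_)
open import Data.List.Relation.Unary.Unique.Propositional using (Unique)
open import Data.List.Relation.Unary.All as All using (All)
open import Data.Vec as Vec using (Vec; lookup)
open import Data.Product using (Σ; _×_; _,_; ∃)
open import Data.Sum using (_⊎_; inj₁; inj₂)
open import Relation.Nullary using (¬_; Dec; yes; no; does)
open import Relation.Nullary.Decidable using (_⊎-dec_; ⌊_⌋)
open import Relation.Binary.PropositionalEquality using (_≡_)
open import Relation.Binary.Definitions using (DecidableEquality)
open import Algebra.Structures using (IsCommutativeRing)

record FiniteField (p n : ℕ) : Set₁ where
  infixl 6 _+F_
  infixl 7 _*F_
  field
    F      : Set
    _+F_   : F → F → F
    _*F_   : F → F → F
    -F_    : F → F
    0F     : F
    1F     : F
    isCommutativeRing : IsCommutativeRing _≡_ _+F_ _*F_ -F_ 0F 1F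
    0≢1    : ¬ (0F ≡ 1F)
    inverse : ∀ x → ¬ (x ≡ 0F) → Σ F (λ y → x *F y ≡ 1F)
    _≟F_   : DecidableEquality F
    elems  : List F
    complete : ∀ x → x ∈ elems
    unique : Unique elems
    card   : length elems ≡ p ^ n

module Fp (p : ℕ) .{{_ : NonZero p}} where

  fromN : ℕ → Fin p
  fromN k = fromℕ< (m%n<n k p)

  0p 1p : Fin p
  0p = fromN 0
  1p = fromN 1

  _⊕_ _⊗_ : Fin p → Fin p → Fin p
  a ⊕ b = fromN (toℕ a ℕ.+ toℕ b)
  a ⊗ b = fromN (toℕ a ℕ.* toℕ b)

  ⊖_ : Fin p → Fin p
  ⊖ a = fromN (p ∸ toℕ a)

  -- The cyclotomic integers Z[ε_p] ⊂ ℂ : an element Σ_j c_j ε_p^j is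
  -- represented by its coefficient vector c : Fin p → ℤ; two vectors
  -- represent the same complex number iff their difference is constant
  -- (the only Z-relation among 1, ε_p, …, ε_p^{p-1} is their sum = 0).

  Cyc : Set
  Cyc = Fin p → ℤ

  _≈C_ : Cyc → Cyc → Set
  u ≈C v = ∀ i j → u i ℤ.- v i ≡ u j ℤ.- v j

  _≈C?_ : ∀ u v → Dec (u ≈C v)
  u ≈C? v = all? (λ i → all? (λ j → (u i ℤ.- v i) ℤ.≟ (u j ℤ.- v j)))

  ε^ : Fin p → Cyc
  ε^ j k = if ⌊ k Fin.≟ j ⌋ then + 1 else + 0

  intC : ℤ → Cyc
  intC c k = if ⌊ k Fin.≟ 0p ⌋ then c else + 0

  _+C_ : Cyc → Cyc → Cyc
  (u +C v) k = u k ℤ.+ v k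

  sumC : List Cyc → Cyc
  sumC = foldr _+C_ (λ _ → + 0)

  sumZ : List ℤ → ℤ
  sumZ = foldr ℤ._+_ (+ 0)

  _*C_ : Cyc → Cyc → Cyc
  (u *C v) m = sumZ (map (λ k → u k ℤ.* v (m ⊕ (⊖ k))) (allFin p))

  conj : Cyc → Cyc
  conj u j = u (⊖ j)

  normSq : Cyc → Cyc
  normSq w = w *C conj w

  -- Polynomials over F_p as coefficient lists (constant term first)

  Poly : Set
  Poly = List (Fin p)

  coeffP : Poly → ℕ → Fin p
  coeffP []      _       = 0p
  coeffP (a ∷ f) zero    = a
  coeffP (a ∷ f) (suc i) = coeffP f i

  -- equality of polynomials (trailing zeros irrelevant)
  _≈P_ : Poly → Poly → Set
  f ≈P g = ∀ i → coeffP f i ≡ coeffP g i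

  addP : Poly → Poly → Poly
  addP []      g       = g
  addP (a ∷ f) []      = a ∷ f
  addP (a ∷ f) (b ∷ g) = (a ⊕ b) ∷ addP f g

  scaleP : Fin p → Poly → Poly
  scaleP c = map (c ⊗_)

  mulP : Poly → Poly → Poly
  mulP []      g = []
  mulP (a ∷ f) g = addP (scaleP a g) (0p ∷ mulP f g)

  powP : Poly → ℕ → Poly
  powP f zero    = 1p ∷ []
  powP f (suc k) = mulP f (powP f k)

  prodP : List Poly → Poly
  prodP = foldr mulP (1p ∷ [])

  monomialP : Fin p → ℕ → Poly
  monomialP c k = replicate k 0p ++ (c ∷ [])

  strip : Poly → Poly
  strip [] = []
  strip (a ∷ f) with strip f
  ... | [] = if ⌊ a Fin.≟ 0p ⌋ then [] else (a ∷ [])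
  ... | r ∷ rs = a ∷ r ∷ rs

  degP : Poly → ℕ
  degP f = length (strip f) ∸ 1

  leadP : Poly → Fin p
  leadP f = coeffP f (degP f)

  Monic : Poly → Set
  Monic f = leadP f ≡ 1p

  -- f* (x) = x^{deg f} f(1/x)
  recip : Poly → Poly
  recip f = reverse (strip f)

  NonzeroConst : Poly → Set
  NonzeroConst f = ¬ (coeffP f 0 ≡ 0p)

  SelfReciprocal : Poly → Set
  SelfReciprocal f = NonzeroConst f × (recip f ≈P f)

  Irreducible : Poly → Set
  Irreducible f = (1 ≤ degP f) × (∀ g h → f ≈P mulP g h → (degP g ≡ 0) ⊎ (degP h ≡ 0))

  PrimeSelfReciprocal : Poly → Set
  PrimeSelfReciprocal f =
    Monic f ×
    ((Irreducible f × SelfReciprocal f) ⊎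
     Σ Poly (λ g → Σ (Fin p) (λ u →
        Monic g × Irreducible g × NonzeroConst g ×
        ¬ (Σ (Fin p) (λ c → recip g ≈P scaleP c g)) ×
        ¬ (u ≡ 0p) ×
        (f ≈P scaleP u (mulP g (recip g))))))

  xPowMinus1 : ℕ → Poly
  xPowMinus1 m = addP (monomialP 1p m) ((⊖ 1p) ∷ [])

  PolyN : Set
  PolyN = List ℕ

  coeffN : PolyN → ℕ → ℕ
  coeffN []      _       = 0
  coeffN (a ∷ f) zero    = a
  coeffN (a ∷ f) (suc i) = coeffN f i

  addN : PolyN → PolyN → PolyN
  addN []      g       = g
  addN (a ∷ f) []      = a ∷ f
  addN (a ∷ f) (b ∷ g) = (a ℕ.+ b) ∷ addN f g

  mulN : PolyN → PolyN → PolyN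
  mulN []      g = []
  mulN (a ∷ f) g = addN (map (a ℕ.*_) g) (0 ∷ mulN f g)

  sumN : List PolyN → PolyN
  sumN = foldr addN []

  prodN : List PolyN → PolyN
  prodN = foldr mulN (1 ∷ [])

  monoN : ℕ → ℕ → PolyN
  monoN c k = replicate k 0 ++ (c ∷ [])

  range1 : ℕ → List ℕ
  range1 m = map suc (upTo m)

  factorA : ℕ → PolyN
  factorA v = addN (1 ∷ []) (sumN (map (λ j → monoN (p ^ (j ∸ 1) ℕ.* (p ∸ 1)) (2 ℕ.* j ∸ 1))
                                       (range1 ((p ^ v ℕ.+ 1) / 2))))

  factorG : ℕ → Poly → PolyN
  factorG v r = addN (1 ∷ []) (sumN (map (λ j →
      monoN (p ^ (degP (powP r j) / 2) ∸ p ^ ((degP (powP r j) ∸ degP r) / 2)) (j ℕ.* degP r))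
      (range1 (p ^ v))))

  allVecs : (m : ℕ) → List (Vec (Fin p) m)
  allVecs zero    = Vec.[] ∷ []
  allVecs (suc m) = List.concatMap (λ a → map (a Vec.∷_) (allVecs m)) (allFin p)

module OverField {p n : ℕ} .{{_ : NonZero p}} (K : FiniteField p n) where
  open FiniteField K
  open Fp p

  ι : Fin p → F
  ι k = go (toℕ k)
    where
    go : ℕ → F
    go zero    = 0F
    go (suc m) = 1F +F go m

  powF : F → ℕ → F
  powF x zero    = 1F
  powF x (suc k) = x *F powF x k

  sumF : List F → F
  sumF = foldr _+F_ 0F

  TrF : F → F
  TrF x = sumF (map (λ i → powF x (p ^ i)) (upTo n))

  -- identify an element of the prime subfield with its residue in F_p
  -- (the default 0p is never reached for elements of the prime subfield)
  toFp : F → Fin p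
  toFp y = go (allFin p)
    where
    go : List (Fin p) → Fin p
    go []       = 0p
    go (k ∷ ks) = if ⌊ ι k ≟F y ⌋ then k else go ks

  Tr : F → Fin p
  Tr x = toFp (TrF x)

  walsh : (F → Fin p) → F → Cyc
  walsh f b = sumC (map (λ x → ε^ (f x ⊕ (⊖ Tr (b *F x)))) elems)

  -- |f̂(b)| ∈ {0, p^{(n+s)/2}}, i.e. |f̂(b)|^2 ∈ {0, p^{n+s}}
  PlateauedAt : ℕ → (F → Fin p) → F → Set
  PlateauedAt s f b = (normSq (walsh f b) ≈C intC (+ 0)) ⊎ (normSq (walsh f b) ≈C intC (+ (p ^ (n ℕ.+ s))))

  Plateaued : ℕ → (F → Fin p) → Set
  Plateaued s f = ∀ b → PlateauedAt s f b

  plateaued? : ∀ s f → Dec (Plateaued s f)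
  plateaued? s f with All.all? (λ b → (normSq (walsh f b) ≈C? intC (+ 0)) ⊎-dec
                                      (normSq (walsh f b) ≈C? intC (+ (p ^ (n ℕ.+ s))))) elems
  ... | yes all = yes (λ b → All.lookup all (complete b))
  ... | no ¬all = no (λ h → ¬all (All.tabulate (λ {b} _ → h b)))

  Q : Vec (Fin p) (suc (n / 2)) → F → Fin p
  Q a x = Tr (sumF (map (λ i → ι (lookup a i) *F powF x (p ^ toℕ i ℕ.+ 1)) (allFin (suc (n / 2)))))

  𝒩 : ℕ → ℕ
  𝒩 s = length (filter (λ a → plateaued? s (Q a)) (allVecs (suc (n / 2))))

  𝒢 : PolyN
  𝒢 = map (λ t → 𝒩 (n ∸ t)) (upTo (suc n))

{-# OPTIONS --safe #-}

-- Let n = 2m + 1, let φ be the Frobenius map and P_a = Σ a_i (x^(m+i) + x^(m-i)), a palindrome of length n.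
-- The polar form of Q_a is Tr(y^(p^m) P_a(φ)(z)), so |Q̂_a(b)|² is 0 or p^n |ker P_a(φ)|, and Q_a is
-- s-plateaued exactly for s = deg gcd(P_a, x^n - 1).
--
-- If D divides x^n - 1 and is palindromic or antipalindromic, then P ↦ P / D maps the palindromes of length n
-- divisible by D bijectively onto all (anti)palindromes of length n - deg D, of which there are
-- p^⌈(n - deg D)/2⌉.  For D = (x - 1)^(q - b_0) ∏ r_i^(q - b_i), q = p^v, this number is
-- p^⌈b_0/2⌉ ∏ p^(b_i deg r_i / 2).  Hence the defects q - v_r(P_a), r ∈ {x - 1, r_1, …, r_k}, are independent
-- statistics of a, and the generating function of n - deg gcd(P_a, x^n - 1) is the product of their
-- generating functions.

module Submission where

open import Defs
open import Algebra.Bundles using (CommutativeRing)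
import Algebra.Properties.AbelianGroup as AbelianGroupP
import Algebra.Properties.CommutativeSemigroup as CommutativeSemigroupP
import Algebra.Properties.CommutativeSemiring.Binomial as Binomial
import Algebra.Properties.Monoid.Mult as MonoidMult
import Algebra.Properties.Monoid.Sum as MonoidSum
import Algebra.Properties.Ring as RingP
import Algebra.Properties.Semiring.Exp as SemiringExp
import Algebra.Properties.Semiring.Mult as SemiringMult
import Algebra.Solver.Ring.NaturalCoefficients.Default as SemiringSolver
open import Algebra.Structures using (IsCommutativeRing)
open import Data.Empty using (⊥; ⊥-elim)
open import Data.Fin as Fin using (Fin; toℕ)
import Data.Fin.Properties as FinP
open import Data.Integer as ℤ using (ℤ)
import Data.Integer.Properties as ℤP
open import Data.List as List using (List; []; _∷_; _++_; map; foldr; length; filter; upTo; allFin; replicate; reverse; _∷ʳ_; cartesianProductWith; applyUpTo)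
open import Data.List.Membership.Propositional using (_∈_)
import Data.List.Membership.Propositional.Properties as ∈P
import Data.List.Properties as ListP
open import Data.List.Relation.Binary.Permutation.Propositional as ↭ using (_↭_)
import Data.List.Relation.Binary.Permutation.Propositional.Properties as ↭P
import Data.List.Relation.Binary.Permutation.Setoid.Properties as ↭SP
open import Data.List.Relation.Unary.All as All using (All; []; _∷_)
import Data.List.Relation.Unary.All.Properties as AllP
open import Data.List.Relation.Unary.AllPairs as AllPairs using (AllPairs; []; _∷_)
import Data.List.Relation.Unary.AllPairs.Properties as AllPairsP
open import Data.List.Relation.Unary.Any as Any using (here; there; Any)
open import Data.List.Relation.Unary.Unique.Propositional using (Unique)
import Data.List.Relation.Unary.Unique.Propositional.Properties as UniqueP
open import Data.Nat as ℕ using (ℕ; zero; suc; _+_; _*_; _∸_; _^_; _≤_; _<_; z≤n; s≤s; NonZero; ⌈_/2⌉; ⌊_/2⌋; _!)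
open import Data.Nat.Combinatorics using (_C_; nCn≡1; nCk≡n!/k![n-k]!; k![n∸k]!∣n!)
import Data.Nat.Coprimality as Coprime
open import Data.Nat.DivMod using (_%_; _/_; m%n<n; m<n⇒m%n≡m; %-distribˡ-+; %-distribˡ-*; n%n≡0; m*n/n≡m; m≡m%n+[m/n]*n; m/n*n≡m)
open import Data.Nat.Divisibility using (_∣_; _∤_; m%n≡0⇒n∣m; n∣m⇒m%n≡0; ∣⇒≤; divides; m∣m*n; ∣1⇒≡1)
open import Data.Nat.GCD using (module Bézout)
open import Data.Nat.Primality using (Prime; euclidsLemma; prime⇒nonTrivial; prime[2])
import Data.Nat.Properties as ℕP
open import Data.Product using (Σ; _×_; _,_; proj₁; proj₂)
open import Data.Sum as Sum using (_⊎_; inj₁; inj₂)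
open import Data.Unit using (⊤; tt)
open import Data.Vec as Vec using (Vec; lookup)
import Data.Vec.Properties as VecP
open import Function using (_∘_; id)
open import Relation.Binary.Definitions using (DecidableEquality)
open import Relation.Binary.PropositionalEquality as ≡ using (_≡_; _≢_; refl; sym; trans; cong; cong₂; subst; module ≡-Reasoning)
import Relation.Binary.Reasoning.Setoid as SetoidReasoning
open import Relation.Nullary using (¬_; Dec; yes; no)
open import Relation.Nullary.Decidable using (_×-dec_; ¬?; decidable-stable)

-- The obstacle is a pair factor `r = u g g*`, which is not prime: a general polynomial may be
-- divisible by `g` and not by `g*`. Among palindromes and antipalindromes it behaves like a prime,
-- since reversal carries `g ∣ P` to `g* ∣ P`; so `r` divides such a `P` or is coprime to it. This
-- dichotomy replaces unique factorization. It remains available for cofactors, because the quotient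
-- of a symmetric word by a symmetric divisor is symmetric. Signs need care: odd powers of `x - 1`
-- are antipalindromic, and the middle letter of an antipalindrome of odd length is 0, which would
-- falsify the exponent with the ceiling. Since `q` is odd and each `r_i` has even degree, a
-- quotient of odd length always has sign 1. Divisibility controls only tails, the events that all
-- defects are at most given bounds; exact values are differences of tails. For `x - 1` the tail
-- p^⌈b/2⌉ grows only at odd `b`, hence the odd exponents and the coefficients p^(j-1)(p - 1) of the
-- first factor. Norms in Z[ε_p] are read as counts of solutions; a count independent of the value
-- represents 0.

private variable
  A B : Set

-- Finite sums, indicators and counting by bijection.

∑ : List A → (A → ℕ) → ℕ
∑ []       f = 0
∑ (x ∷ xs) f = f x + ∑ xs f

∑-cong∈ : ∀ xs {f g : A → ℕ} → (∀ x → x ∈ xs → f x ≡ g x) → ∑ xs f ≡ ∑ xs g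
∑-cong∈ []       e = refl
∑-cong∈ (x ∷ xs) e = cong₂ _+_ (e x (here refl)) (∑-cong∈ xs (λ y h → e y (there h)))

∑-cong : ∀ xs {f g : A → ℕ} → (∀ x → f x ≡ g x) → ∑ xs f ≡ ∑ xs g
∑-cong xs e = ∑-cong∈ xs (λ x _ → e x)

∑-mono : ∀ xs {f g : A → ℕ} → (∀ x → f x ≤ g x) → ∑ xs f ≤ ∑ xs g
∑-mono []       e = z≤n
∑-mono (x ∷ xs) e = ℕP.+-mono-≤ (e x) (∑-mono xs e)

∑-+ : ∀ xs (f g : A → ℕ) → ∑ xs (λ x → f x + g x) ≡ ∑ xs f + ∑ xs g
∑-+ []       f g = refl
∑-+ (x ∷ xs) f g = begin
  f x + g x + ∑ xs (λ y → f y + g y)  ≡⟨ cong (f x + g x +_) (∑-+ xs f g) ⟩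
  f x + g x + (∑ xs f + ∑ xs g)       ≡⟨ ℕP.+-assoc (f x) (g x) _ ⟩
  f x + (g x + (∑ xs f + ∑ xs g))     ≡⟨ cong (f x +_) (x∙yz≈y∙xz (g x) (∑ xs f) (∑ xs g)) ⟩
  f x + (∑ xs f + (g x + ∑ xs g))     ≡⟨ ℕP.+-assoc (f x) _ _ ⟨
  f x + ∑ xs f + (g x + ∑ xs g)       ∎
  where
  open ≡-Reasoning
  open import Algebra.Properties.CommutativeSemigroup ℕP.+-commutativeSemigroup using (x∙yz≈y∙xz)

∑-*ˡ : ∀ c xs (f : A → ℕ) → ∑ xs (λ x → c * f x) ≡ c * ∑ xs f
∑-*ˡ c []       f = sym (ℕP.*-zeroʳ c)
∑-*ˡ c (x ∷ xs) f = trans (cong (c * f x +_) (∑-*ˡ c xs f)) (sym (ℕP.*-distribˡ-+ c (f x) _))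

∑-*ʳ : ∀ c xs (f : A → ℕ) → ∑ xs (λ x → f x * c) ≡ ∑ xs f * c
∑-*ʳ c xs f = trans (∑-cong xs (λ x → ℕP.*-comm (f x) c)) (trans (∑-*ˡ c xs f) (ℕP.*-comm c _))

∑-zero : ∀ (xs : List A) → ∑ xs (λ _ → 0) ≡ 0
∑-zero []       = refl
∑-zero (x ∷ xs) = ∑-zero xs

∑-const : ∀ (xs : List A) c → ∑ xs (λ _ → c) ≡ length xs * c
∑-const []       c = refl
∑-const (x ∷ xs) c = cong (c +_) (∑-const xs c)

∑-swap : ∀ (xs : List A) (ys : List B) (f : A → B → ℕ) →
         ∑ xs (λ x → ∑ ys (f x)) ≡ ∑ ys (λ y → ∑ xs (λ x → f x y))
∑-swap []       ys f = sym (∑-zero ys)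
∑-swap (x ∷ xs) ys f = trans (cong (∑ ys (f x) +_) (∑-swap xs ys f)) (sym (∑-+ ys (f x) _))

∑-map : ∀ (h : A → B) xs (f : B → ℕ) → ∑ (map h xs) f ≡ ∑ xs (f ∘ h)
∑-map h []       f = refl
∑-map h (x ∷ xs) f = cong (f (h x) +_) (∑-map h xs f)

∑-++ : ∀ xs ys (f : A → ℕ) → ∑ (xs ++ ys) f ≡ ∑ xs f + ∑ ys f
∑-++ []       ys f = refl
∑-++ (x ∷ xs) ys f = trans (cong (f x +_) (∑-++ xs ys f)) (sym (ℕP.+-assoc (f x) _ _))

-- Iverson bracket. Counts are kept as sums of brackets so that they can be interchanged and
-- factored.
iv : {P : Set} → Dec P → ℕ
iv (yes _) = 1
iv (no _)  = 0

iv-cong : {P Q : Set} {d : Dec P} {e : Dec Q} → (P → Q) → (Q → P) → iv d ≡ iv e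
iv-cong {d = yes _} {yes _} _ _ = refl
iv-cong {d = yes a} {no ¬b} f _ = ⊥-elim (¬b (f a))
iv-cong {d = no ¬a} {yes b} _ g = ⊥-elim (¬a (g b))
iv-cong {d = no _}  {no _}  _ _ = refl

iv-yes : {P : Set} (d : Dec P) → P → iv d ≡ 1
iv-yes (yes _) _ = refl
iv-yes (no ¬a) a = ⊥-elim (¬a a)

iv-no : {P : Set} (d : Dec P) → ¬ P → iv d ≡ 0
iv-no (yes a) ¬a = ⊥-elim (¬a a)
iv-no (no _)  _  = refl

iv-× : {P Q : Set} (d : Dec P) (e : Dec Q) → iv (d ×-dec e) ≡ iv d * iv e
iv-× (yes _) (yes _) = refl
iv-× (yes _) (no _)  = refl
iv-× (no _)  (yes _) = refl
iv-× (no _)  (no _)  = refl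

length-filter-iv : {P : A → Set} (P? : ∀ x → Dec (P x)) → ∀ xs →
                   length (filter P? xs) ≡ ∑ xs (λ x → iv (P? x))
length-filter-iv P? [] = refl
length-filter-iv P? (x ∷ xs) with P? x
... | yes _ = cong suc (length-filter-iv P? xs)
... | no _  = length-filter-iv P? xs

∑-δ-∉ : (_≟_ : DecidableEquality A) → ∀ {xs y} → All (y ≢_) xs → (f : A → ℕ) →
        ∑ xs (λ x → iv (y ≟ x) * f x) ≡ 0
∑-δ-∉ _≟_ []       f = refl
∑-δ-∉ _≟_ {x ∷ _} {y} (h ∷ hs) f
  rewrite iv-no (y ≟ x) h = ∑-δ-∉ _≟_ hs f

∑-δ : (_≟_ : DecidableEquality A) → ∀ {xs y} → Unique xs → y ∈ xs → (f : A → ℕ) →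
      ∑ xs (λ x → iv (y ≟ x) * f x) ≡ f y
∑-δ _≟_ {x ∷ xs} (h ∷ u) (here refl) f
  rewrite iv-yes (x ≟ x) refl | ∑-δ-∉ _≟_ h f = trans (ℕP.+-identityʳ _) (ℕP.+-identityʳ _)
∑-δ _≟_ {x ∷ xs} {y} (h ∷ u) (there m) f
  rewrite iv-no (y ≟ x) (λ e → All.lookup h m (sym e)) = ∑-δ _≟_ u m f

record Enumeration (A : Set) : Set where
  field
    list     : List A
    complete : ∀ x → x ∈ list
    unique   : Unique list
    _≟_      : DecidableEquality A

module _ (E : Enumeration A) (E' : Enumeration B) where
  private
    module E = Enumeration E
    module E' = Enumeration E'

  -- Both sides count the pairs `(a , b)` with `b ≡ φ a` and `P a`; by the hypotheses these are the
  -- pairs with `a ≡ ψ b` and `R b`. The maps need to be inverse only on the counted subsets.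
  ∑-bijection : {P : A → Set} {R : B → Set} (P? : ∀ a → Dec (P a)) (R? : ∀ b → Dec (R b)) →
    (φ : A → B) (ψ : B → A) →
    (∀ a → P a → R (φ a) × ψ (φ a) ≡ a) → (∀ b → R b → P (ψ b) × φ (ψ b) ≡ b) →
    ∑ E.list (λ a → iv (P? a)) ≡ ∑ E'.list (λ b → iv (R? b))
  ∑-bijection P? R? φ ψ f g = begin
    ∑ E.list (λ a → iv (P? a))
      ≡⟨ ∑-cong E.list (λ a → sym (∑-δ E'._≟_ E'.unique (E'.complete (φ a)) (λ _ → iv (P? a)))) ⟩
    ∑ E.list (λ a → ∑ E'.list (λ b → iv (φ a E'.≟ b) * iv (P? a)))
      ≡⟨ ∑-swap E.list E'.list _ ⟩
    ∑ E'.list (λ b → ∑ E.list (λ a → iv (φ a E'.≟ b) * iv (P? a)))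
      ≡⟨ ∑-cong E'.list (λ b → ∑-cong E.list (λ a → same a b)) ⟩
    ∑ E'.list (λ b → ∑ E.list (λ a → iv (ψ b E.≟ a) * iv (R? b)))
      ≡⟨ ∑-cong E'.list (λ b → ∑-δ E._≟_ E.unique (E.complete (ψ b)) (λ _ → iv (R? b))) ⟩
    ∑ E'.list (λ b → iv (R? b)) ∎
    where
    open ≡-Reasoning
    same : ∀ a b → iv (φ a E'.≟ b) * iv (P? a) ≡ iv (ψ b E.≟ a) * iv (R? b)
    same a b = trans (sym (iv-× (φ a E'.≟ b) (P? a)))
      (trans (iv-cong (λ { (refl , pa) → proj₂ (f a pa) , proj₁ (f a pa) })
                      (λ { (refl , rb) → proj₂ (g b rb) , proj₁ (g b rb) }))
             (iv-× (ψ b E.≟ a) (R? b)))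

module _ (E : Enumeration A) where
  private module E = Enumeration E

  ∑-reindex : (π π⁻ : A → A) → (∀ x → π⁻ (π x) ≡ x) → (∀ x → π (π⁻ x) ≡ x) → (f : A → ℕ) →
              ∑ E.list (f ∘ π) ≡ ∑ E.list f
  ∑-reindex π π⁻ l r f = begin
    ∑ E.list (f ∘ π)
      ≡⟨ ∑-cong E.list (λ x → sym (∑-δ E._≟_ E.unique (E.complete (π x)) f)) ⟩
    ∑ E.list (λ x → ∑ E.list (λ y → iv (π x E.≟ y) * f y))
      ≡⟨ ∑-swap E.list E.list _ ⟩
    ∑ E.list (λ y → ∑ E.list (λ x → iv (π x E.≟ y) * f y))
      ≡⟨ ∑-cong E.list (λ y → ∑-cong E.list (λ x → cong (_* f y)
           (iv-cong {d = π x E.≟ y} {π⁻ y E.≟ x} (λ { refl → l x }) (λ { refl → r y })))) ⟩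
    ∑ E.list (λ y → ∑ E.list (λ x → iv (π⁻ y E.≟ x) * f y))
      ≡⟨ ∑-cong E.list (λ y → ∑-δ E._≟_ E.unique (E.complete (π⁻ y)) (λ _ → f y)) ⟩
    ∑ E.list f ∎
    where open ≡-Reasoning

-- The head `x` is deleted from `ys`. By uniqueness no remaining element equals `x`, so both
-- inclusions survive the deletion.
unique-↭ : ∀ {xs ys : List A} → Unique xs → Unique ys →
           (∀ {x} → x ∈ xs → x ∈ ys) → (∀ {x} → x ∈ ys → x ∈ xs) → xs ↭ ys
unique-↭ {xs = []} {[]} _ _ _ _ = ↭.refl
unique-↭ {xs = []} {y ∷ ys} _ _ _ g with () ← g (here refl)
unique-↭ {xs = x ∷ xs} {ys} (x∉ ∷ ux) uy f g
  with us , vs , refl ← ∈P.∈-∃++ (f (here refl)) =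
  ↭.trans (↭.prep x (unique-↭ ux (AllPairs.tail uy') f' g')) (↭.↭-sym σ)
  where
  σ : us ++ x ∷ vs ↭ x ∷ us ++ vs
  σ = ↭P.shift x us vs
  uy' : Unique (x ∷ us ++ vs)
  uy' = ↭SP.Unique-resp-↭ (≡.setoid _) (↭.↭⇒↭ₛ σ) uy
  f' : ∀ {y} → y ∈ xs → y ∈ us ++ vs
  f' m with ↭P.∈-resp-↭ σ (f (there m))
  ... | here refl = ⊥-elim (All.lookup x∉ m refl)
  ... | there m'  = m'
  g' : ∀ {y} → y ∈ us ++ vs → y ∈ xs
  g' m with g (↭P.∈-resp-↭ (↭.↭-sym σ) (there m))
  ... | here refl = ⊥-elim (All.lookup (AllPairs.head uy') m refl)
  ... | there m'  = m'

-- The field of residues modulo `p`.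

module Residues (p : ℕ) .{{_ : NonZero p}} where
  open Fp p

  toℕ-fromN : ∀ k → toℕ (fromN k) ≡ k % p
  toℕ-fromN k = FinP.toℕ-fromℕ< (m%n<n k p)

  fromN-% : ∀ {a b} → a % p ≡ b % p → fromN a ≡ fromN b
  fromN-% {a} {b} e = FinP.toℕ-injective (trans (toℕ-fromN a) (trans e (sym (toℕ-fromN b))))

  fromN-toℕ : ∀ x → fromN (toℕ x) ≡ x
  fromN-toℕ x = FinP.toℕ-injective (trans (toℕ-fromN (toℕ x)) (m<n⇒m%n≡m (FinP.toℕ<n x)))

  fromN-+ : ∀ a b → fromN a ⊕ fromN b ≡ fromN (a + b)
  fromN-+ a b = fromN-% (trans (cong₂ (λ u v → (u + v) % p) (toℕ-fromN a) (toℕ-fromN b)) (sym (%-distribˡ-+ a b p)))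

  fromN-* : ∀ a b → fromN a ⊗ fromN b ≡ fromN (a * b)
  fromN-* a b = fromN-% (trans (cong₂ (λ u v → (u * v) % p) (toℕ-fromN a) (toℕ-fromN b)) (sym (%-distribˡ-* a b p)))

  private
    infix 0 _via_
    -- Every residue is the class of a natural number, so the ring laws are inherited from ℕ along
    -- `fromN`.
    _via_ : ∀ {a} (P : Fin p → Set a) → (∀ k → P (fromN k)) → ∀ x → P x
    (P via h) x = subst P (fromN-toℕ x) (h (toℕ x))

  ⊕-assoc : ∀ x y z → (x ⊕ y) ⊕ z ≡ x ⊕ (y ⊕ z)
  ⊕-assoc = _ via λ a → _ via λ b → _ via λ c → begin
    (fromN a ⊕ fromN b) ⊕ fromN c  ≡⟨ cong (_⊕ fromN c) (fromN-+ a b) ⟩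
    fromN (a + b) ⊕ fromN c        ≡⟨ fromN-+ (a + b) c ⟩
    fromN (a + b + c)              ≡⟨ cong fromN (ℕP.+-assoc a b c) ⟩
    fromN (a + (b + c))            ≡⟨ fromN-+ a (b + c) ⟨
    fromN a ⊕ fromN (b + c)        ≡⟨ cong (fromN a ⊕_) (fromN-+ b c) ⟨
    fromN a ⊕ (fromN b ⊕ fromN c)  ∎
    where open ≡-Reasoning

  ⊗-assoc : ∀ x y z → (x ⊗ y) ⊗ z ≡ x ⊗ (y ⊗ z)
  ⊗-assoc = _ via λ a → _ via λ b → _ via λ c → begin
    (fromN a ⊗ fromN b) ⊗ fromN c  ≡⟨ cong (_⊗ fromN c) (fromN-* a b) ⟩
    fromN (a * b) ⊗ fromN c        ≡⟨ fromN-* (a * b) c ⟩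
    fromN (a * b * c)              ≡⟨ cong fromN (ℕP.*-assoc a b c) ⟩
    fromN (a * (b * c))            ≡⟨ fromN-* a (b * c) ⟨
    fromN a ⊗ fromN (b * c)        ≡⟨ cong (fromN a ⊗_) (fromN-* b c) ⟨
    fromN a ⊗ (fromN b ⊗ fromN c)  ∎
    where open ≡-Reasoning

  ⊕-comm : ∀ x y → x ⊕ y ≡ y ⊕ x
  ⊕-comm x y = cong fromN (ℕP.+-comm (toℕ x) (toℕ y))

  ⊗-comm : ∀ x y → x ⊗ y ≡ y ⊗ x
  ⊗-comm x y = cong fromN (ℕP.*-comm (toℕ x) (toℕ y))

  ⊗-distribˡ : ∀ x y z → x ⊗ (y ⊕ z) ≡ (x ⊗ y) ⊕ (x ⊗ z)
  ⊗-distribˡ = _ via λ a → _ via λ b → _ via λ c → begin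
    fromN a ⊗ (fromN b ⊕ fromN c)              ≡⟨ cong (fromN a ⊗_) (fromN-+ b c) ⟩
    fromN a ⊗ fromN (b + c)                    ≡⟨ fromN-* a (b + c) ⟩
    fromN (a * (b + c))                        ≡⟨ cong fromN (ℕP.*-distribˡ-+ a b c) ⟩
    fromN (a * b + a * c)                      ≡⟨ fromN-+ (a * b) (a * c) ⟨
    fromN (a * b) ⊕ fromN (a * c)              ≡⟨ cong₂ _⊕_ (fromN-* a b) (fromN-* a c) ⟨
    (fromN a ⊗ fromN b) ⊕ (fromN a ⊗ fromN c)  ∎
    where open ≡-Reasoning

  ⊕-identityˡ : ∀ x → 0p ⊕ x ≡ x
  ⊕-identityˡ = _ via λ a → fromN-+ 0 a

  ⊗-identityˡ : ∀ x → 1p ⊗ x ≡ x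
  ⊗-identityˡ = _ via λ a → trans (fromN-* 1 a) (cong fromN (ℕP.*-identityˡ a))

  ⊖-inverseˡ : ∀ x → (⊖ x) ⊕ x ≡ 0p
  ⊖-inverseˡ x = begin
    fromN (p ∸ toℕ x) ⊕ x                ≡⟨ cong ((⊖ x) ⊕_) (fromN-toℕ x) ⟨
    fromN (p ∸ toℕ x) ⊕ fromN (toℕ x)    ≡⟨ fromN-+ _ _ ⟩
    fromN (p ∸ toℕ x + toℕ x)            ≡⟨ cong fromN (ℕP.m∸n+n≡m (ℕP.<⇒≤ (FinP.toℕ<n x))) ⟩
    fromN p                              ≡⟨ fromN-% (trans (n%n≡0 p) (sym (m<n⇒m%n≡m (ℕ.>-nonZero⁻¹ p)))) ⟩
    0p                                   ∎
    where open ≡-Reasoning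

  Fp-isCommutativeRing : IsCommutativeRing _≡_ _⊕_ _⊗_ ⊖_ 0p 1p
  Fp-isCommutativeRing = record
    { isRing = record
      { +-isAbelianGroup = record
        { isGroup = record
          { isMonoid = record
            { isSemigroup = record
              { isMagma = record { isEquivalence = ≡.isEquivalence ; ∙-cong = cong₂ _⊕_ }
              ; assoc = ⊕-assoc }
            ; identity = ⊕-identityˡ , λ x → trans (⊕-comm x 0p) (⊕-identityˡ x) }
          ; inverse = ⊖-inverseˡ , λ x → trans (⊕-comm x (⊖ x)) (⊖-inverseˡ x)
          ; ⁻¹-cong = cong ⊖_ }
        ; comm = ⊕-comm }
      ; *-cong = cong₂ _⊗_
      ; *-assoc = ⊗-assoc
      ; *-identity = ⊗-identityˡ , λ x → trans (⊗-comm x 1p) (⊗-identityˡ x)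
      ; distrib = ⊗-distribˡ , λ x y z → trans (⊗-comm (y ⊕ z) x)
                    (trans (⊗-distribˡ x y z) (cong₂ _⊕_ (⊗-comm x y) (⊗-comm x z))) }
    ; *-comm = ⊗-comm }

  FpRing : CommutativeRing _ _
  FpRing = record { isCommutativeRing = Fp-isCommutativeRing }

  module 𝔽 = CommutativeRing FpRing
  module 𝔽P = RingP 𝔽.ring

  ≡0⇒∣ : ∀ a → fromN a ≡ 0p → p ∣ a
  ≡0⇒∣ a e = m%n≡0⇒n∣m a p (trans (sym (toℕ-fromN a))
      (trans (cong toℕ e) (trans (toℕ-fromN 0) (m<n⇒m%n≡m (ℕ.>-nonZero⁻¹ p)))))

  ∣⇒≡0 : ∀ a → p ∣ a → fromN a ≡ 0p
  ∣⇒≡0 a d = fromN-% (trans (n∣m⇒m%n≡0 a p d) (sym (m<n⇒m%n≡m (ℕ.>-nonZero⁻¹ p))))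

  -- Every residue is a multiple of 1.
  shift-invariant⇒constant : ∀ {A : Set} (f : Fin p → A) → (∀ x → f (x ⊕ 1p) ≡ f x) → ∀ x → f x ≡ f 0p
  shift-invariant⇒constant f inv = _ via go
    where
    go : ∀ k → f (fromN k) ≡ f 0p
    go zero    = refl
    go (suc k) = trans (cong f (trans (cong fromN (ℕP.+-comm 1 k)) (sym (fromN-+ k 1)))) (trans (inv _) (go k))

  Fp-enumeration : Enumeration (Fin p)
  Fp-enumeration = record
    { list = allFin p ; complete = ∈P.∈-allFin ; unique = UniqueP.allFin⁺ p ; _≟_ = Fin._≟_ }

  module _ (pp : Prime p) where
    1p≢0p : 1p ≢ 0p
    1p≢0p e = ℕP.<⇒≱ (ℕ.nonTrivial⇒n>1 p {{prime⇒nonTrivial pp}}) (∣⇒≤ (≡0⇒∣ 1 e))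

    ⊗-inverse : ∀ x → x ≢ 0p → Σ (Fin p) λ y → x ⊗ y ≡ 1p
    ⊗-inverse x x≢0 with Coprime.coprime-Bézout (Coprime.prime⇒coprime pp {{ℕ.≢-nonZero x≢0'}} (FinP.toℕ<n x))
      where
      x≢0' : toℕ x ≢ 0
      x≢0' e = x≢0 (trans (sym (fromN-toℕ x)) (cong fromN e))
    ... | b = inv b
      where
      inv : Bézout.Identity 1 p (toℕ x) → Σ (Fin p) λ y → x ⊗ y ≡ 1p
      -- This form of the Bézout identity reads `1 + b x = a p`, so the inverse is `-b`; the other
      -- form reads `1 + a p = b x`, and `b` itself is the inverse.
      inv (Bézout.+- a b e) = ⊖ fromN b , (begin
        x ⊗ (⊖ fromN b)            ≡⟨ 𝔽P.-‿distribʳ-* x (fromN b) ⟨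
        ⊖ (x ⊗ fromN b)            ≡⟨ cong (λ z → ⊖ (z ⊗ fromN b)) (fromN-toℕ x) ⟨
        ⊖ (fromN (toℕ x) ⊗ fromN b) ≡⟨ cong ⊖_ (trans (fromN-* _ _) (cong fromN (ℕP.*-comm (toℕ x) b))) ⟩
        ⊖ (fromN (b * toℕ x))
          ≡⟨ 𝔽P.+-inverseˡ-unique 1p (fromN (b * toℕ x))
            (trans (fromN-+ 1 _) (trans (cong fromN e) (∣⇒≡0 _ (divides a refl)))) ⟨
        1p ∎)
        where open ≡-Reasoning
      inv (Bézout.-+ a b e) = fromN b , (begin
        x ⊗ fromN b                ≡⟨ cong (_⊗ fromN b) (fromN-toℕ x) ⟨
        fromN (toℕ x) ⊗ fromN b    ≡⟨ fromN-* _ _ ⟩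
        fromN (toℕ x * b)          ≡⟨ cong fromN (trans (ℕP.*-comm (toℕ x) b) (sym e)) ⟩
        fromN (1 + a * p)          ≡⟨ fromN-+ 1 (a * p) ⟨
        1p ⊕ fromN (a * p)         ≡⟨ cong (1p ⊕_) (∣⇒≡0 _ (divides a refl)) ⟩
        1p ⊕ 0p                    ≡⟨ 𝔽.+-identityʳ 1p ⟩
        1p ∎)
        where open ≡-Reasoning

    ⊗-zero-product : ∀ x y → x ⊗ y ≡ 0p → x ≢ 0p → y ≡ 0p
    ⊗-zero-product x y e x≢0 with z , xz ← ⊗-inverse x x≢0 = begin
      y            ≡⟨ 𝔽.*-identityˡ y ⟨
      1p ⊗ y       ≡⟨ cong (_⊗ y) (trans (sym xz) (⊗-comm x z)) ⟩
      (z ⊗ x) ⊗ y  ≡⟨ ⊗-assoc z x y ⟩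
      z ⊗ (x ⊗ y)  ≡⟨ cong (z ⊗_) e ⟩
      z ⊗ 0p       ≡⟨ 𝔽.zeroʳ z ⟩
      0p ∎
      where open ≡-Reasoning

-- The commutative ring of polynomials over the residues.

module Polynomials (p : ℕ) .{{_ : NonZero p}} where
  open Fp p
  open Residues p
  private
    module ⊕P = CommutativeSemigroupP 𝔽.+-commutativeSemigroup
    module ⊗P = CommutativeSemigroupP 𝔽.*-commutativeSemigroup

  -- _≈P_ unfolds to a function type, which defeats inference of the polynomials; hence the record.
  infix 4 _≃_
  record _≃_ (f g : Poly) : Set where
    constructor pointwise
    field at : f ≈P g
  open _≃_ public

  ≃-refl : ∀ {f} → f ≃ f
  ≃-refl = pointwise λ _ → refl

  ≃-sym : ∀ {f g} → f ≃ g → g ≃ f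
  ≃-sym e = pointwise λ i → sym (at e i)

  ≃-trans : ∀ {f g h} → f ≃ g → g ≃ h → f ≃ h
  ≃-trans e e' = pointwise λ i → trans (at e i) (at e' i)

  coeff-addP : ∀ f g i → coeffP (addP f g) i ≡ coeffP f i ⊕ coeffP g i
  coeff-addP []      g       i       = sym (𝔽.+-identityˡ _)
  coeff-addP (a ∷ f) []      i       = sym (𝔽.+-identityʳ _)
  coeff-addP (a ∷ f) (b ∷ g) zero    = refl
  coeff-addP (a ∷ f) (b ∷ g) (suc i) = coeff-addP f g i

  coeff-scaleP : ∀ c f i → coeffP (scaleP c f) i ≡ c ⊗ coeffP f i
  coeff-scaleP c []      i       = sym (𝔽.zeroʳ c)
  coeff-scaleP c (a ∷ f) zero    = refl
  coeff-scaleP c (a ∷ f) (suc i) = coeff-scaleP c f i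

  negP : Poly → Poly
  negP = map ⊖_

  coeff-negP : ∀ f i → coeffP (negP f) i ≡ ⊖ coeffP f i
  coeff-negP []      i       = sym 𝔽P.-0#≈0#
  coeff-negP (a ∷ f) zero    = refl
  coeff-negP (a ∷ f) (suc i) = coeff-negP f i

  ∷-cong : ∀ {a b f g} → a ≡ b → f ≃ g → a ∷ f ≃ b ∷ g
  ∷-cong e e' = pointwise λ { zero → e ; (suc i) → at e' i }

  tail-≃ : ∀ {a b f g} → a ∷ f ≃ b ∷ g → f ≃ g
  tail-≃ e = pointwise (at e ∘ suc)

  tail-≃[] : ∀ {a f} → a ∷ f ≃ [] → f ≃ []
  tail-≃[] e = pointwise (at e ∘ suc)

  0∷[] : ∀ {f} → f ≃ [] → 0p ∷ f ≃ []
  0∷[] e = pointwise λ { zero → refl ; (suc i) → at e i }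

  addP-cong : ∀ {f f' g g'} → f ≃ f' → g ≃ g' → addP f g ≃ addP f' g'
  addP-cong {f} {f'} {g} {g'} e e' = pointwise λ i →
    trans (coeff-addP f g i) (trans (cong₂ _⊕_ (at e i) (at e' i)) (sym (coeff-addP f' g' i)))

  scaleP-cong : ∀ {c d f g} → c ≡ d → f ≃ g → scaleP c f ≃ scaleP d g
  scaleP-cong {c} {d} {f} {g} e e' = pointwise λ i →
    trans (coeff-scaleP c f i) (trans (cong₂ _⊗_ e (at e' i)) (sym (coeff-scaleP d g i)))

  addP-comm : ∀ f g → addP f g ≃ addP g f
  addP-comm f g = pointwise λ i →
    trans (coeff-addP f g i) (trans (⊕-comm (coeffP f i) (coeffP g i)) (sym (coeff-addP g f i)))

  addP-assoc : ∀ f g h → addP (addP f g) h ≃ addP f (addP g h)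
  addP-assoc f g h = pointwise λ i → begin
    coeffP (addP (addP f g) h) i                ≡⟨ coeff-addP (addP f g) h i ⟩
    coeffP (addP f g) i ⊕ coeffP h i            ≡⟨ cong (_⊕ coeffP h i) (coeff-addP f g i) ⟩
    (coeffP f i ⊕ coeffP g i) ⊕ coeffP h i      ≡⟨ ⊕-assoc (coeffP f i) (coeffP g i) (coeffP h i) ⟩
    coeffP f i ⊕ (coeffP g i ⊕ coeffP h i)      ≡⟨ cong (coeffP f i ⊕_) (coeff-addP g h i) ⟨
    coeffP f i ⊕ coeffP (addP g h) i            ≡⟨ coeff-addP f (addP g h) i ⟨
    coeffP (addP f (addP g h)) i                ∎
    where open ≡-Reasoning

  addP-identityʳ : ∀ f → addP f [] ≃ f
  addP-identityʳ []      = ≃-refl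
  addP-identityʳ (_ ∷ _) = ≃-refl

  addP-inverseʳ : ∀ f → addP f (negP f) ≃ []
  addP-inverseʳ f = pointwise λ i →
    trans (coeff-addP f (negP f) i) (trans (cong (coeffP f i ⊕_) (coeff-negP f i)) (𝔽.-‿inverseʳ _))

  addP-interchange : ∀ a b c d → addP (addP a b) (addP c d) ≃ addP (addP a c) (addP b d)
  addP-interchange a b c d = pointwise λ i → begin
    coeffP (addP (addP a b) (addP c d)) i
      ≡⟨ trans (coeff-addP (addP a b) (addP c d) i) (cong₂ _⊕_ (coeff-addP a b i) (coeff-addP c d i)) ⟩
    (coeffP a i ⊕ coeffP b i) ⊕ (coeffP c i ⊕ coeffP d i)
      ≡⟨ ⊕P.interchange (coeffP a i) (coeffP b i) (coeffP c i) (coeffP d i) ⟩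
    (coeffP a i ⊕ coeffP c i) ⊕ (coeffP b i ⊕ coeffP d i)
      ≡⟨ trans (coeff-addP (addP a c) (addP b d) i) (cong₂ _⊕_ (coeff-addP a c i) (coeff-addP b d i)) ⟨
    coeffP (addP (addP a c) (addP b d)) i ∎
    where open ≡-Reasoning

  scaleP-addP : ∀ c f g → scaleP c (addP f g) ≃ addP (scaleP c f) (scaleP c g)
  scaleP-addP c f g = pointwise λ i → begin
    coeffP (scaleP c (addP f g)) i              ≡⟨ trans (coeff-scaleP c (addP f g) i) (cong (c ⊗_) (coeff-addP f g i)) ⟩
    c ⊗ (coeffP f i ⊕ coeffP g i)               ≡⟨ ⊗-distribˡ c (coeffP f i) (coeffP g i) ⟩
    (c ⊗ coeffP f i) ⊕ (c ⊗ coeffP g i)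
      ≡⟨ trans (coeff-addP (scaleP c f) (scaleP c g) i) (cong₂ _⊕_ (coeff-scaleP c f i) (coeff-scaleP c g i)) ⟨
    coeffP (addP (scaleP c f) (scaleP c g)) i   ∎
    where open ≡-Reasoning

  scaleP-⊕ : ∀ c d f → scaleP (c ⊕ d) f ≃ addP (scaleP c f) (scaleP d f)
  scaleP-⊕ c d f = pointwise λ i → begin
    coeffP (scaleP (c ⊕ d) f) i                 ≡⟨ coeff-scaleP (c ⊕ d) f i ⟩
    (c ⊕ d) ⊗ coeffP f i                        ≡⟨ 𝔽.distribʳ (coeffP f i) c d ⟩
    (c ⊗ coeffP f i) ⊕ (d ⊗ coeffP f i)
      ≡⟨ trans (coeff-addP (scaleP c f) (scaleP d f) i) (cong₂ _⊕_ (coeff-scaleP c f i) (coeff-scaleP d f i)) ⟨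
    coeffP (addP (scaleP c f) (scaleP d f)) i   ∎
    where open ≡-Reasoning

  scaleP-⊗ : ∀ c d f → scaleP (c ⊗ d) f ≃ scaleP c (scaleP d f)
  scaleP-⊗ c d f = pointwise λ i → begin
    coeffP (scaleP (c ⊗ d) f) i        ≡⟨ coeff-scaleP (c ⊗ d) f i ⟩
    (c ⊗ d) ⊗ coeffP f i               ≡⟨ ⊗-assoc c d (coeffP f i) ⟩
    c ⊗ (d ⊗ coeffP f i)               ≡⟨ trans (coeff-scaleP c (scaleP d f) i) (cong (c ⊗_) (coeff-scaleP d f i)) ⟨
    coeffP (scaleP c (scaleP d f)) i   ∎
    where open ≡-Reasoning

  scaleP-1 : ∀ f → scaleP 1p f ≃ f
  scaleP-1 f = pointwise λ i → trans (coeff-scaleP 1p f i) (𝔽.*-identityˡ _)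

  scaleP-0 : ∀ f → scaleP 0p f ≃ []
  scaleP-0 f = pointwise λ i → trans (coeff-scaleP 0p f i) (𝔽.zeroˡ _)

  scaleP-0∷ : ∀ c f → scaleP c (0p ∷ f) ≃ 0p ∷ scaleP c f
  scaleP-0∷ c f = ∷-cong (𝔽.zeroʳ c) ≃-refl

  0∷-addP : ∀ f g → 0p ∷ addP f g ≃ addP (0p ∷ f) (0p ∷ g)
  0∷-addP f g = ∷-cong (sym (𝔽.+-identityˡ 0p)) ≃-refl

  mulP-zeroˡ : ∀ {f} g → f ≃ [] → mulP f g ≃ []
  mulP-zeroˡ {[]}    g e = ≃-refl
  mulP-zeroˡ {a ∷ f} g e =
    addP-cong (≃-trans (scaleP-cong {a} {0p} {g} {g} (at e 0) ≃-refl) (scaleP-0 g)) (0∷[] (mulP-zeroˡ g (tail-≃[] e)))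

  mulP-congʳ : ∀ f {g g'} → g ≃ g' → mulP f g ≃ mulP f g'
  mulP-congʳ []      e = ≃-refl
  mulP-congʳ (a ∷ f) e = addP-cong (scaleP-cong {a} refl e) (∷-cong refl (mulP-congʳ f e))

  mulP-congˡ : ∀ {f f'} g → f ≃ f' → mulP f g ≃ mulP f' g
  mulP-congˡ {[]}    {f'}    g e = ≃-sym (mulP-zeroˡ g (≃-sym e))
  mulP-congˡ {a ∷ f} {[]}    g e = mulP-zeroˡ {a ∷ f} g e
  mulP-congˡ {a ∷ f} {b ∷ f'} g e =
    addP-cong (scaleP-cong {a} {b} {g} {g} (at e 0) ≃-refl) (∷-cong refl (mulP-congˡ g (tail-≃ e)))

  mulP-cong : ∀ {f f' g g'} → f ≃ f' → g ≃ g' → mulP f g ≃ mulP f' g'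
  mulP-cong {f' = f'} {g = g} e e' = ≃-trans (mulP-congˡ g e) (mulP-congʳ f' e')

  mulP-distribʳ : ∀ h f g → mulP (addP f g) h ≃ addP (mulP f h) (mulP g h)
  mulP-distribʳ h []      g       = ≃-refl
  mulP-distribʳ h (a ∷ f) []      = ≃-sym (addP-identityʳ _)
  mulP-distribʳ h (a ∷ f) (b ∷ g) = ≃-trans
    (addP-cong (scaleP-⊕ a b h) (≃-trans (∷-cong refl (mulP-distribʳ h f g)) (0∷-addP (mulP f h) (mulP g h))))
    (addP-interchange (scaleP a h) (scaleP b h) (0p ∷ mulP f h) (0p ∷ mulP g h))

  mulP-scaleˡ : ∀ c f g → mulP (scaleP c f) g ≃ scaleP c (mulP f g)
  mulP-scaleˡ c []      g = ≃-refl
  mulP-scaleˡ c (a ∷ f) g = ≃-trans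
    (addP-cong (scaleP-⊗ c a g) (≃-trans (∷-cong refl (mulP-scaleˡ c f g)) (≃-sym (scaleP-0∷ c (mulP f g)))))
    (≃-sym (scaleP-addP c (scaleP a g) (0p ∷ mulP f g)))

  mulP-0∷ˡ : ∀ f g → mulP (0p ∷ f) g ≃ 0p ∷ mulP f g
  mulP-0∷ˡ f g = addP-cong (scaleP-0 g) ≃-refl

  mulP-assoc : ∀ f g h → mulP (mulP f g) h ≃ mulP f (mulP g h)
  mulP-assoc []      g h = ≃-refl
  mulP-assoc (a ∷ f) g h = ≃-trans (mulP-distribʳ h (scaleP a g) (0p ∷ mulP f g))
    (addP-cong (mulP-scaleˡ a g h) (≃-trans (mulP-0∷ˡ (mulP f g) h) (∷-cong refl (mulP-assoc f g h))))

  mulP-zeroʳ : ∀ f → mulP f [] ≃ []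
  mulP-zeroʳ []      = ≃-refl
  mulP-zeroʳ (a ∷ f) = 0∷[] (mulP-zeroʳ f)

  -- `mulP` recurses on its left factor; this is the mirrored recursion on the right factor, from
  -- which commutativity follows by induction.
  mulP-∷ʳ : ∀ f b g → mulP f (b ∷ g) ≃ addP (scaleP b f) (0p ∷ mulP f g)
  mulP-∷ʳ []      b g = ≃-sym (0∷[] ≃-refl)
  mulP-∷ʳ (a ∷ f) b g = ∷-cong (cong (_⊕ 0p) (⊗-comm a b)) (≃-trans
    (addP-cong (≃-refl {scaleP a g}) (mulP-∷ʳ f b g)) (≃-trans
    (≃-sym (addP-assoc (scaleP a g) (scaleP b f) (0p ∷ mulP f g))) (≃-trans
    (addP-cong (addP-comm (scaleP a g) (scaleP b f)) (≃-refl {0p ∷ mulP f g}))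
    (addP-assoc (scaleP b f) (scaleP a g) (0p ∷ mulP f g)))))

  mulP-comm : ∀ f g → mulP f g ≃ mulP g f
  mulP-comm []      g = ≃-sym (mulP-zeroʳ g)
  mulP-comm (a ∷ f) g = ≃-trans (addP-cong (≃-refl {scaleP a g}) (∷-cong refl (mulP-comm f g))) (≃-sym (mulP-∷ʳ g a f))

  oneP : Poly
  oneP = 1p ∷ []

  mulP-identityˡ : ∀ f → mulP oneP f ≃ f
  mulP-identityˡ f = ≃-trans (addP-cong (scaleP-1 f) (0∷[] ≃-refl)) (addP-identityʳ f)

  PolyIsCommutativeRing : IsCommutativeRing _≃_ addP mulP negP [] oneP
  PolyIsCommutativeRing = record
    { isRing = record
      { +-isAbelianGroup = record
        { isGroup = record
          { isMonoid = record
            { isSemigroup = record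
              { isMagma = record
                { isEquivalence = record { refl = ≃-refl ; sym = ≃-sym ; trans = ≃-trans }
                ; ∙-cong = addP-cong }
              ; assoc = addP-assoc }
            ; identity = (λ f → ≃-refl) , addP-identityʳ }
          ; inverse = (λ f → ≃-trans (addP-comm (negP f) f) (addP-inverseʳ f)) , addP-inverseʳ
          ; ⁻¹-cong = λ {f} {g} e → pointwise λ i →
              trans (coeff-negP f i) (trans (cong ⊖_ (at e i)) (sym (coeff-negP g i))) }
        ; comm = addP-comm }
      ; *-cong = mulP-cong
      ; *-assoc = mulP-assoc
      ; *-identity = mulP-identityˡ , λ f → ≃-trans (mulP-comm f oneP) (mulP-identityˡ f)
      ; distrib = (λ f g h → ≃-trans (mulP-comm f (addP g h)) (≃-trans (mulP-distribʳ f g h)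
                    (addP-cong (mulP-comm g f) (mulP-comm h f)))) , mulP-distribʳ }
    ; *-comm = mulP-comm }

  PolyRing : CommutativeRing _ _
  PolyRing = record { isCommutativeRing = PolyIsCommutativeRing }

  module ℙ = CommutativeRing PolyRing
  module ℙP = RingP ℙ.ring

  mulP-constˡ : ∀ c g → mulP (c ∷ []) g ≃ scaleP c g
  mulP-constˡ c g = ≃-trans (addP-cong (≃-refl {scaleP c g}) (0∷[] ≃-refl)) (addP-identityʳ _)

-- Degrees, division with remainder, coprimality and gcds.

module Division (p : ℕ) .{{_ : NonZero p}} (pp : Prime p) where
  open Fp p
  open Residues p
  open Polynomials p
  open SemiringSolver ℙ.commutativeSemiring using (solve; _:+_; _:*_; _:=_)
  module ≃-Reasoning = SetoidReasoning ℙ.setoid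

  Deg< : Poly → ℕ → Set
  Deg< f N = ∀ i → N ≤ i → coeffP f i ≡ 0p

  -- `c` may be 0, so any polynomial with a degree bound has such a certificate and products can be
  -- treated uniformly. Where the true degree matters, `c ≢ 0p` is a separate hypothesis.
  HasLead : Poly → ℕ → Fin p → Set
  HasLead f d c = coeffP f d ≡ c × Deg< f (suc d)

  Deg<-length : ∀ f → Deg< f (length f)
  Deg<-length []      i       _       = refl
  Deg<-length (a ∷ f) (suc i) (s≤s h) = Deg<-length f i h

  Deg<-cong : ∀ {f g N} → f ≃ g → Deg< f N → Deg< g N
  Deg<-cong e h i l = trans (sym (at e i)) (h i l)

  HasLead-cong : ∀ {f g d c} → f ≃ g → HasLead f d c → HasLead g d c
  HasLead-cong {f} {g} {d} e (h , h') = trans (sym (at e d)) h , Deg<-cong e h'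

  Deg<-mono : ∀ {f M N} → M ≤ N → Deg< f M → Deg< f N
  Deg<-mono m h i l = h i (ℕP.≤-trans m l)

  Deg<-[] : ∀ N → Deg< [] N
  Deg<-[] N i _ = refl

  Deg<0 : ∀ f → Deg< f 0 → f ≃ []
  Deg<0 f h = pointwise λ i → h i z≤n

  Deg<-addP : ∀ f g {N} → Deg< f N → Deg< g N → Deg< (addP f g) N
  Deg<-addP f g h h' i l = trans (coeff-addP f g i) (trans (cong₂ _⊕_ (h i l) (h' i l)) (𝔽.+-identityʳ 0p))

  Deg<-scaleP : ∀ c f {N} → Deg< f N → Deg< (scaleP c f) N
  Deg<-scaleP c f h i l = trans (coeff-scaleP c f i) (trans (cong (c ⊗_) (h i l)) (𝔽.zeroʳ c))

  Deg<-∷ : ∀ a f {N} → Deg< f N → Deg< (a ∷ f) (suc N)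
  Deg<-∷ a f h (suc i) (s≤s l) = h i l

  Deg<-tail : ∀ a f {N} → Deg< (a ∷ f) (suc N) → Deg< f N
  Deg<-tail a f h i l = h (suc i) (s≤s l)

  HasLead-scaleP : ∀ c {f d a} → HasLead f d a → HasLead (scaleP c f) d (c ⊗ a)
  HasLead-scaleP c {f} {d} (h , h') = trans (coeff-scaleP c f d) (cong (c ⊗_) h) , Deg<-scaleP c f h'

  HasLead-mulP : ∀ {f g d e a b} → HasLead f d a → HasLead g e b → HasLead (mulP f g) (d + e) (a ⊗ b)
  HasLead-mulP {[]} {b = b} (refl , h) _ = sym (𝔽.zeroˡ b) , Deg<-[] _
  HasLead-mulP {x ∷ f} {g} {zero} {e} {a} (refl , h) hg =
    HasLead-cong {f = scaleP a g}
      (≃-sym (≃-trans (addP-cong (≃-refl {scaleP a g}) (0∷[] (mulP-zeroˡ {f} g (Deg<0 f (Deg<-tail a f h)))))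
        (addP-identityʳ _)))
      (HasLead-scaleP a {g} hg)
  HasLead-mulP {x ∷ f} {g} {suc d} {e} {a} {b} (hf , h) hg@(_ , hg')
    with l , h' ← HasLead-mulP {f} {g} {d} {e} (hf , Deg<-tail x f h) hg =
    (begin
      coeffP (addP (scaleP x g) (0p ∷ mulP f g)) (suc (d + e))
        ≡⟨ coeff-addP (scaleP x g) _ (suc (d + e)) ⟩
      coeffP (scaleP x g) (suc (d + e)) ⊕ coeffP (mulP f g) (d + e)
        ≡⟨ cong₂ _⊕_ (Deg<-scaleP x g hg' _ (s≤s (ℕP.m≤n+m e d))) l ⟩
      0p ⊕ (a ⊗ b)  ≡⟨ 𝔽.+-identityˡ (a ⊗ b) ⟩
      a ⊗ b ∎) ,
    Deg<-addP (scaleP x g) (0p ∷ mulP f g)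
      (Deg<-mono {scaleP x g} (s≤s (ℕP.m≤n+m e (suc d))) (Deg<-scaleP x g hg')) (Deg<-∷ 0p (mulP f g) h')
    where open ≡-Reasoning

  Deg<-mulP : ∀ f g {M e} → Deg< f M → Deg< g (suc e) → Deg< (mulP f g) (M + e)
  Deg<-mulP f g {zero}  hf hg = Deg<-cong {[]} {mulP f g} (≃-sym (mulP-zeroˡ {f} g (Deg<0 f hf))) (Deg<-[] _)
  Deg<-mulP f g {suc d} hf hg = proj₂ (HasLead-mulP {f} {g} (refl , hf) (refl , hg))

  Nonzero : Poly → Set
  Nonzero f = Σ ℕ λ d → Σ (Fin p) λ c → c ≢ 0p × HasLead f d c

  zero-or-lead : ∀ f → (f ≃ []) ⊎ Nonzero f
  zero-or-lead [] = inj₁ ≃-refl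
  zero-or-lead (a ∷ f) with zero-or-lead f
  ... | inj₂ (d , c , c≢0 , h , h') = inj₂ (suc d , c , c≢0 , h , Deg<-∷ a f h')
  ... | inj₁ e with a Fin.≟ 0p
  ...   | yes refl = inj₁ (0∷[] e)
  ...   | no  a≢0  = inj₂ (0 , a , a≢0 , refl , Deg<-∷ a f (λ i _ → at e i))

  lead≢0⇒≄[] : ∀ {f d c} → c ≢ 0p → HasLead f d c → ¬ (f ≃ [])
  lead≢0⇒≄[] {d = d} c≢0 (h , _) e = c≢0 (trans (sym h) (at e d))

  ≃[]? : ∀ f → Dec (f ≃ [])
  ≃[]? f with zero-or-lead f
  ... | inj₁ e = yes e
  ... | inj₂ (d , c , c≢0 , h) = no (lead≢0⇒≄[] {f} c≢0 h)

  ⊗-≢0 : ∀ {a b} → a ≢ 0p → b ≢ 0p → a ⊗ b ≢ 0p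
  ⊗-≢0 {a} {b} a≢0 b≢0 e = b≢0 (⊗-zero-product pp a b e a≢0)

  lead-≤ : ∀ {f d c N} → c ≢ 0p → HasLead f d c → Deg< f N → d < N
  lead-≤ {f} {d} {c} {N} c≢0 (h , _) l with d ℕ.<? N
  ... | yes q = q
  ... | no  q = ⊥-elim (c≢0 (trans (sym h) (l d (ℕP.≮⇒≥ q))))

  lead-unique : ∀ {f d c e a} → c ≢ 0p → a ≢ 0p → HasLead f d c → HasLead f e a → d ≡ e
  lead-unique {f} c≢0 a≢0 h h' = ℕP.≤-antisym
    (ℕP.≤-pred (lead-≤ {f} c≢0 h (proj₂ h'))) (ℕP.≤-pred (lead-≤ {f} a≢0 h' (proj₂ h)))

  -- Nonzero leading coefficients have a nonzero product, so degrees add. Cancellation and the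
  -- uniqueness of quotients rest on this.
  mulP-Deg<-lead : ∀ {f d c} g {N} → c ≢ 0p → HasLead f d c → Deg< (mulP f g) (d + N) → Deg< g N
  mulP-Deg<-lead {f} {d} {c} g {N} c≢0 hf h with zero-or-lead g
  ... | inj₁ e = Deg<-cong (≃-sym e) (Deg<-[] N)
  ... | inj₂ (e , b , b≢0 , hg) = Deg<-mono {g}
        (ℕP.+-cancelˡ-≤ d (suc e) N (ℕP.≤-trans (ℕP.≤-reflexive (ℕP.+-suc d e))
          (lead-≤ {mulP f g} (⊗-≢0 c≢0 b≢0) (HasLead-mulP {f} {g} hf hg) h))) (proj₂ hg)

  mulP-zero-product : ∀ {f d c} g → c ≢ 0p → HasLead f d c → mulP f g ≃ [] → g ≃ []
  mulP-zero-product {f} {d} g c≢0 hf e =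
    Deg<0 g (mulP-Deg<-lead {f} {d} g {0} c≢0 hf (λ i _ → at e i))

  subP : Poly → Poly → Poly
  subP f g = addP f (negP g)

  subP≃[] : ∀ {f g} → subP f g ≃ [] → f ≃ g
  subP≃[] {f} {g} = ℙP.x∙y⁻¹≈ε⇒x≈y f g

  mulP-subP : ∀ f g h → mulP f (subP g h) ≃ subP (mulP f g) (mulP f h)
  mulP-subP = ℙP.x[y-z]≈xy-xz

  mulP-cancelˡ : ∀ {f d c g h} → c ≢ 0p → HasLead f d c → mulP f g ≃ mulP f h → g ≃ h
  mulP-cancelˡ {f} {g = g} {h} c≢0 hf e = subP≃[] (mulP-zero-product {f} (subP g h) c≢0 hf
    (≃-trans (mulP-subP f g h) (≃-trans (addP-cong e (≃-refl {negP (mulP f h)})) (addP-inverseʳ (mulP f h)))))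

  strip-[] : ∀ {f} → f ≃ [] → strip f ≡ []
  strip-[] {[]} e = refl
  strip-[] {a ∷ f} e rewrite strip-[] (tail-≃[] e) with a Fin.≟ 0p
  ... | yes _   = refl
  ... | no  a≢0 = ⊥-elim (a≢0 (at e 0))

  strip-≃ : ∀ f → strip f ≃ f
  strip-≃ [] = ≃-refl
  strip-≃ (a ∷ f) with strip f | strip-≃ f
  ... | r ∷ rs | e = ∷-cong refl e
  ... | []     | e with a Fin.≟ 0p
  ...   | yes refl = ≃-sym (0∷[] (≃-sym e))
  ...   | no  _    = ∷-cong refl e

  length-strip : ∀ {f d c} → c ≢ 0p → HasLead f d c → length (strip f) ≡ suc d
  length-strip {[]} c≢0 (h , _) = ⊥-elim (c≢0 (sym h))
  length-strip {a ∷ f} {zero} c≢0 (h , h') rewrite strip-[] {f} (Deg<0 f (Deg<-tail a f h')) with a Fin.≟ 0p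
  ... | yes e = ⊥-elim (c≢0 (trans (sym h) e))
  ... | no  _ = refl
  length-strip {a ∷ f} {suc d} c≢0 (h , h') with strip f | length-strip {f} c≢0 (h , Deg<-tail a f h')
  ... | r ∷ rs | e = cong suc e

  degP-lead : ∀ {f d c} → c ≢ 0p → HasLead f d c → degP f ≡ d
  degP-lead {f} c≢0 h = cong (_∸ 1) (length-strip {f} c≢0 h)

  degP-[] : ∀ {f} → f ≃ [] → degP f ≡ 0
  degP-[] e = cong (λ g → length g ∸ 1) (strip-[] e)

  monic-lead : ∀ {f} → Monic f → HasLead f (degP f) 1p
  monic-lead {f} m with zero-or-lead f
  ... | inj₁ e = ⊥-elim (1p≢0p pp (trans (sym m) (at e (degP f))))
  ... | inj₂ (d , c , c≢0 , h) = subst (λ e → HasLead f e 1p) (sym (degP-lead {f} c≢0 h))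
        (subst (λ e → coeffP f e ≡ 1p) (degP-lead {f} c≢0 h) m , proj₂ h)

  degree0 : ∀ f → degP f ≡ 0 → f ≃ coeffP f 0 ∷ []
  degree0 f e with zero-or-lead f
  ... | inj₁ z = ≃-trans z (≃-sym (≃-trans (∷-cong (at z 0) (≃-refl {[]})) (0∷[] ≃-refl)))
  ... | inj₂ (d , c , c≢0 , hd , h) with refl ← trans (sym (degP-lead {f} c≢0 (hd , h))) e =
        pointwise λ { zero → refl ; (suc i) → h (suc i) (s≤s z≤n) }

  infix 4 _∣P_
  _∣P_ : Poly → Poly → Set
  f ∣P g = Σ Poly λ k → g ≃ mulP f k

  -- Recursion on the dividend: `f = g k + ρ` gives `a + x f = g (x k) + (a + x ρ)`, whose remainder
  -- has degree at most `d`; subtracting one scalar multiple of `g` removes the coefficient at `d`.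
  divide : ∀ {g d c} → c ≢ 0p → HasLead g d c → ∀ f → Σ Poly λ k → Σ Poly λ ρ → f ≃ addP (mulP g k) ρ × Deg< ρ d
  divide {g} c≢0 hg [] = [] , [] , ≃-sym (≃-trans (addP-identityʳ _) (mulP-zeroʳ g)) , Deg<-[] _
  divide {g} {d} {c} c≢0 hg@(gd , g<) (a ∷ f)
    with k , ρ , e , ρ< ← divide {g} c≢0 hg f | c⁻¹ , cc ← ⊗-inverse pp c c≢0 =
    t ∷ k , ρ' , eq , ρ'<
    where
    t = coeffP (a ∷ ρ) d ⊗ c⁻¹
    ρ' = subP (a ∷ ρ) (scaleP t g)
    tc : t ⊗ c ≡ coeffP (a ∷ ρ) d
    tc = trans (⊗-assoc (coeffP (a ∷ ρ) d) c⁻¹ c) (trans (cong (coeffP (a ∷ ρ) d ⊗_) (trans (⊗-comm c⁻¹ c) cc))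
        (𝔽.*-identityʳ (coeffP (a ∷ ρ) d)))
    top : ∀ i → d ≤ i → coeffP (a ∷ ρ) i ≡ t ⊗ coeffP g i
    top i l with ℕP.m≤n⇒m<n∨m≡n l
    ... | inj₂ refl = trans (sym tc) (cong (t ⊗_) (sym gd))
    ... | inj₁ l' = trans (Deg<-∷ a ρ ρ< i l') (sym (trans (cong (t ⊗_) (g< i l')) (𝔽.zeroʳ t)))
    ρ'< : Deg< ρ' d
    ρ'< i l = trans (coeff-addP (a ∷ ρ) (negP (scaleP t g)) i) (trans
      (cong₂ _⊕_ (top i l) (trans (coeff-negP (scaleP t g) i) (cong ⊖_ (coeff-scaleP t g i))))
        (𝔽.-‿inverseʳ (t ⊗ coeffP g i)))
    eq : a ∷ f ≃ addP (mulP g (t ∷ k)) ρ'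
    eq = ≃-sym (begin
      addP (mulP g (t ∷ k)) ρ'
        ≈⟨ addP-cong (mulP-∷ʳ g t k) (≃-refl {ρ'}) ⟩
      addP (addP (scaleP t g) (0p ∷ mulP g k)) (addP (a ∷ ρ) (negP (scaleP t g)))
        ≈⟨ solve 4 (λ x y z w → (x :+ y) :+ (z :+ w) := (y :+ z) :+ (x :+ w)) ≃-refl
             (scaleP t g) (0p ∷ mulP g k) (a ∷ ρ) (negP (scaleP t g)) ⟩
      addP (addP (0p ∷ mulP g k) (a ∷ ρ)) (addP (scaleP t g) (negP (scaleP t g)))
        ≈⟨ addP-cong (≃-refl {addP (0p ∷ mulP g k) (a ∷ ρ)}) (addP-inverseʳ (scaleP t g)) ⟩
      addP (addP (0p ∷ mulP g k) (a ∷ ρ)) []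
        ≈⟨ addP-identityʳ _ ⟩
      addP (0p ∷ mulP g k) (a ∷ ρ)
        ≈⟨ ∷-cong (𝔽.+-identityˡ a) (≃-sym e) ⟩
      a ∷ f ∎)
      where open ≃-Reasoning

  -- The remainder equals `g (k' - k)` and has degree below that of `g`, which forces `k' - k = 0`.
  divide-unique : ∀ {g d c} → c ≢ 0p → HasLead g d c → ∀ {f k ρ} k' → f ≃ addP (mulP g k) ρ → Deg< ρ d →
                  f ≃ mulP g k' → k' ≃ k
  divide-unique {g} {d} c≢0 hg {f} {k} {ρ} k' e ρ< e' =
      subP≃[] (Deg<0 (subP k' k) (mulP-Deg<-lead {g} {d} (subP k' k) {0} c≢0 hg
      (subst (Deg< (mulP g (subP k' k))) (sym (ℕP.+-identityʳ d)) (Deg<-cong {ρ} difference ρ<))))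
    where
    open ≃-Reasoning
    difference : ρ ≃ mulP g (subP k' k)
    difference = begin
      ρ                                  ≈⟨ addP-identityʳ ρ ⟨
      addP ρ []                          ≈⟨ addP-cong (≃-refl {ρ}) (addP-inverseʳ (mulP g k)) ⟨
      addP ρ (subP (mulP g k) (mulP g k))
        ≈⟨ solve 3 (λ x y z → x :+ (y :+ z) := (y :+ x) :+ z) ≃-refl ρ (mulP g k) (negP (mulP g k)) ⟩
      subP (addP (mulP g k) ρ) (mulP g k) ≈⟨ addP-cong (≃-trans (≃-sym e) e') (≃-refl {negP (mulP g k)}) ⟩
      subP (mulP g k') (mulP g k)        ≈⟨ mulP-subP g k' k ⟨
      mulP g (subP k' k)                 ∎

  ∣P? : ∀ {g d c} → c ≢ 0p → HasLead g d c → ∀ f → Dec (g ∣P f)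
  ∣P? {g} {d} c≢0 hg f with k , ρ , e , ρ< ← divide {g} c≢0 hg f with ≃[]? ρ
  ... | yes z = yes (k , ≃-trans e (≃-trans (addP-cong (≃-refl {mulP g k}) z) (addP-identityʳ _)))
  ... | no ¬z = no λ { (k' , e') → ¬z (ℙP.+-cancelˡ (mulP g k) ρ [] (≃-trans (≃-sym e) (≃-trans e'
      (≃-trans (mulP-congʳ g (divide-unique {g} c≢0 hg {f} {k} {ρ} k' e ρ< e')) (≃-sym (addP-identityʳ _)))))) }

  ∣P-refl : ∀ {f} → f ∣P f
  ∣P-refl {f} = oneP , ≃-sym (ℙ.*-identityʳ f)

  ∣P-trans : ∀ {f g h} → f ∣P g → g ∣P h → f ∣P h
  ∣P-trans {f} (k , e) (l , e') = mulP k l , ≃-trans e' (≃-trans (mulP-congˡ l e) (mulP-assoc f k l))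

  ∣P-mulʳ : ∀ {f g} h → f ∣P g → f ∣P mulP g h
  ∣P-mulʳ {f} h (k , e) = mulP k h , ≃-trans (mulP-congˡ h e) (mulP-assoc f k h)

  ∣P-congʳ : ∀ {f g h} → g ≃ h → f ∣P g → f ∣P h
  ∣P-congʳ e (k , e') = k , ≃-trans (≃-sym e) e'

  ∣P-congˡ : ∀ {f g h} → f ≃ g → f ∣P h → g ∣P h
  ∣P-congˡ {f} {g} e (k , e') = k , ≃-trans e' (mulP-congˡ k e)

  mulP-mono-∣P : ∀ {f g h k} → f ∣P g → h ∣P k → mulP f h ∣P mulP g k
  mulP-mono-∣P {f} {g} {h} {k} (a , e) (b , e') = mulP a b , ≃-trans (mulP-cong e e')
    (solve 4 (λ f a h b → (f :* a) :* (h :* b) := (f :* h) :* (a :* b)) ≃-refl f a h b)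

  -- Coprimality is a Bézout identity, so it passes to products by pure algebra and can be applied
  -- as an identity of operators in the Frobenius map.
  Coprime : Poly → Poly → Set
  Coprime f g = Σ Poly λ u → Σ Poly λ v → addP (mulP u f) (mulP v g) ≃ oneP

  coprime-sym : ∀ {f g} → Coprime f g → Coprime g f
  coprime-sym {f} {g} (u , v , e) = v , u , ≃-trans (addP-comm (mulP v g) (mulP u f)) e

  coprime-one : ∀ f → Coprime oneP f
  coprime-one f = oneP , [] , ≃-trans (addP-identityʳ _) (mulP-identityˡ oneP)

  -- Multiply the two Bézout identities: every term except `(u f)(u' g)` contains `h`.
  coprime-mulP : ∀ {f g h} → Coprime f h → Coprime g h → Coprime (mulP f g) h
  coprime-mulP {f} {g} {h} (u , v , e) (u' , v' , e') =
    mulP u u' , addP (mulP v (addP (mulP u' g) (mulP v' h))) (mulP (mulP u f) v') , (begin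
      addP (mulP (mulP u u') (mulP f g)) (mulP (addP (mulP v (addP (mulP u' g) (mulP v' h))) (mulP (mulP u f) v')) h)
        ≈⟨ solve 7 (λ f g h u v u' v' → (u :* u') :* (f :* g) :+ (v :* (u' :* g :+ v' :* h) :+ (u :* f) :* v') :* h
                      := (u :* f :+ v :* h) :* (u' :* g :+ v' :* h)) ≃-refl f g h u v u' v' ⟩
      mulP (addP (mulP u f) (mulP v h)) (addP (mulP u' g) (mulP v' h)) ≈⟨ mulP-cong e e' ⟩
      mulP oneP oneP ≈⟨ mulP-identityˡ oneP ⟩
      oneP ∎)
    where open ≃-Reasoning

  coprime-powP : ∀ {f h} k → Coprime f h → Coprime (powP f k) h
  coprime-powP {h = h} zero c = coprime-one h
  coprime-powP {f} (suc k) c = coprime-mulP {f} {powP f k} c (coprime-powP k c)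

  -- Write `h = u f h + v g h`, and replace `h` by `g b` in the first term and by `f a` in the
  -- second.
  coprime-∣P : ∀ {f g h} → Coprime f g → f ∣P h → g ∣P h → mulP f g ∣P h
  coprime-∣P {f} {g} {h} (u , v , e) (a , ea) (b , eb) = addP (mulP u b) (mulP v a) , (begin
    h                                       ≈⟨ mulP-identityˡ h ⟨
    mulP oneP h                             ≈⟨ mulP-congˡ h e ⟨
    mulP (addP (mulP u f) (mulP v g)) h     ≈⟨ mulP-distribʳ h (mulP u f) (mulP v g) ⟩
    addP (mulP (mulP u f) h) (mulP (mulP v g) h)
      ≈⟨ addP-cong (mulP-congʳ (mulP u f) eb) (mulP-congʳ (mulP v g) ea) ⟩
    addP (mulP (mulP u f) (mulP g b)) (mulP (mulP v g) (mulP f a))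
      ≈⟨ solve 6 (λ f g u v a b → (u :* f) :* (g :* b) :+ (v :* g) :* (f :* a) := (f :* g) :* (u :* b :+ v :* a))
        ≃-refl f g u v a b ⟩
    mulP (mulP f g) (addP (mulP u b) (mulP v a)) ∎)
    where open ≃-Reasoning

  record GCD (f g : Poly) : Set where
    field
      d u v : Poly
      combination : d ≃ addP (mulP u f) (mulP v g)
      d∣f : d ∣P f
      d∣g : d ∣P g

  -- `N` bounds the degree of the second argument and drops at each division, which makes the
  -- recursion structural.
  euclid : ∀ N f g → Deg< g N → GCD f g
  euclid N f g h with zero-or-lead g
  ... | inj₁ z = record { d = f ; u = oneP ; v = []
        ; combination = ≃-sym (≃-trans (addP-identityʳ _) (mulP-identityˡ f))
        ; d∣f = ∣P-refl ; d∣g = [] , ≃-trans z (≃-sym (mulP-zeroʳ f)) }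
  euclid zero f g h | inj₂ (e , c , c≢0 , hg) = ⊥-elim (lead≢0⇒≄[] {g} c≢0 hg (Deg<0 g h))
  euclid (suc N) f g h | inj₂ (e , c , c≢0 , hg)
    with k , ρ , eq , ρ< ← divide {g} c≢0 hg f
    with record { d = d ; u = u ; v = v ; combination = comb ; d∣f = (a , ea) ; d∣g = (b , eb) }
         ← euclid N g ρ (Deg<-mono {ρ} (ℕP.≤-pred (lead-≤ {g} c≢0 hg h)) ρ<) =
    record { d = d ; u = v ; v = subP u (mulP v k)
           ; combination = ≃-sym (begin
               addP (mulP v f) (mulP (subP u (mulP v k)) g)
                 ≈⟨ addP-cong (mulP-congʳ v eq) (≃-refl {mulP (subP u (mulP v k)) g}) ⟩
               addP (mulP v (addP (mulP g k) ρ)) (mulP (addP u (negP (mulP v k))) g)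
                 ≈⟨ solve 6 (λ v g k ρ u w → v :* (g :* k :+ ρ) :+ (u :+ w) :* g
                              := (u :* g :+ v :* ρ) :+ g :* (v :* k :+ w)) ≃-refl v g k ρ u (negP (mulP v k)) ⟩
               addP (addP (mulP u g) (mulP v ρ)) (mulP g (subP (mulP v k) (mulP v k)))
                 ≈⟨ addP-cong (≃-sym comb) (≃-trans (mulP-congʳ g (addP-inverseʳ (mulP v k))) (mulP-zeroʳ g)) ⟩
               addP d [] ≈⟨ addP-identityʳ d ⟩
               d ∎)
           ; d∣f = addP (mulP a k) b , (begin
               f                                      ≈⟨ eq ⟩
               addP (mulP g k) ρ                      ≈⟨ addP-cong (mulP-congˡ k ea) eb ⟩
               addP (mulP (mulP d a) k) (mulP d b)
                 ≈⟨ solve 4 (λ d a k b → (d :* a) :* k :+ d :* b := d :* (a :* k :+ b)) ≃-refl d a k b ⟩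
               mulP d (addP (mulP a k) b)             ∎)
           ; d∣g = a , ea }
    where open ≃-Reasoning

  -- Let `d` be a gcd and `g = d a`. If `d` is constant, its Bézout combination scales to 1; if `a`
  -- is constant, `g` is an associate of `d` and so divides `k`.
  irreducible-dichotomy : ∀ {g} → Irreducible g → ∀ k → g ∣P k ⊎ Coprime g k
  irreducible-dichotomy {g} (1≤deg , irr) k
    with record { d = d ; u = u ; v = v ; combination = comb ; d∣f = (a , ea) ; d∣g = (b , eb) }
         ← euclid (length k) g k (Deg<-length k)
    = cases (irr d a (at ea))
    where
    open ≃-Reasoning
    g≄[] : ¬ (g ≃ [])
    g≄[] z with () ← subst (1 ≤_) (degP-[] z) 1≤deg
    cases : degP d ≡ 0 ⊎ degP a ≡ 0 → g ∣P k ⊎ Coprime g k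
    cases (inj₁ d0) with c⁻¹ , cc ← ⊗-inverse pp (coeffP d 0)
                      (λ z → g≄[] (≃-trans ea (mulP-zeroˡ a
                        (≃-trans (degree0 d d0) (≃-trans (∷-cong z ≃-refl) (0∷[] ≃-refl)))))) =
      inj₂ (scaleP c⁻¹ u , scaleP c⁻¹ v , (begin
        addP (mulP (scaleP c⁻¹ u) g) (mulP (scaleP c⁻¹ v) k)
          ≈⟨ addP-cong (mulP-scaleˡ c⁻¹ u g) (mulP-scaleˡ c⁻¹ v k) ⟩
        addP (scaleP c⁻¹ (mulP u g)) (scaleP c⁻¹ (mulP v k))
          ≈⟨ scaleP-addP c⁻¹ (mulP u g) (mulP v k) ⟨
        scaleP c⁻¹ (addP (mulP u g) (mulP v k))
          ≈⟨ scaleP-cong {c⁻¹} refl (≃-trans (≃-sym comb) (degree0 d d0)) ⟩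
        (c⁻¹ ⊗ coeffP d 0) ∷ []
          ≈⟨ ∷-cong (trans (⊗-comm c⁻¹ (coeffP d 0)) cc) ≃-refl ⟩
        oneP ∎))
    cases (inj₂ a0) with c⁻¹ , cc ← ⊗-inverse pp (coeffP a 0)
                      (λ z → g≄[] (≃-trans ea (≃-trans
                        (mulP-congʳ d (≃-trans (degree0 a a0) (≃-trans (∷-cong z ≃-refl) (0∷[] ≃-refl))))
                          (mulP-zeroʳ d)))) =
      inj₁ (∣P-trans {g} {d} {k} ((c⁻¹ ∷ []) , ≃-sym (begin
        mulP g (c⁻¹ ∷ [])                        ≈⟨ mulP-congˡ (c⁻¹ ∷ []) (≃-trans ea (mulP-congʳ d (degree0 a a0))) ⟩
        mulP (mulP d (coeffP a 0 ∷ [])) (c⁻¹ ∷ []) ≈⟨ mulP-assoc d _ _ ⟩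
        mulP d (mulP (coeffP a 0 ∷ []) (c⁻¹ ∷ []))
          ≈⟨ mulP-congʳ d (≃-trans (mulP-constˡ (coeffP a 0) (c⁻¹ ∷ [])) (∷-cong cc ≃-refl)) ⟩
        mulP d oneP                              ≈⟨ ℙ.*-identityʳ d ⟩
        d ∎)) (b , eb))

  -- D = gcd(P, x^n - 1) has degree d, as certified by coprime cofactors.
  record ExactGCD (n : ℕ) (P : Poly) (d : ℕ) : Set where
    field
      D E k     : Poly
      e         : ℕ
      D-lead    : HasLead D d 1p
      E-lead    : HasLead E e 1p
      degrees   : d + e ≡ n
      f≃        : xPowMinus1 n ≃ mulP D E
      P≃        : P ≃ mulP D k
      k-coprime : Coprime k E

-- Reversal of words, palindromes and antipalindromes.

module Reversal (p : ℕ) .{{_ : NonZero p}} (pp : Prime p) where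
  open Fp p
  open Residues p
  open Polynomials p
  open Division p pp

  -- Trailing zeros do not change a polynomial but do change its reversal, so reversal is always
  -- taken relative to a prescribed length.
  fit : ℕ → Poly → Poly
  fit zero    f       = []
  fit (suc n) []      = 0p ∷ fit n []
  fit (suc n) (a ∷ f) = a ∷ fit n f

  length-fit : ∀ n f → length (fit n f) ≡ n
  length-fit zero    f       = refl
  length-fit (suc n) []      = cong suc (length-fit n [])
  length-fit (suc n) (a ∷ f) = cong suc (length-fit n f)

  fit-≃ : ∀ {n} f → Deg< f n → fit n f ≃ f
  fit-≃ {zero}  f       h = ≃-sym (Deg<0 f h)
  fit-≃ {suc n} []      h = 0∷[] (fit-≃ {n} [] (Deg<-[] n))
  fit-≃ {suc n} (a ∷ f) h = ∷-cong refl (fit-≃ f (Deg<-tail a f h))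

  ≃⇒≡ : ∀ f g → length f ≡ length g → f ≃ g → f ≡ g
  ≃⇒≡ []      []      l e = refl
  ≃⇒≡ (a ∷ f) (b ∷ g) l e = cong₂ _∷_ (at e 0) (≃⇒≡ f g (ℕP.suc-injective l) (tail-≃ e))

  fit-cong : ∀ n f g → f ≃ g → fit n f ≡ fit n g
  fit-cong zero    f       g       e = refl
  fit-cong (suc n) []      []      e = refl
  fit-cong (suc n) []      (b ∷ g) e = cong₂ _∷_ (at e 0) (fit-cong n [] g (≃-sym (tail-≃[] (≃-sym e))))
  fit-cong (suc n) (a ∷ f) []      e = cong₂ _∷_ (at e 0) (fit-cong n f [] (tail-≃[] e))
  fit-cong (suc n) (a ∷ f) (b ∷ g) e = cong₂ _∷_ (at e 0) (fit-cong n f g (tail-≃ e))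

  fit-length : ∀ f → fit (length f) f ≡ f
  fit-length []      = refl
  fit-length (a ∷ f) = cong (a ∷_) (fit-length f)

  shift : ℕ → Poly → Poly
  shift n f = replicate n 0p ++ f

  addP-∷ʳ : ∀ f g a b → length f ≡ length g → addP (f ∷ʳ a) (g ∷ʳ b) ≡ addP f g ∷ʳ (a ⊕ b)
  addP-∷ʳ []      []      a b l = refl
  addP-∷ʳ (x ∷ f) (y ∷ g) a b l = cong ((x ⊕ y) ∷_) (addP-∷ʳ f g a b (ℕP.suc-injective l))

  length-addP : ∀ f g → length f ≡ length g → length (addP f g) ≡ length g
  length-addP []      []      l = refl
  length-addP (x ∷ f) (y ∷ g) l = cong suc (length-addP f g (ℕP.suc-injective l))

  reverse-addP : ∀ f g → length f ≡ length g → reverse (addP f g) ≡ addP (reverse f) (reverse g)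
  reverse-addP []      []      l = refl
  reverse-addP (x ∷ f) (y ∷ g) l = begin
    reverse ((x ⊕ y) ∷ addP f g)                ≡⟨ ListP.unfold-reverse (x ⊕ y) (addP f g) ⟩
    reverse (addP f g) ∷ʳ (x ⊕ y)               ≡⟨ cong (_∷ʳ (x ⊕ y)) (reverse-addP f g l') ⟩
    addP (reverse f) (reverse g) ∷ʳ (x ⊕ y)     ≡⟨ addP-∷ʳ (reverse f) (reverse g) x y
                                                     (trans (ListP.length-reverse f)
                                                       (trans l' (sym (ListP.length-reverse g)))) ⟨
    addP (reverse f ∷ʳ x) (reverse g ∷ʳ y)      ≡⟨ cong₂ addP (ListP.unfold-reverse x f) (ListP.unfold-reverse y g) ⟨
    addP (reverse (x ∷ f)) (reverse (y ∷ g))    ∎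
    where
    open ≡-Reasoning
    l' = ℕP.suc-injective l

  pad : ∀ f g k → length f + k ≡ length g → addP f g ≡ addP (f ++ replicate k 0p) g
  pad []      []      zero    l = refl
  pad []      (y ∷ g) (suc k) l = cong₂ _∷_ (sym (𝔽.+-identityˡ y)) (pad [] g k (ℕP.suc-injective l))
  pad (x ∷ f) (y ∷ g) k       l = cong ((x ⊕ y) ∷_) (pad f g k (ℕP.suc-injective l))

  mulP-[a] : ∀ a f e → length f ≡ suc e → mulP (a ∷ []) f ≡ scaleP a f
  mulP-[a] a (b ∷ f) e l = cong₂ _∷_ (𝔽.+-identityʳ (a ⊗ b)) (addP-[] (scaleP a f))
    where
    addP-[] : ∀ f → addP f [] ≡ f
    addP-[] []      = refl
    addP-[] (_ ∷ _) = refl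

  length-pad : ∀ (f : Poly) k → length (f ++ replicate k 0p) ≡ length f + k
  length-pad f k = trans (ListP.length-++ f) (cong (length f +_) (ListP.length-replicate k))

  -- The list computed by `mulP` has the generic length even if leading letters vanish. Reversal of
  -- a product needs this exact length, not a degree.
  length-mulP : ∀ a f g e → length g ≡ suc e → length (mulP (a ∷ f) g) ≡ suc (length f + e)
  length-summands : ∀ a b f g e → length g ≡ suc e →
                    length (scaleP a g) + suc (length f) ≡ suc (length (mulP (b ∷ f) g))

  length-summands a b f g e l = begin
    length (scaleP a g) + suc (length f)   ≡⟨ cong (_+ suc (length f)) (trans (ListP.length-map (a ⊗_) g) l) ⟩
    suc (e + suc (length f))
      ≡⟨ cong suc (trans (ℕP.+-suc e (length f)) (cong suc (ℕP.+-comm e (length f)))) ⟩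
    suc (suc (length f + e))               ≡⟨ cong suc (length-mulP b f g e l) ⟨
    suc (length (mulP (b ∷ f) g))          ∎
    where open ≡-Reasoning

  length-mulP a [] g e l = trans (cong length (mulP-[a] a g e l)) (trans (ListP.length-map (a ⊗_) g) l)
  length-mulP a (b ∷ f) g e l = begin
    length (addP (scaleP a g) (0p ∷ mulP (b ∷ f) g))
      ≡⟨ cong length (pad (scaleP a g) (0p ∷ mulP (b ∷ f) g) (suc (length f)) l') ⟩
    length (addP padded (0p ∷ mulP (b ∷ f) g))
      ≡⟨ length-addP padded (0p ∷ mulP (b ∷ f) g) (trans (length-pad (scaleP a g) (suc (length f))) l') ⟩
    suc (length (mulP (b ∷ f) g))
      ≡⟨ cong suc (length-mulP b f g e l) ⟩
    suc (suc (length f + e)) ∎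
    where
    open ≡-Reasoning
    padded = scaleP a g ++ replicate (suc (length f)) 0p
    l' = length-summands a b f g e l

  reverse-replicate : ∀ k → reverse (replicate k 0p) ≡ replicate k 0p
  reverse-replicate zero    = refl
  reverse-replicate (suc k) = trans (ListP.unfold-reverse 0p (replicate k 0p))
    (trans (cong (_∷ʳ 0p) (reverse-replicate k)) (∷ʳ-replicate k))
    where
    ∷ʳ-replicate : ∀ k → replicate k 0p ∷ʳ 0p ≡ 0p ∷ replicate k 0p
    ∷ʳ-replicate zero    = refl
    ∷ʳ-replicate (suc k) = cong (0p ∷_) (∷ʳ-replicate k)

  ∷ʳ0 : ∀ f → f ∷ʳ 0p ≃ f
  ∷ʳ0 []      = 0∷[] ≃-refl
  ∷ʳ0 (a ∷ f) = ∷-cong refl (∷ʳ0 f)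

  mulP-∷ʳˡ : ∀ f a g → mulP (f ∷ʳ a) g ≃ addP (mulP f g) (shift (length f) (scaleP a g))
  mulP-∷ʳˡ []      a g = mulP-constˡ a g
  mulP-∷ʳˡ (b ∷ f) a g = ≃-trans (addP-cong (≃-refl {scaleP b g}) (≃-trans (∷-cong refl (mulP-∷ʳˡ f a g))
      (0∷-addP (mulP f g) (shift (length f) (scaleP a g)))))
    (≃-sym (addP-assoc (scaleP b g) (0p ∷ mulP f g) _))

  -- In `a g + x h` with `h` the product of the tail and `g`, reversal turns the factor `x` into a
  -- trailing zero, and the padding of `a g` into a shift. This is the product with one letter
  -- appended to the reversed left factor.
  reverse-mulP : ∀ a f g e → length g ≡ suc e → reverse (mulP (a ∷ f) g) ≃ mulP (reverse (a ∷ f)) (reverse g)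
  reverse-mulP a [] g e l = ≃-trans
      (ℙ.reflexive (trans (cong reverse (mulP-[a] a g e l)) (sym (ListP.reverse-map (a ⊗_) g))))
    (≃-sym (mulP-constˡ a (reverse g)))
  reverse-mulP a (b ∷ f) g e l = begin
    reverse (addP (scaleP a g) (0p ∷ h))
      ≡⟨ cong reverse (pad (scaleP a g) (0p ∷ h) (suc (length f)) l') ⟩
    reverse (addP (scaleP a g ++ zs) (0p ∷ h))
      ≡⟨ reverse-addP (scaleP a g ++ zs) (0p ∷ h) (trans (length-pad (scaleP a g) (suc (length f))) l') ⟩
    addP (reverse (scaleP a g ++ zs)) (reverse (0p ∷ h))
      ≡⟨ cong₂ addP (trans (ListP.reverse-++ (scaleP a g) zs) (cong₂ _++_ (reverse-replicate (suc (length f)))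
        (sym (ListP.reverse-map (a ⊗_) g))))
                    (ListP.unfold-reverse 0p h) ⟩
    addP (shift (suc (length f)) (scaleP a (reverse g))) (reverse h ∷ʳ 0p)
      ≈⟨ addP-cong (≃-refl {shift (suc (length f)) (scaleP a (reverse g))})
        (≃-trans (∷ʳ0 (reverse h)) (reverse-mulP b f g e l)) ⟩
    addP (shift (suc (length f)) (scaleP a (reverse g))) (mulP (reverse (b ∷ f)) (reverse g))
      ≈⟨ addP-comm (shift (suc (length f)) (scaleP a (reverse g))) _ ⟩
    addP (mulP (reverse (b ∷ f)) (reverse g)) (shift (suc (length f)) (scaleP a (reverse g)))
      ≡⟨ cong (λ k → addP (mulP (reverse (b ∷ f)) (reverse g)) (shift k (scaleP a (reverse g))))
        (ListP.length-reverse (b ∷ f)) ⟨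
    addP (mulP (reverse (b ∷ f)) (reverse g)) (shift (length (reverse (b ∷ f))) (scaleP a (reverse g)))
      ≈⟨ mulP-∷ʳˡ (reverse (b ∷ f)) a (reverse g) ⟨
    mulP (reverse (b ∷ f) ∷ʳ a) (reverse g)
      ≡⟨ cong (λ h → mulP h (reverse g)) (ListP.unfold-reverse a (b ∷ f)) ⟨
    mulP (reverse (a ∷ b ∷ f)) (reverse g) ∎
    where
    open ≃-Reasoning
    h = mulP (b ∷ f) g
    zs = replicate (suc (length f)) 0p
    l' = length-summands a b f g e l

  rev : ℕ → Poly → Poly
  rev n f = reverse (fit n f)

  rev-cong : ∀ n {f g} → f ≃ g → rev n f ≡ rev n g
  rev-cong n {f} {g} e = cong reverse (fit-cong n f g e)

  length-rev : ∀ n f → length (rev n f) ≡ n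
  length-rev n f = trans (ListP.length-reverse (fit n f)) (length-fit n f)

  Deg<-rev : ∀ n f → Deg< (rev n f) n
  Deg<-rev n f = subst (Deg< (rev n f)) (length-rev n f) (Deg<-length (rev n f))

  rev-involutive : ∀ {n} f → Deg< f n → rev n (rev n f) ≃ f
  rev-involutive {n} f h = ≃-trans (ℙ.reflexive (trans
      (cong reverse (subst (λ m → fit m (rev n f) ≡ rev n f) (length-rev n f) (fit-length (rev n f))))
      (ListP.reverse-involutive (fit n f)))) (fit-≃ f h)

  rev-[] : ∀ n → rev n [] ≃ []
  rev-[] n = ≃-trans (ℙ.reflexive (cong reverse (fit-[] n))) (≃-trans (ℙ.reflexive (reverse-replicate n)) (zeros n))
    where
    fit-[] : ∀ n → fit n [] ≡ replicate n 0p
    fit-[] zero    = refl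
    fit-[] (suc n) = cong (0p ∷_) (fit-[] n)
    zeros : ∀ n → replicate n 0p ≃ []
    zeros zero    = ≃-refl
    zeros (suc n) = 0∷[] (zeros n)

  -- A word of length `d + 1` times a word of length `M` has length `d + M`. Measuring the first
  -- factor by degree and the second by length also covers `M = 0`, where `g` is zero.
  rev-mulP : ∀ {d M} f g → Deg< f (suc d) → Deg< g M → rev (d + M) (mulP f g) ≃ mulP (rev (suc d) f) (rev M g)
  rev-mulP {d} {zero} f g hf hg = ≃-trans
    (ℙ.reflexive (rev-cong (d + 0) (≃-trans (mulP-congʳ f (Deg<0 g hg)) (mulP-zeroʳ f))))
    (≃-trans (rev-[] (d + 0)) (≃-sym (mulP-zeroʳ (rev (suc d) f))))
  rev-mulP {d} {suc e} f g hf hg with fit (suc d) f | length-fit (suc d) f | fit-≃ f hf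
  ... | a ∷ f' | l | ef = ≃-trans (ℙ.reflexive (cong reverse exact))
      (reverse-mulP a f' (fit (suc e) g) e (length-fit (suc e) g))
    where
    exact : fit (d + suc e) (mulP f g) ≡ mulP (a ∷ f') (fit (suc e) g)
    exact = trans (fit-cong (d + suc e) (mulP f g) h (mulP-cong (≃-sym ef) (≃-sym (fit-≃ g hg))))
      (subst (λ m → fit m h ≡ h) (trans (length-mulP a f' (fit (suc e) g) e (length-fit (suc e) g))
        (trans (cong (_+ e) l) (sym (ℕP.+-suc d e)))) (fit-length h))
      where h = mulP (a ∷ f') (fit (suc e) g)

  -- P is palindromic (s = 1) or antipalindromic (s = -1) as a word of length n.
  record Symmetric (n : ℕ) (s : Fin p) (P : Poly) : Set where
    constructor symmetric
    field
      bounded  : Deg< P n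
      reversed : rev n P ≃ scaleP s P
  open Symmetric public

  Symmetric-cong : ∀ {n s P Q} → P ≃ Q → Symmetric n s P → Symmetric n s Q
  Symmetric-cong {n} {s} {P} e (symmetric b r) = symmetric (Deg<-cong {P} e b)
    (≃-trans (ℙ.reflexive (rev-cong n (≃-sym e))) (≃-trans r (scaleP-cong {s} refl e)))

  mulP-scaleʳ : ∀ c f g → mulP f (scaleP c g) ≃ scaleP c (mulP f g)
  mulP-scaleʳ c f g = ≃-trans (mulP-comm f (scaleP c g))
      (≃-trans (mulP-scaleˡ c g f) (scaleP-cong {c} refl (mulP-comm g f)))

  Symmetric-mulP : ∀ {d M s t D k} → Symmetric (suc d) s D → Symmetric M t k → Symmetric (d + M) (s ⊗ t) (mulP D k)
  Symmetric-mulP {d} {M} {s} {t} {D} {k} (symmetric b r) (symmetric b' r') = symmetric (bound M b')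
    (begin
      rev (d + M) (mulP D k)               ≈⟨ rev-mulP D k b b' ⟩
      mulP (rev (suc d) D) (rev M k)       ≈⟨ mulP-cong r r' ⟩
      mulP (scaleP s D) (scaleP t k)       ≈⟨ mulP-scaleˡ s D (scaleP t k) ⟩
      scaleP s (mulP D (scaleP t k))       ≈⟨ scaleP-cong {s} refl (mulP-scaleʳ t D k) ⟩
      scaleP s (scaleP t (mulP D k))       ≈⟨ scaleP-⊗ s t (mulP D k) ⟨
      scaleP (s ⊗ t) (mulP D k)            ∎)
    where
    open ≃-Reasoning
    bound : ∀ M → Deg< k M → Deg< (mulP D k) (d + M)
    bound zero    h = Deg<-cong {[]} (≃-sym (≃-trans (mulP-congʳ D (Deg<0 k h)) (mulP-zeroʳ D))) (Deg<-[] (d + 0))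
    bound (suc e) h = subst (Deg< (mulP D k)) (sym (ℕP.+-suc d e)) (Deg<-mulP D k b h)

  -- Reversing `P = D k` gives `s D rev(k) = t D k`. Cancelling `D` and multiplying by `s`, which is
  -- its own inverse, leaves `rev(k) = s t k`.
  Symmetric-quotient : ∀ {d M s t D k P c} → c ≢ 0p → HasLead D d c → s ⊗ s ≡ 1p →
    Symmetric (suc d) s D → Symmetric (d + M) t P → P ≃ mulP D k → Symmetric M (s ⊗ t) k
  Symmetric-quotient {d} {M} {s} {t} {D} {k} {P} c≢0 hD ss (symmetric b r) (symmetric b' r') e =
    symmetric bk (begin
      rev M k                      ≈⟨ scaleP-1 (rev M k) ⟨
      scaleP 1p (rev M k)          ≈⟨ scaleP-cong (sym ss) (≃-refl {rev M k}) ⟩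
      scaleP (s ⊗ s) (rev M k)     ≈⟨ scaleP-⊗ s s (rev M k) ⟩
      scaleP s (scaleP s (rev M k)) ≈⟨ scaleP-cong {s} refl core ⟩
      scaleP s (scaleP t k)        ≈⟨ scaleP-⊗ s t k ⟨
      scaleP (s ⊗ t) k             ∎)
    where
    open ≃-Reasoning
    bk : Deg< k M
    bk = mulP-Deg<-lead {D} {d} k c≢0 hD (Deg<-cong {P} e b')
    core : scaleP s (rev M k) ≃ scaleP t k
    core = mulP-cancelˡ {D} {d} c≢0 hD (begin
      mulP D (scaleP s (rev M k))      ≈⟨ mulP-scaleʳ s D (rev M k) ⟩
      scaleP s (mulP D (rev M k))      ≈⟨ mulP-scaleˡ s D (rev M k) ⟨
      mulP (scaleP s D) (rev M k)      ≈⟨ mulP-congˡ (rev M k) r ⟨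
      mulP (rev (suc d) D) (rev M k)   ≈⟨ rev-mulP D k b bk ⟨
      rev (d + M) (mulP D k)           ≡⟨ rev-cong (d + M) (≃-sym e) ⟩
      rev (d + M) P                    ≈⟨ r' ⟩
      scaleP t P                       ≈⟨ scaleP-cong {t} refl e ⟩
      scaleP t (mulP D k)              ≈⟨ mulP-scaleʳ t D k ⟨
      mulP D (scaleP t k)              ∎)

  -- Reversing `P = g k` gives `t P = g* rev(k)`, and `t` is its own inverse.
  rev-∣P : ∀ {d N t g P c} → c ≢ 0p → HasLead g d c → t ⊗ t ≡ 1p → Symmetric N t P → g ∣P P → rev (suc d) g ∣P P
  rev-∣P {d} {N} {t} {g} {P} c≢0 hg ht (symmetric b r) (k , e) with d ℕ.≤? N
  -- A nonzero multiple of `g` does not fit into length `N`, so `P` is zero here.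
  ... | no d≰N = [] , ≃-trans P≃[] (≃-sym (mulP-zeroʳ (rev (suc d) g)))
    where
    P≃[] : P ≃ []
    P≃[] with zero-or-lead P
    ... | inj₁ z = z
    ... | inj₂ (m , a , a≢0 , hP) with zero-or-lead k
    ...   | inj₁ z = ≃-trans e (≃-trans (mulP-congʳ g z) (mulP-zeroʳ g))
    ...   | inj₂ (j , b' , b'≢0 , hk) = ⊥-elim (d≰N (ℕP.≤-trans (ℕP.m≤m+n d j)
            (ℕP.<⇒≤ (lead-≤ {mulP g k} (⊗-≢0 c≢0 b'≢0) (HasLead-mulP {g} {k} hg hk) (Deg<-cong {P} e b)))))
  ... | yes d≤N with M , refl ← ℕP.m≤n⇒∃[o]m+o≡n d≤N = scaleP t (rev M k) , (begin
      P                                          ≈⟨ scaleP-1 P ⟨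
      scaleP 1p P                                ≈⟨ scaleP-cong (sym ht) (≃-refl {P}) ⟩
      scaleP (t ⊗ t) P                           ≈⟨ scaleP-⊗ t t P ⟩
      scaleP t (scaleP t P)                      ≈⟨ scaleP-cong {t} refl r ⟨
      scaleP t (rev (d + M) P)                   ≡⟨ cong (scaleP t) (rev-cong (d + M) e) ⟩
      scaleP t (rev (d + M) (mulP g k))
        ≈⟨ scaleP-cong {t} refl (rev-mulP g k (proj₂ hg) (mulP-Deg<-lead {g} {d} k c≢0 hg (Deg<-cong {P} e b))) ⟩
      scaleP t (mulP (rev (suc d) g) (rev M k))  ≈⟨ mulP-scaleʳ t (rev (suc d) g) (rev M k) ⟨
      mulP (rev (suc d) g) (scaleP t (rev M k))  ∎)
    where open ≃-Reasoning

-- Prime self-reciprocal polynomials, `x - 1`, and parity of degrees.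

module SymmetricPrimes (p : ℕ) .{{_ : NonZero p}} (pp : Prime p) (odd : ¬ (2 ∣ p)) where
  open Fp p
  open Residues p
  open Polynomials p
  open Division p pp
  open Reversal p pp

  1⊕1≢0 : 1p ⊕ 1p ≢ 0p
  1⊕1≢0 e = odd (subst (2 ∣_) 2≡p (divides 1 refl))
    where
    2≡p : 2 ≡ p
    2≡p = ℕP.≤-antisym (ℕ.nonTrivial⇒n>1 p {{prime⇒nonTrivial pp}}) (∣⇒≤ (≡0⇒∣ 2 (trans (sym (fromN-+ 1 1)) e)))

  double : ∀ x → x ⊕ x ≡ (1p ⊕ 1p) ⊗ x
  double x = trans (cong₂ _⊕_ (sym (𝔽.*-identityˡ x)) (sym (𝔽.*-identityˡ x))) (sym (𝔽.distribʳ x 1p 1p))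

  x⊕x≡0⇒x≡0 : ∀ x → x ⊕ x ≡ 0p → x ≡ 0p
  x⊕x≡0⇒x≡0 x e = ⊗-zero-product pp (1p ⊕ 1p) x (trans (sym (double x)) e) 1⊕1≢0

  recip≡rev : ∀ {f d c} → c ≢ 0p → HasLead f d c → recip f ≡ rev (suc d) f
  recip≡rev {f} {d} c≢0 h = cong reverse (≃⇒≡ (strip f) (fit (suc d) f)
    (trans (length-strip {f} c≢0 h) (sym (length-fit (suc d) f)))
    (≃-trans (strip-≃ f) (≃-sym (fit-≃ f (proj₂ h)))))

  coeff-∷ʳ : ∀ f a → coeffP (f ∷ʳ a) (length f) ≡ a
  coeff-∷ʳ []      a = refl
  coeff-∷ʳ (_ ∷ f) a = coeff-∷ʳ f a

  rev-lead : ∀ d f → HasLead (rev (suc d) f) d (coeffP f 0)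
  rev-lead d f = top f , Deg<-rev (suc d) f
    where
    step : ∀ a g → length g ≡ d → coeffP (reverse (a ∷ g)) d ≡ a
    step a g l = trans (cong₂ coeffP (ListP.unfold-reverse a g) (trans (sym l) (sym (ListP.length-reverse g))))
        (coeff-∷ʳ (reverse g) a)
    top : ∀ f → coeffP (rev (suc d) f) d ≡ coeffP f 0
    top []      = step 0p (fit d []) (length-fit d [])
    top (a ∷ f) = step a (fit d f) (length-fit d f)

  rev-coeff0 : ∀ {d c f} → HasLead f d c → coeffP (rev (suc d) f) 0 ≡ c
  rev-coeff0 {d} {c} {f} h = begin
    coeffP (rev (suc d) f) 0                   ≡⟨ proj₁ (rev-lead d (rev (suc d) f)) ⟨
    coeffP (rev (suc d) (rev (suc d) f)) d     ≡⟨ at (rev-involutive f (proj₂ h)) d ⟩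
    coeffP f d                                 ≡⟨ proj₁ h ⟩
    c                                          ∎
    where open ≡-Reasoning

  mulP-coeff0 : ∀ f g → coeffP (mulP f g) 0 ≡ coeffP f 0 ⊗ coeffP g 0
  mulP-coeff0 []      g = sym (𝔽.zeroˡ (coeffP g 0))
  mulP-coeff0 (a ∷ f) g = trans (coeff-addP (scaleP a g) (0p ∷ mulP f g) 0)
    (trans (𝔽.+-identityʳ (coeffP (scaleP a g) 0)) (coeff-scaleP a g 0))

  leads-of-product : ∀ {f g h d c} → c ≢ 0p → HasLead f d c → f ≃ mulP g h →
    Σ ℕ λ i → Σ ℕ λ j → Σ (Fin p) λ a → Σ (Fin p) λ b →
    i + j ≡ d × (a ≢ 0p × HasLead g i a) × (b ≢ 0p × HasLead h j b)
  leads-of-product {f} {g} {h} c≢0 hf e with zero-or-lead g | zero-or-lead h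
  ... | inj₁ z | _ = ⊥-elim (lead≢0⇒≄[] {f} c≢0 hf (≃-trans e (mulP-zeroˡ {g} h z)))
  ... | inj₂ _ | inj₁ z = ⊥-elim (lead≢0⇒≄[] {f} c≢0 hf (≃-trans e (≃-trans (mulP-congʳ g z) (mulP-zeroʳ g))))
  ... | inj₂ (i , a , a≢0 , hg) | inj₂ (j , b , b≢0 , hh) = i , j , a , b ,
        lead-unique {mulP g h} (⊗-≢0 a≢0 b≢0) c≢0 (HasLead-mulP {g} {h} hg hh) (HasLead-cong {f} e hf) ,
        (a≢0 , hg) , (b≢0 , hh)

  -- A factorization of `g*` reverses to one of `g` with the same degrees. Degrees are kept because
  -- the factors have nonzero constant terms: these multiply to `g*(0)`, the leading coefficient 1
  -- of `g`.
  rev-irreducible : ∀ {g d} → HasLead g d 1p → coeffP g 0 ≢ 0p → Irreducible g → Irreducible (rev (suc d) g)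
  rev-irreducible {g} {d} hg g0 (1≤ , irr) =
    subst (1 ≤_) (trans (degP-lead {g} (1p≢0p pp) hg) (sym (degP-lead {rev (suc d) g} g0 (rev-lead d g)))) 1≤ ,
    λ h k e → split h k (pointwise e)
    where
    split : ∀ h k → rev (suc d) g ≃ mulP h k → degP h ≡ 0 ⊎ degP k ≡ 0
    split h k e with i , j , a , b , refl , (a≢0 , hh) , (b≢0 , hk) ← leads-of-product {rev (suc d) g} {h} {k} g0
      (rev-lead d g) e =
      Sum.map (transfer h a≢0 hh h0≢0) (transfer k b≢0 hk k0≢0) (irr (rev (suc i) h) (rev (suc j) k) (at factor))
      where
      open ≃-Reasoning
      product≢0 : coeffP h 0 ⊗ coeffP k 0 ≢ 0p
      product≢0 z = 1p≢0p pp (trans (sym (rev-coeff0 {f = g} hg)) (trans (at e 0) (trans (mulP-coeff0 h k) z)))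
      h0≢0 : coeffP h 0 ≢ 0p
      h0≢0 z = product≢0 (trans (cong (_⊗ coeffP k 0) z) (𝔽.zeroˡ (coeffP k 0)))
      k0≢0 : coeffP k 0 ≢ 0p
      k0≢0 z = product≢0 (trans (cong (coeffP h 0 ⊗_) z) (𝔽.zeroʳ (coeffP h 0)))
      factor : g ≃ mulP (rev (suc i) h) (rev (suc j) k)
      factor = begin
        g                                        ≈⟨ rev-involutive g (proj₂ hg) ⟨
        rev (suc (i + j)) (rev (suc (i + j)) g)  ≡⟨ rev-cong (suc (i + j)) e ⟩
        rev (suc (i + j)) (mulP h k)             ≡⟨ cong (λ m → rev m (mulP h k)) (ℕP.+-suc i j) ⟨
        rev (i + suc j) (mulP h k)               ≈⟨ rev-mulP {i} {suc j} h k (proj₂ hh) (proj₂ hk) ⟩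
        mulP (rev (suc i) h) (rev (suc j) k)     ∎
      transfer : ∀ h {i a} → a ≢ 0p → HasLead h i a → coeffP h 0 ≢ 0p → degP (rev (suc i) h) ≡ 0 → degP h ≡ 0
      transfer h {i} a≢0 hh h0 z = trans (degP-lead {h} a≢0 hh)
          (trans (sym (degP-lead {rev (suc i) h} h0 (rev-lead i h))) z)

  -- The divisors of x^n - 1 that matter: x - 1 with sign s = -1, the r_i with s = 1.
  record SymmetricPrime (r : Poly) (d : ℕ) (s : Fin p) : Set where
    field
      lead       : HasLead r d 1p
      sign       : s ⊗ s ≡ 1p
      isSymmetric : Symmetric (suc d) s r
      dichotomy  : ∀ {N t P} → t ⊗ t ≡ 1p → Symmetric N t P → r ∣P P ⊎ Coprime r P

  1⊗1≡1 : 1p ⊗ 1p ≡ 1p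
  1⊗1≡1 = 𝔽.*-identityˡ 1p

  module PairFactor {g : Poly} {u : Fin p} (mon : Monic g) (irr : Irreducible g) (g0 : NonzeroConst g)
      (not-assoc : ¬ (Σ (Fin p) λ c → recip g ≈P scaleP c g)) (u≢0 : ¬ (u ≡ 0p)) where
    e = degP g
    g* = rev (suc e) g

    hg : HasLead g e 1p
    hg = monic-lead {g} mon

    recip≡g* : recip g ≡ g*
    recip≡g* = recip≡rev {g} (1p≢0p pp) hg

    hg* : HasLead g* e (coeffP g 0)
    hg* = rev-lead e g

    -- `g*` has no larger degree than `g`, so the quotient would be constant and `g*` an associate
    -- of `g`.
    not-∣ : ¬ (g ∣P g*)
    not-∣ (k , eq) = not-assoc (coeffP k 0 , at (≃-trans (ℙ.reflexive recip≡g*) (≃-trans eq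
            (≃-trans (mulP-comm g k) (≃-trans (mulP-congˡ g k≃) (mulP-constˡ (coeffP k 0) g))))))
      where
      k< : Deg< k 1
      k< = mulP-Deg<-lead {g} {e} k {1} (1p≢0p pp) hg
          (subst (Deg< (mulP g k)) (ℕP.+-comm 1 e) (Deg<-cong {g*} eq (proj₂ hg*)))
      k≃ : k ≃ coeffP k 0 ∷ []
      k≃ = pointwise λ { zero → refl ; (suc i) → k< (suc i) (s≤s z≤n) }

    coprime-g-g* : Coprime g g*
    coprime-g-g* = Sum.fromInj₂ (λ d → ⊥-elim (not-∣ d)) (irreducible-dichotomy {g} irr g*)

    product = scaleP u (mulP g g*)

    unscale-∣P : ∀ {P} → mulP g g* ∣P P → product ∣P P
    unscale-∣P {P} (k , eq) = scaleP u⁻¹ k , ≃-sym (begin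
        mulP (scaleP u (mulP g g*)) (scaleP u⁻¹ k)   ≈⟨ mulP-scaleˡ u (mulP g g*) (scaleP u⁻¹ k) ⟩
        scaleP u (mulP (mulP g g*) (scaleP u⁻¹ k))   ≈⟨ scaleP-cong {u} refl (mulP-scaleʳ u⁻¹ (mulP g g*) k) ⟩
        scaleP u (scaleP u⁻¹ (mulP (mulP g g*) k))   ≈⟨ scaleP-⊗ u u⁻¹ (mulP (mulP g g*) k) ⟨
        scaleP (u ⊗ u⁻¹) (mulP (mulP g g*) k)        ≈⟨ scaleP-cong (proj₂ (⊗-inverse pp u u≢0)) (≃-sym eq) ⟩
        scaleP 1p P                                  ≈⟨ scaleP-1 P ⟩
        P                                            ∎)
      where
      open ≃-Reasoning
      u⁻¹ = proj₁ (⊗-inverse pp u u≢0)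

    unscale-coprime : ∀ {P} → Coprime (mulP g g*) P → Coprime product P
    unscale-coprime {P} (a , b , eq) = scaleP u⁻¹ a , b , ≃-trans (addP-cong (begin
        mulP (scaleP u⁻¹ a) (scaleP u (mulP g g*))   ≈⟨ mulP-scaleˡ u⁻¹ a (scaleP u (mulP g g*)) ⟩
        scaleP u⁻¹ (mulP a (scaleP u (mulP g g*)))   ≈⟨ scaleP-cong {u⁻¹} refl (mulP-scaleʳ u a (mulP g g*)) ⟩
        scaleP u⁻¹ (scaleP u (mulP a (mulP g g*)))   ≈⟨ scaleP-⊗ u⁻¹ u (mulP a (mulP g g*)) ⟨
        scaleP (u⁻¹ ⊗ u) (mulP a (mulP g g*))
          ≈⟨ scaleP-cong (trans (⊗-comm u⁻¹ u) (proj₂ (⊗-inverse pp u u≢0))) (≃-refl {mulP a (mulP g g*)}) ⟩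
        scaleP 1p (mulP a (mulP g g*))               ≈⟨ scaleP-1 _ ⟩
        mulP a (mulP g g*)                           ∎) (≃-refl {mulP b P})) eq
      where
      open ≃-Reasoning
      u⁻¹ = proj₁ (⊗-inverse pp u u≢0)

    module _ {N t P} (ht : t ⊗ t ≡ 1p) (σ : Symmetric N t P) where
      -- The symmetry of `P` supplies the second divisor `g*`, and coprime divisors multiply.
      g∣P⇒product∣P : g ∣P P → product ∣P P
      g∣P⇒product∣P g∣P = unscale-∣P (coprime-∣P {g} {g*} coprime-g-g* g∣P (rev-∣P {e} {g = g} (1p≢0p pp) hg ht σ g∣P))

      g*∣P⇒g∣P : g* ∣P P → g ∣P P
      g*∣P⇒g∣P g*∣P = ∣P-congˡ {rev (suc e) g*} (rev-involutive g (proj₂ hg)) (rev-∣P {e} {g = g*} g0 hg* ht σ g*∣P)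

      -- Each of `g` and `g*` divides `P` or is coprime to it. Symmetry of `P` turns divisibility by
      -- either one into divisibility by the product; otherwise both are coprime to `P`, and so is
      -- the product.
      product-dichotomy : product ∣P P ⊎ Coprime product P
      product-dichotomy = decide (irreducible-dichotomy {g} irr P)
          (irreducible-dichotomy {g*} (rev-irreducible {g} hg g0 irr) P)
        where
        decide : g ∣P P ⊎ Coprime g P → g* ∣P P ⊎ Coprime g* P → product ∣P P ⊎ Coprime product P
        decide (inj₁ d) _        = inj₁ (g∣P⇒product∣P d)
        decide (inj₂ _) (inj₁ d) = inj₁ (g∣P⇒product∣P (g*∣P⇒g∣P d))
        decide (inj₂ c) (inj₂ d) = inj₂ (unscale-coprime (coprime-mulP {g} {g*} c d))

    product-symmetric : Symmetric (suc (e + e)) 1p product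
    product-symmetric = Symmetric-cong {P = mulP (u ∷ []) (mulP g g*)} (mulP-constˡ u (mulP g g*))
        (subst (λ s → Symmetric (suc (e + e)) s (mulP (u ∷ []) (mulP g g*))) 1⊗1≡1
      (Symmetric-mulP {0} {suc (e + e)} {1p} {1p} {u ∷ []} {mulP g g*}
        (symmetric (Deg<-length (u ∷ [])) (≃-sym (scaleP-1 (u ∷ [])))) (symmetric
        (proj₂ (HasLead-mulP {g} {g*} hg hg*)) (begin
          rev (suc (e + e)) (mulP g g*)       ≡⟨ cong (λ m → rev m (mulP g g*)) (ℕP.+-suc e e) ⟨
          rev (e + suc e) (mulP g g*)         ≈⟨ rev-mulP {e} {suc e} g g* (proj₂ hg) (proj₂ hg*) ⟩
          mulP g* (rev (suc e) g*)            ≈⟨ mulP-congʳ g* (rev-involutive g (proj₂ hg)) ⟩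
          mulP g* g                           ≈⟨ mulP-comm g* g ⟩
          mulP g g*                           ≈⟨ scaleP-1 (mulP g g*) ⟨
          scaleP 1p (mulP g g*)               ∎))))
      where open ≃-Reasoning

    product-lead : HasLead product (e + e) (u ⊗ (1p ⊗ coeffP g 0))
    product-lead = HasLead-scaleP u {mulP g g*} (HasLead-mulP {g} {g*} hg hg*)

    product-lead≢0 : u ⊗ (1p ⊗ coeffP g 0) ≢ 0p
    product-lead≢0 = ⊗-≢0 u≢0 (⊗-≢0 (1p≢0p pp) g0)

  coprime-congˡ : ∀ {f g h} → f ≃ g → Coprime f h → Coprime g h
  coprime-congˡ {h = h} e (u , v , eq) = u , v , ≃-trans (addP-cong (mulP-congʳ u (≃-sym e)) (≃-refl {mulP v h})) eq

  primeSelfReciprocal⇒symmetricPrime : ∀ {r} → PrimeSelfReciprocal r → SymmetricPrime r (degP r) 1p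
  primeSelfReciprocal⇒symmetricPrime {r} (mon , inj₁ (irr , (_ , self))) = record
    { lead = monic-lead {r} mon
    ; sign = 1⊗1≡1
    ; isSymmetric = symmetric (proj₂ (monic-lead {r} mon))
        (≃-trans (ℙ.reflexive (sym (recip≡rev {r} (1p≢0p pp) (monic-lead {r} mon))))
          (≃-trans (pointwise self) (≃-sym (scaleP-1 r))))
    ; dichotomy = λ {N} {t} {P} _ _ → irreducible-dichotomy {r} irr P }
  primeSelfReciprocal⇒symmetricPrime {r} (mon , inj₂ (g , u , mon-g , irr , g0 , not-assoc , u≢0 , self)) = record
    { lead = monic-lead {r} mon
    ; sign = 1⊗1≡1
    ; isSymmetric = subst (λ d → Symmetric (suc d) 1p r) deg-r (Symmetric-cong (≃-sym r≃) product-symmetric)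
    ; dichotomy = λ ht σ → Sum.map (∣P-congˡ (≃-sym r≃)) (coprime-congˡ (≃-sym r≃)) (product-dichotomy ht σ) }
    where
    open PairFactor {g} {u} mon-g irr g0 not-assoc u≢0
    r≃ : r ≃ product
    r≃ = ≃-trans (pointwise self) (scaleP-cong {u} refl (mulP-congʳ g (ℙ.reflexive recip≡g*)))
    deg-r : e + e ≡ degP r
    deg-r = sym (degP-lead {r} product-lead≢0 (HasLead-cong {product} (≃-sym r≃) product-lead))

  x-1 : Poly
  x-1 = xPowMinus1 1

  x-1-lead : HasLead x-1 1 1p
  x-1-lead = refl , Deg<-length x-1

  x-1-irreducible : Irreducible x-1
  x-1-irreducible = ℕP.≤-reflexive (sym (degP-lead {x-1} (1p≢0p pp) x-1-lead)) , λ g h e → split g h (pointwise e)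
    where
    split : ∀ g h → x-1 ≃ mulP g h → degP g ≡ 0 ⊎ degP h ≡ 0
    split g h e with leads-of-product {x-1} {g} {h} (1p≢0p pp) x-1-lead e
    ... | zero , j , a , b , _ , (a≢0 , hg) , _ = inj₁ (degP-lead {g} a≢0 hg)
    ... | suc i , zero , a , b , _ , _ , (b≢0 , hh) = inj₂ (degP-lead {h} b≢0 hh)
    ... | suc zero , suc j , a , b , () , _
    ... | suc (suc i) , suc j , a , b , () , _

  ⊖1⊗⊖1≡1 : (⊖ 1p) ⊗ (⊖ 1p) ≡ 1p
  ⊖1⊗⊖1≡1 = trans (𝔽P.-1*x≈-x (⊖ 1p)) (𝔽P.-‿involutive 1p)

  x-1-symmetricPrime : SymmetricPrime x-1 1 (⊖ 1p)
  x-1-symmetricPrime = record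
    { lead = x-1-lead
    ; sign = ⊖1⊗⊖1≡1
    ; isSymmetric = symmetric (proj₂ x-1-lead) (∷-cong top (∷-cong bottom ≃-refl))
    ; dichotomy = λ {N} {t} {P} _ _ → irreducible-dichotomy {x-1} x-1-irreducible P }
    where
    top : 1p ≡ (⊖ 1p) ⊗ (0p ⊕ (⊖ 1p))
    top = sym (trans (cong ((⊖ 1p) ⊗_) (𝔽.+-identityˡ (⊖ 1p))) ⊖1⊗⊖1≡1)
    bottom : 0p ⊕ (⊖ 1p) ≡ (⊖ 1p) ⊗ 1p
    bottom = trans (𝔽.+-identityˡ (⊖ 1p)) (sym (𝔽.*-identityʳ (⊖ 1p)))

  -- The value `(-1)^k x`.
  alternating : ℕ → Fin p → Fin p
  alternating zero    x = x
  alternating (suc k) x = ⊖ alternating k x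

  alternating-⊕ : ∀ k x y → alternating k (x ⊕ y) ≡ alternating k x ⊕ alternating k y
  alternating-⊕ zero    x y = refl
  alternating-⊕ (suc k) x y = trans (cong ⊖_ (alternating-⊕ k x y))
      (sym (𝔽P.-‿+-comm (alternating k x) (alternating k y)))

  alternating-⊖ : ∀ k x → alternating k (⊖ x) ≡ ⊖ alternating k x
  alternating-⊖ zero    x = refl
  alternating-⊖ (suc k) x = cong ⊖_ (alternating-⊖ k x)

  -- Evaluation at the point `-1` by Horner's rule.
  eval-1 : Poly → Fin p
  eval-1 []      = 0p
  eval-1 (a ∷ f) = a ⊕ (⊖ eval-1 f)

  eval-1-[] : ∀ {f} → f ≃ [] → eval-1 f ≡ 0p
  eval-1-[] {[]} e = refl
  eval-1-[] {a ∷ f} e = trans (cong₂ (λ x y → x ⊕ (⊖ y)) (at e 0) (eval-1-[] {f} (tail-≃[] e))) (𝔽.-‿inverseʳ 0p)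

  eval-1-cong : ∀ {f g} → f ≃ g → eval-1 f ≡ eval-1 g
  eval-1-cong {[]}    {g}     e = sym (eval-1-[] {g} (≃-sym e))
  eval-1-cong {a ∷ f} {[]}    e = eval-1-[] {a ∷ f} e
  eval-1-cong {a ∷ f} {b ∷ g} e = cong₂ (λ x y → x ⊕ (⊖ y)) (at e 0) (eval-1-cong {f} {g} (tail-≃ e))

  open CommutativeSemigroupP 𝔽.+-commutativeSemigroup using (interchange)

  eval-1-addP : ∀ f g → eval-1 (addP f g) ≡ eval-1 f ⊕ eval-1 g
  eval-1-addP []      g       = sym (𝔽.+-identityˡ (eval-1 g))
  eval-1-addP (a ∷ f) []      = sym (𝔽.+-identityʳ (eval-1 (a ∷ f)))
  eval-1-addP (a ∷ f) (b ∷ g) = trans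
      (cong ((a ⊕ b) ⊕_) (trans (cong ⊖_ (eval-1-addP f g)) (sym (𝔽P.-‿+-comm (eval-1 f) (eval-1 g)))))
    (interchange a b (⊖ eval-1 f) (⊖ eval-1 g))

  eval-1-scaleP : ∀ c f → eval-1 (scaleP c f) ≡ c ⊗ eval-1 f
  eval-1-scaleP c []      = sym (𝔽.zeroʳ c)
  eval-1-scaleP c (a ∷ f) = trans (cong ((c ⊗ a) ⊕_) (trans (cong ⊖_ (eval-1-scaleP c f)) (𝔽P.-‿distribʳ-* c (eval-1 f))))
    (sym (⊗-distribˡ c a (⊖ eval-1 f)))

  eval-1-mulP : ∀ f g → eval-1 (mulP f g) ≡ eval-1 f ⊗ eval-1 g
  eval-1-mulP []      g = sym (𝔽.zeroˡ (eval-1 g))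
  eval-1-mulP (a ∷ f) g = begin
    eval-1 (addP (scaleP a g) (0p ∷ mulP f g))               ≡⟨ eval-1-addP (scaleP a g) (0p ∷ mulP f g) ⟩
    eval-1 (scaleP a g) ⊕ (0p ⊕ (⊖ eval-1 (mulP f g)))
      ≡⟨ cong₂ _⊕_ (eval-1-scaleP a g) (𝔽.+-identityˡ (⊖ eval-1 (mulP f g))) ⟩
    (a ⊗ eval-1 g) ⊕ (⊖ eval-1 (mulP f g))                   ≡⟨ cong ((a ⊗ eval-1 g) ⊕_)
                                                                  (trans (cong ⊖_ (eval-1-mulP f g))
                                                                    (𝔽P.-‿distribˡ-* (eval-1 f) (eval-1 g))) ⟩
    (a ⊗ eval-1 g) ⊕ ((⊖ eval-1 f) ⊗ eval-1 g)               ≡⟨ 𝔽.distribʳ (eval-1 g) a (⊖ eval-1 f) ⟨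
    (a ⊕ (⊖ eval-1 f)) ⊗ eval-1 g                            ∎
    where open ≡-Reasoning

  eval-1-∷ʳ : ∀ f a → eval-1 (f ∷ʳ a) ≡ eval-1 f ⊕ alternating (length f) a
  eval-1-∷ʳ []      a = trans (cong (a ⊕_) 𝔽P.-0#≈0#) (⊕-comm a 0p)
  eval-1-∷ʳ (b ∷ f) a = begin
    b ⊕ (⊖ eval-1 (f ∷ʳ a))                                ≡⟨ cong (λ z → b ⊕ (⊖ z)) (eval-1-∷ʳ f a) ⟩
    b ⊕ (⊖ (eval-1 f ⊕ alternating (length f) a))
      ≡⟨ cong (b ⊕_) (𝔽P.-‿+-comm (eval-1 f) (alternating (length f) a)) ⟨
    b ⊕ ((⊖ eval-1 f) ⊕ (⊖ alternating (length f) a))      ≡⟨ ⊕-assoc b (⊖ eval-1 f) (⊖ alternating (length f) a) ⟨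
    (b ⊕ (⊖ eval-1 f)) ⊕ (⊖ alternating (length f) a)      ∎
    where open ≡-Reasoning

  -- For a word of length `l` this is `f*(-1) = (-1)^(l-1) f(-1)`; the exponent `l - 1` is written
  -- as `l` with an extra sign so that `l = 0` is included.
  eval-1-reverse : ∀ f → eval-1 (reverse f) ≡ ⊖ alternating (length f) (eval-1 f)
  eval-1-reverse []      = sym 𝔽P.-0#≈0#
  eval-1-reverse (a ∷ f) = begin
    eval-1 (reverse (a ∷ f))                                   ≡⟨ cong eval-1 (ListP.unfold-reverse a f) ⟩
    eval-1 (reverse f ∷ʳ a)                                    ≡⟨ eval-1-∷ʳ (reverse f) a ⟩
    eval-1 (reverse f) ⊕ alternating (length (reverse f)) a
      ≡⟨ cong₂ _⊕_ (eval-1-reverse f) (cong (λ l → alternating l a) (ListP.length-reverse f)) ⟩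
    (⊖ alternating l (eval-1 f)) ⊕ alternating l a             ≡⟨ ⊕-comm (⊖ alternating l (eval-1 f)) (alternating l a) ⟩
    alternating l a ⊕ (⊖ alternating l (eval-1 f))             ≡⟨ cong (alternating l a ⊕_) (alternating-⊖ l (eval-1 f)) ⟨
    alternating l a ⊕ alternating l (⊖ eval-1 f)               ≡⟨ alternating-⊕ l a (⊖ eval-1 f) ⟨
    alternating l (a ⊕ (⊖ eval-1 f))                           ≡⟨ 𝔽P.-‿involutive (alternating l (a ⊕ (⊖ eval-1 f))) ⟨
    ⊖ (⊖ alternating l (a ⊕ (⊖ eval-1 f)))                     ∎
    where
    open ≡-Reasoning
    l = length f

  alternating-even : ∀ k x → alternating (k + k) x ≡ x
  alternating-even zero    x = refl
  alternating-even (suc k) x rewrite ℕP.+-suc k k = trans (𝔽P.-‿involutive (alternating (k + k) x)) (alternating-even k x)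

  -- For even length, reversal changes the sign of the value at `-1`. The value equals its own
  -- negative and vanishes because `p` is odd.
  palindrome-root : ∀ k {r} → Symmetric (k + k) 1p r → eval-1 r ≡ 0p
  palindrome-root k {r} (symmetric b h) = x⊕x≡0⇒x≡0 (eval-1 r) (trans (cong (_⊕ eval-1 r) flip) (𝔽.-‿inverseˡ (eval-1 r)))
    where
    open ≡-Reasoning
    flip : eval-1 r ≡ ⊖ eval-1 r
    flip = begin
      eval-1 r                                   ≡⟨ eval-1-cong {r} (≃-sym (≃-trans h (scaleP-1 r))) ⟩
      eval-1 (rev (k + k) r)                     ≡⟨ eval-1-reverse (fit (k + k) r) ⟩
      ⊖ alternating (length (fit (k + k) r)) (eval-1 (fit (k + k) r))
        ≡⟨ cong₂ (λ l x → ⊖ alternating l x) (length-fit (k + k) r) (eval-1-cong (fit-≃ r b)) ⟩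
      ⊖ alternating (k + k) (eval-1 r)           ≡⟨ cong ⊖_ (alternating-even k (eval-1 r)) ⟩
      ⊖ eval-1 r                                 ∎

  eval-1-xPowMinus1 : ∀ m → eval-1 (xPowMinus1 m) ≡ alternating m 1p ⊕ (⊖ 1p)
  eval-1-xPowMinus1 m = trans (eval-1-addP (monomialP 1p m) ((⊖ 1p) ∷ []))
    (cong₂ _⊕_ (mono m) (trans (cong ((⊖ 1p) ⊕_) 𝔽P.-0#≈0#) (𝔽.+-identityʳ (⊖ 1p))))
    where
    mono : ∀ m → eval-1 (monomialP 1p m) ≡ alternating m 1p
    mono zero    = trans (cong (1p ⊕_) 𝔽P.-0#≈0#) (𝔽.+-identityʳ 1p)
    mono (suc m) = trans (𝔽.+-identityˡ (⊖ eval-1 (monomialP 1p m))) (cong ⊖_ (mono m))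

  -- A palindrome of odd degree vanishes at -1, which is not a root of x^n - 1 for n odd.
  even-degree : ∀ {d r} k → Symmetric (suc d) 1p r → r ∣P xPowMinus1 (suc (k + k)) → Σ ℕ λ δ → d ≡ δ + δ
  even-degree {d} {r} k σ (h , e) with parity d
    where
    parity : ∀ d → Σ ℕ λ δ → d ≡ δ + δ ⊎ suc d ≡ δ + δ
    parity zero = 0 , inj₁ refl
    parity (suc d) with parity d
    ... | δ , inj₂ q = δ , inj₁ q
    ... | δ , inj₁ q = suc δ , inj₂ (cong suc (trans (cong suc q) (sym (ℕP.+-suc δ δ))))
  ... | δ , inj₁ q = δ , q
  ... | δ , inj₂ q = ⊥-elim (1⊕1≢0 (begin
      1p ⊕ 1p                                 ≡⟨ 𝔽P.-‿involutive (1p ⊕ 1p) ⟨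
      ⊖ (⊖ (1p ⊕ 1p))                         ≡⟨ cong ⊖_ (𝔽P.-‿+-comm 1p 1p) ⟨
      ⊖ ((⊖ 1p) ⊕ (⊖ 1p))                     ≡⟨ cong ⊖_ (trans (sym value) root) ⟩
      ⊖ 0p                                    ≡⟨ 𝔽P.-0#≈0# ⟩
      0p                                      ∎))
    where
    open ≡-Reasoning
    value : eval-1 (xPowMinus1 (suc (k + k))) ≡ (⊖ 1p) ⊕ (⊖ 1p)
    value = trans (eval-1-xPowMinus1 (suc (k + k))) (cong (λ x → (⊖ x) ⊕ (⊖ 1p)) (alternating-even k 1p))
    root : eval-1 (xPowMinus1 (suc (k + k))) ≡ 0p
    root = trans (eval-1-cong {xPowMinus1 (suc (k + k))} e) (trans (eval-1-mulP r h)
      (trans (cong (_⊗ eval-1 h) (palindrome-root δ {r} (subst (λ m → Symmetric m 1p r) q σ))) (𝔽.zeroˡ (eval-1 h))))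

-- Generating functions of independent statistics.

∑-upTo-suc : ∀ n (f : ℕ → ℕ) → ∑ (upTo (suc n)) f ≡ ∑ (upTo n) f + f n
∑-upTo-suc n f = trans (cong (λ xs → ∑ xs f) (sym (ListP.upTo-∷ʳ n)))
  (trans (∑-++ (upTo n) (n ∷ []) f) (cong (∑ (upTo n) f +_) (ℕP.+-identityʳ (f n))))

∑-upTo-δ : ∀ q {e} → e ≤ q → (f : ℕ → ℕ) → ∑ (upTo (suc q)) (λ i → iv (e ℕ.≟ i) * f i) ≡ f e
∑-upTo-δ q e≤q f = ∑-δ ℕ._≟_ (UniqueP.upTo⁺ (suc q)) (∈P.∈-upTo⁺ (s≤s e≤q)) f

-- Multiplication by `z^k` on coefficient sequences.
delay : ℕ → (ℕ → ℕ) → ℕ → ℕ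
delay zero    φ t       = φ t
delay (suc k) φ zero    = 0
delay (suc k) φ (suc t) = delay k φ t

delay-cong : ∀ k {φ ψ : ℕ → ℕ} → (∀ i → φ i ≡ ψ i) → ∀ t → delay k φ t ≡ delay k ψ t
delay-cong zero    e t       = e t
delay-cong (suc k) e zero    = refl
delay-cong (suc k) e (suc t) = delay-cong k e t

delay-* : ∀ c k φ t → delay k (λ i → c * φ i) t ≡ c * delay k φ t
delay-* c zero    φ t       = refl
delay-* c (suc k) φ zero    = sym (ℕP.*-zeroʳ c)
delay-* c (suc k) φ (suc t) = delay-* c k φ t

delay-∑ : ∀ (xs : List A) k (φ : A → ℕ → ℕ) t → ∑ xs (λ x → delay k (φ x) t) ≡ delay k (λ i → ∑ xs (λ x → φ x i)) t
delay-∑ xs zero    φ t       = refl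
delay-∑ xs (suc k) φ zero    = ∑-zero xs
delay-∑ xs (suc k) φ (suc t) = delay-∑ xs k φ t

iv-delay : ∀ k m t → iv (k + m ℕ.≟ t) ≡ delay k (λ i → iv (m ℕ.≟ i)) t
iv-delay zero    m t       = refl
iv-delay (suc k) m zero    = iv-no (suc (k + m) ℕ.≟ zero) (λ ())
iv-delay (suc k) m (suc t) = trans (iv-cong {e = k + m ℕ.≟ t} ℕP.suc-injective (cong suc)) (iv-delay k m t)

-- If `S e` counts the elements of rank at most `e`, this counts those of rank exactly `e`.
Δ : (ℕ → ℕ) → ℕ → ℕ
Δ S zero    = S zero
Δ S (suc e) = S (suc e) ∸ S e

iv-≟-≤ : ∀ r e → iv (r ℕ.≟ suc e) + iv (r ℕ.≤? e) ≡ iv (r ℕ.≤? suc e)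
iv-≟-≤ r e with r ℕ.≟ suc e
... | yes refl = trans (cong suc (iv-no (suc e ℕ.≤? e) ℕP.1+n≰n)) (sym (iv-yes (suc e ℕ.≤? suc e) ℕP.≤-refl))
... | no r≢ = iv-cong ℕP.m≤n⇒m≤1+n (λ l → ℕP.≤-pred (ℕP.≤∧≢⇒< l r≢))

module GeneratingFunctions (p : ℕ) .{{_ : NonZero p}} where
  open Fp p

  coeff-addN : ∀ f g t → coeffN (addN f g) t ≡ coeffN f t + coeffN g t
  coeff-addN []      g       t       = refl
  coeff-addN (a ∷ f) []      t       = sym (ℕP.+-identityʳ _)
  coeff-addN (a ∷ f) (b ∷ g) zero    = refl
  coeff-addN (a ∷ f) (b ∷ g) (suc t) = coeff-addN f g t

  coeff-scaleN : ∀ c f t → coeffN (map (c *_) f) t ≡ c * coeffN f t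
  coeff-scaleN c []      t       = sym (ℕP.*-zeroʳ c)
  coeff-scaleN c (a ∷ f) zero    = refl
  coeff-scaleN c (a ∷ f) (suc t) = coeff-scaleN c f t

  coeff-mulN-∷ : ∀ a f h t → coeffN (mulN (a ∷ f) h) t ≡ a * coeffN h t + delay 1 (coeffN (mulN f h)) t
  coeff-mulN-∷ a f h t = trans (coeff-addN (map (a *_) h) (0 ∷ mulN f h) t) (cong₂ _+_ (coeff-scaleN a h t) (shift t))
    where
    shift : ∀ t → coeffN (0 ∷ mulN f h) t ≡ delay 1 (coeffN (mulN f h)) t
    shift zero    = refl
    shift (suc t) = refl

  coeff-mulN-addN : ∀ f g h t → coeffN (mulN (addN f g) h) t ≡ coeffN (mulN f h) t + coeffN (mulN g h) t
  coeff-mulN-addN []      g       h t = refl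
  coeff-mulN-addN (a ∷ f) []      h t = sym (ℕP.+-identityʳ _)
  coeff-mulN-addN (a ∷ f) (b ∷ g) h t = begin
    coeffN (mulN ((a + b) ∷ addN f g) h) t
      ≡⟨ coeff-mulN-∷ (a + b) (addN f g) h t ⟩
    (a + b) * coeffN h t + delay 1 (coeffN (mulN (addN f g) h)) t
      ≡⟨ cong₂ _+_ (ℕP.*-distribʳ-+ (coeffN h t) a b) (split t) ⟩
    (a * coeffN h t + b * coeffN h t) + (delay 1 (coeffN (mulN f h)) t + delay 1 (coeffN (mulN g h)) t)
      ≡⟨ interchange (a * coeffN h t) _ _ _ ⟩
    (a * coeffN h t + delay 1 (coeffN (mulN f h)) t) + (b * coeffN h t + delay 1 (coeffN (mulN g h)) t)
      ≡⟨ cong₂ _+_ (coeff-mulN-∷ a f h t) (coeff-mulN-∷ b g h t) ⟨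
    coeffN (mulN (a ∷ f) h) t + coeffN (mulN (b ∷ g) h) t ∎
    where
    open ≡-Reasoning
    open import Algebra.Properties.CommutativeSemigroup ℕP.+-commutativeSemigroup using (interchange)
    split : ∀ t → delay 1 (coeffN (mulN (addN f g) h)) t ≡ delay 1 (coeffN (mulN f h)) t + delay 1 (coeffN (mulN g h)) t
    split zero    = refl
    split (suc t) = coeff-mulN-addN f g h t

  coeff-mulN-monoN : ∀ c k h t → coeffN (mulN (monoN c k) h) t ≡ delay k (λ i → c * coeffN h i) t
  coeff-mulN-monoN c zero h t = trans (coeff-mulN-∷ c [] h t)
      (trans (cong (c * coeffN h t +_) (zeros t)) (ℕP.+-identityʳ _))
    where
    zeros : ∀ t → delay 1 (coeffN []) t ≡ 0
    zeros zero    = refl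
    zeros (suc t) = refl
  coeff-mulN-monoN c (suc k) h t = trans (coeff-mulN-∷ 0 (monoN c k) h t) (step t)
    where
    step : ∀ t → delay 1 (coeffN (mulN (monoN c k) h)) t ≡ delay (suc k) (λ i → c * coeffN h i) t
    step zero    = refl
    step (suc t) = coeff-mulN-monoN c k h t

  coeff-mulN-sumN : ∀ (js : List ℕ) (F : ℕ → PolyN) h t →
    coeffN (mulN (sumN (map F js)) h) t ≡ ∑ js (λ j → coeffN (mulN (F j) h) t)
  coeff-mulN-sumN []       F h t = refl
  coeff-mulN-sumN (j ∷ js) F h t = trans (coeff-mulN-addN (F j) (sumN (map F js)) h t)
    (cong (coeffN (mulN (F j) h) t +_) (coeff-mulN-sumN js F h t))

  -- The common shape of `factorA` and `factorG`: multiplication by either is a sum of delayed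
  -- multiples.
  coeff-mulN-1+monomials : ∀ m (c k : ℕ → ℕ) h t →
    coeffN (mulN (addN (1 ∷ []) (sumN (map (λ j → monoN (c j) (k j)) (range1 m)))) h) t
    ≡ 1 * coeffN h t + ∑ (upTo m) (λ j → delay (k (suc j)) (λ i → c (suc j) * coeffN h i) t)
  coeff-mulN-1+monomials m c k h t = trans (coeff-mulN-addN (1 ∷ []) (sumN (map (λ j → monoN (c j) (k j)) (range1 m)))
      h t) (cong₂ _+_ (coeff-mulN-monoN 1 0 h t)
    (trans (coeff-mulN-sumN (range1 m) (λ j → monoN (c j) (k j)) h t)
      (trans (∑-map suc (upTo m) _) (∑-cong (upTo m) (λ j → coeff-mulN-monoN (c (suc j)) (k (suc j)) h t)))))

  -- A weighted statistic on A with values in {0,…,q}; S is the tail count of the statistic and G the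
  -- polynomial Σ_e (S e - S (e - 1)) z^(e d), described by how multiplication by it acts.
  record Statistic (A : Set) (q : ℕ) : Set where
    field
      rank   : A → ℕ
      S      : ℕ → ℕ
      d      : ℕ
      G      : PolyN
      rank≤q : ∀ x → rank x ≤ q
      G-mul  : ∀ h t → coeffN (mulN G h) t ≡ ∑ (upTo (suc q)) (λ e → delay (e * d) (λ i → Δ S e * coeffN h i) t)

  open Statistic

  module _ {A : Set} {q : ℕ} where
    Bounds : List (Statistic A q) → List ℕ → Set
    Bounds []       []       = ⊤
    Bounds (s ∷ ss) (b ∷ bs) = b ≤ q × Bounds ss bs
    Bounds _        _        = ⊥

    below : List (Statistic A q) → List ℕ → A → ℕ
    below (s ∷ ss) (b ∷ bs) x = iv (rank s x ℕ.≤? b) * below ss bs x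
    below _        _        x = 1

    tails : List (Statistic A q) → List ℕ → ℕ
    tails (s ∷ ss) (b ∷ bs) = S s b * tails ss bs
    tails _        _        = 1

    totalRank : List (Statistic A q) → A → ℕ
    totalRank []       x = 0
    totalRank (s ∷ ss) x = rank s x * d s + totalRank ss x

    -- Slice by the value e of the first statistic: an exact count is a difference of two tail counts,
    -- so the slices again satisfy the hypothesis, with c multiplied by Δ S e.
    independent⇒product : ∀ (ss : List (Statistic A q)) xs (μ : A → ℕ) c →
      (∀ bs → Bounds ss bs → ∑ xs (λ x → μ x * below ss bs x) ≡ c * tails ss bs) →
      ∀ t → ∑ xs (λ x → μ x * iv (totalRank ss x ℕ.≟ t)) ≡ c * coeffN (prodN (map G ss)) t
    independent⇒product [] xs μ c hyp zero = hyp [] tt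
    independent⇒product [] xs μ c hyp (suc t) = trans (∑-cong xs (λ x → ℕP.*-zeroʳ (μ x)))
        (trans (∑-zero xs) (sym (ℕP.*-zeroʳ c)))
    independent⇒product (s ∷ ss) xs μ c hyp t = begin
      ∑ xs (λ x → μ x * iv (rank s x * d s + totalRank ss x ℕ.≟ t))
        ≡⟨ ∑-cong xs (λ x → sym (∑-upTo-δ q (rank≤q s x) (λ e → μ x * iv (e * d s + totalRank ss x ℕ.≟ t)))) ⟩
      ∑ xs (λ x → ∑ (upTo (suc q)) (λ e → iv (rank s x ℕ.≟ e) * (μ x * iv (e * d s + totalRank ss x ℕ.≟ t))))
        ≡⟨ ∑-swap xs (upTo (suc q)) _ ⟩
      ∑ (upTo (suc q)) (λ e → ∑ xs (λ x → iv (rank s x ℕ.≟ e) * (μ x * iv (e * d s + totalRank ss x ℕ.≟ t))))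
        ≡⟨ ∑-cong∈ (upTo (suc q)) (λ e e∈ → slice e (ℕP.≤-pred (∈P.∈-upTo⁻ e∈))) ⟩
      ∑ (upTo (suc q)) (λ e → c * delay (e * d s) (λ i → Δ (S s) e * coeffN rest i) t)
        ≡⟨ ∑-*ˡ c (upTo (suc q)) _ ⟩
      c * ∑ (upTo (suc q)) (λ e → delay (e * d s) (λ i → Δ (S s) e * coeffN rest i) t)
        ≡⟨ cong (c *_) (G-mul s rest t) ⟨
      c * coeffN (mulN (G s) rest) t ∎
      where
      open ≡-Reasoning
      rest = prodN (map G ss)
      μ' : ℕ → A → ℕ
      μ' e x = μ x * iv (rank s x ℕ.≟ e)
      assoc-hyp : ∀ b bs → b ≤ q → Bounds ss bs → ∑ xs (λ x → μ x * iv (rank s x ℕ.≤? b) * below ss bs x)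
          ≡ c * S s b * tails ss bs
      assoc-hyp b bs b≤q adm = trans (∑-cong xs (λ x → ℕP.*-assoc (μ x) _ _))
          (trans (hyp (b ∷ bs) (b≤q , adm)) (sym (ℕP.*-assoc c _ _)))
      hyp' : ∀ e → e ≤ q → ∀ bs → Bounds ss bs → ∑ xs (λ x → μ' e x * below ss bs x) ≡ c * Δ (S s) e * tails ss bs
      hyp' zero    e≤q bs adm = trans (∑-cong xs (λ x → cong (λ z → μ x * z * below ss bs x)
          (iv-cong {d = rank s x ℕ.≟ 0} {rank s x ℕ.≤? 0} ℕP.≤-reflexive ℕP.n≤0⇒n≡0))) (assoc-hyp 0 bs z≤n adm)
      hyp' (suc e) e≤q bs adm = begin
        ∑ xs (λ x → μ' (suc e) x * below ss bs x)
          -- The tail count up to `e` is added and subtracted. Together with the count at `e + 1` it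
          -- is the next tail count, so the truncated subtraction loses nothing.
          ≡⟨ ℕP.m+n∸n≡m (∑ xs (λ x → μ' (suc e) x * below ss bs x))
            (∑ xs (λ x → μ x * iv (rank s x ℕ.≤? e) * below ss bs x)) ⟨
        ∑ xs (λ x → μ' (suc e) x * below ss bs x) + ∑ xs (λ x → μ x * iv (rank s x ℕ.≤? e) * below ss bs x)
          ∸ ∑ xs (λ x → μ x * iv (rank s x ℕ.≤? e) * below ss bs x)
          ≡⟨ cong₂ _∸_ (trans (sym (∑-+ xs _ _)) (trans (∑-cong xs merge) (assoc-hyp (suc e) bs e≤q adm)))
                       (assoc-hyp e bs (ℕP.≤-trans (ℕP.n≤1+n e) e≤q) adm) ⟩
        c * S s (suc e) * tails ss bs ∸ c * S s e * tails ss bs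
          ≡⟨ ℕP.*-distribʳ-∸ (tails ss bs) (c * S s (suc e)) (c * S s e) ⟨
        (c * S s (suc e) ∸ c * S s e) * tails ss bs
          ≡⟨ cong (_* tails ss bs) (ℕP.*-distribˡ-∸ c (S s (suc e)) (S s e)) ⟨
        c * (S s (suc e) ∸ S s e) * tails ss bs ∎
        where
        merge : ∀ x → μ' (suc e) x * below ss bs x + μ x * iv (rank s x ℕ.≤? e) * below ss bs x
                      ≡ μ x * iv (rank s x ℕ.≤? suc e) * below ss bs x
        merge x = trans (sym (ℕP.*-distribʳ-+ (below ss bs x) (μ' (suc e) x) _)) (cong (_* below ss bs x)
          (trans (sym (ℕP.*-distribˡ-+ (μ x) _ _)) (cong (μ x *_) (iv-≟-≤ (rank s x) e))))
      slice : ∀ e → e ≤ q → ∑ xs (λ x → iv (rank s x ℕ.≟ e) * (μ x * iv (e * d s + totalRank ss x ℕ.≟ t)))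
                        ≡ c * delay (e * d s) (λ i → Δ (S s) e * coeffN rest i) t
      slice e e≤q = begin
        ∑ xs (λ x → iv (rank s x ℕ.≟ e) * (μ x * iv (e * d s + totalRank ss x ℕ.≟ t)))
          ≡⟨ ∑-cong xs (λ x → trans (sym (ℕP.*-assoc (iv (rank s x ℕ.≟ e)) (μ x) _))
            (cong₂ _*_ (ℕP.*-comm (iv (rank s x ℕ.≟ e)) (μ x))
               (iv-delay (e * d s) (totalRank ss x) t))) ⟩
        ∑ xs (λ x → μ' e x * delay (e * d s) (λ i → iv (totalRank ss x ℕ.≟ i)) t)
          ≡⟨ ∑-cong xs (λ x → sym (delay-* (μ' e x) (e * d s) _ t)) ⟩
        ∑ xs (λ x → delay (e * d s) (λ i → μ' e x * iv (totalRank ss x ℕ.≟ i)) t)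
          ≡⟨ delay-∑ xs (e * d s) _ t ⟩
        delay (e * d s) (λ i → ∑ xs (λ x → μ' e x * iv (totalRank ss x ℕ.≟ i))) t
          ≡⟨ delay-cong (e * d s) (λ i → trans (independent⇒product ss xs (μ' e) (c * Δ (S s) e) (hyp' e e≤q) i)
            (ℕP.*-assoc c _ _)) t ⟩
        delay (e * d s) (λ i → c * (Δ (S s) e * coeffN rest i)) t
          ≡⟨ delay-* c (e * d s) _ t ⟩
        c * delay (e * d s) (λ i → Δ (S s) e * coeffN rest i) t ∎

  ∑-upTo-∷ : ∀ q (f : ℕ → ℕ) → ∑ (upTo (suc q)) f ≡ f 0 + ∑ (upTo q) (f ∘ suc)
  ∑-upTo-∷ q f = cong (f 0 +_) (trans (cong (λ xs → ∑ xs f) (sym (ListP.map-upTo suc q))) (∑-map suc (upTo q) f))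

  -- The number of palindromes of length `b`.
  halfPower : ℕ → ℕ
  halfPower b = p ^ ⌈ b /2⌉

  ⌈k+k/2⌉ : ∀ k → ⌈ k + k /2⌉ ≡ k
  ⌈k+k/2⌉ zero = refl
  ⌈k+k/2⌉ (suc k) rewrite ℕP.+-suc k k = cong suc (⌈k+k/2⌉ k)

  ⌈1+k+k/2⌉ : ∀ k → ⌈ suc (k + k) /2⌉ ≡ suc k
  ⌈1+k+k/2⌉ zero = refl
  ⌈1+k+k/2⌉ (suc k) rewrite ℕP.+-suc k k = cong suc (⌈1+k+k/2⌉ k)

  -- Only the odd increments of p^⌈b/2⌉ survive.
  ∑-Δ-halfPower : ∀ (g : ℕ → ℕ → ℕ) → (∀ e → g 0 e ≡ 0) → ∀ h →
    ∑ (upTo (suc (suc (h + h)))) (λ e → g (Δ halfPower e) e)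
    ≡ g 1 0 + ∑ (upTo (suc h)) (λ j → g (p ^ j * (p ∸ 1)) (suc (j + j)))
  ∑-Δ-halfPower g g0 zero = cong (g 1 0 +_)
      (cong (λ x → g x 1 + 0) (trans (cong (_∸ 1) (ℕP.*-identityʳ p)) (sym (ℕP.+-identityʳ _))))
  ∑-Δ-halfPower g g0 (suc h) rewrite ℕP.+-suc h h = begin
    ∑ (upTo (4 + (h + h))) f                           ≡⟨ ∑-upTo-suc (3 + (h + h)) f ⟩
    ∑ (upTo (3 + (h + h))) f + f (3 + (h + h))         ≡⟨ cong (_+ f (3 + (h + h))) (∑-upTo-suc (2 + (h + h)) f) ⟩
    ∑ (upTo (2 + (h + h))) f + f (2 + (h + h)) + f (3 + (h + h))
      ≡⟨ cong₂ (λ x y → ∑ (upTo (2 + (h + h))) f + x + y) even odd ⟩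
    ∑ (upTo (2 + (h + h))) f + 0 + g' (suc h)
      ≡⟨ cong (_+ g' (suc h)) (trans (ℕP.+-identityʳ _) (∑-Δ-halfPower g g0 h)) ⟩
    g 1 0 + ∑ (upTo (suc h)) g' + g' (suc h)           ≡⟨ ℕP.+-assoc (g 1 0) _ _ ⟩
    g 1 0 + (∑ (upTo (suc h)) g' + g' (suc h))         ≡⟨ cong (g 1 0 +_) (∑-upTo-suc (suc h) g') ⟨
    g 1 0 + ∑ (upTo (suc (suc h))) g'                  ∎
    where
    open ≡-Reasoning
    f = λ e → g (Δ halfPower e) e
    g' = λ j → g (p ^ j * (p ∸ 1)) (suc (j + j))
    even : f (2 + (h + h)) ≡ 0
    even = trans (cong (λ x → g x (2 + (h + h))) (trans (cong₂ (λ x y → p ^ suc x ∸ p ^ y) (⌈k+k/2⌉ h) (⌈1+k+k/2⌉ h))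
        (ℕP.n∸n≡0 (p ^ suc h)))) (g0 _)
    odd : f (3 + (h + h)) ≡ g' (suc h)
    odd = cong₂ g (begin
      p ^ suc ⌈ suc (h + h) /2⌉ ∸ p ^ suc ⌈ h + h /2⌉
        ≡⟨ cong₂ (λ x y → p ^ suc x ∸ p ^ suc y) (⌈1+k+k/2⌉ h) (⌈k+k/2⌉ h) ⟩
      p * p ^ suc h ∸ p ^ suc h
        ≡⟨ cong₂ _∸_ (ℕP.*-comm p (p ^ suc h)) (sym (ℕP.*-identityʳ (p ^ suc h))) ⟩
      p ^ suc h * p ∸ p ^ suc h * 1                     ≡⟨ ℕP.*-distribˡ-∸ (p ^ suc h) p 1 ⟨
      p ^ suc h * (p ∸ 1)                               ∎) (cong (λ x → 2 + x) (sym (ℕP.+-suc h h)))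

  -- The even increments vanish, and with `q = 2 h + 1` the exponents `2 j - 1` up to `q` are
  -- exactly `h + 1 = (q + 1) / 2` in number.
  factorA-mul : ∀ v h → p ^ v ≡ suc (h + h) → ∀ f t →
    coeffN (mulN (factorA v) f) t ≡ ∑ (upTo (suc (p ^ v))) (λ e → delay (e * 1) (λ i → Δ halfPower e * coeffN f i) t)
  factorA-mul v h q≡ f t = begin
    coeffN (mulN (factorA v) f) t
      ≡⟨ coeff-mulN-1+monomials ((p ^ v + 1) / 2) (λ j → p ^ (j ∸ 1) * (p ∸ 1)) (λ j → 2 * j ∸ 1) f t ⟩
    1 * coeffN f t + ∑ (upTo ((p ^ v + 1) / 2)) (λ j → delay (2 * suc j ∸ 1) (λ i → p ^ j * (p ∸ 1) * coeffN f i) t)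
      ≡⟨ cong₂ (λ m (F : ℕ → ℕ) → 1 * coeffN f t + ∑ (upTo m) F) half refl ⟩
    1 * coeffN f t + ∑ (upTo (suc h)) (λ j → delay (2 * suc j ∸ 1) (λ i → p ^ j * (p ∸ 1) * coeffN f i) t)
      ≡⟨ cong (1 * coeffN f t +_) (∑-cong (upTo (suc h))
        (λ j → cong (λ k → delay k (λ i → p ^ j * (p ∸ 1) * coeffN f i) t) (exponent j))) ⟩
    1 * coeffN f t + ∑ (upTo (suc h)) (λ j → delay (suc (j + j) * 1) (λ i → p ^ j * (p ∸ 1) * coeffN f i) t)
      ≡⟨ ∑-Δ-halfPower (λ c e → delay (e * 1) (λ i → c * coeffN f i) t) (λ e → delay-* 0 (e * 1) (coeffN f) t) h ⟨
    ∑ (upTo (suc (suc (h + h)))) (λ e → delay (e * 1) (λ i → Δ halfPower e * coeffN f i) t)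
      ≡⟨ cong (λ q → ∑ (upTo (suc q)) (λ e → delay (e * 1) (λ i → Δ halfPower e * coeffN f i) t)) q≡ ⟨
    ∑ (upTo (suc (p ^ v))) (λ e → delay (e * 1) (λ i → Δ halfPower e * coeffN f i) t) ∎
    where
    open ≡-Reasoning
    open SemiringSolver ℕP.+-*-commutativeSemiring using (solve; _:+_; _:*_; _:=_; con)
    half : (p ^ v + 1) / 2 ≡ suc h
    half = trans (cong (λ q → (q + 1) / 2) q≡)
        (trans (cong (_/ 2) (solve 1 (λ h → con 1 :+ (h :+ h) :+ con 1 := (con 1 :+ h) :* con 2) refl h))
          (m*n/n≡m (suc h) 2))
    exponent : ∀ j → 2 * suc j ∸ 1 ≡ suc (j + j) * 1
    exponent j = solve 1 (λ j → j :+ (con 1 :+ (j :+ con 0)) := (con 1 :+ (j :+ j)) :* con 1) refl j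

  -- With `d = 2 δ` both halvings in the coefficient are exact, and the coefficient for `j` is the
  -- increment of `p ^ (b * δ)` at `b = j`; the leading 1 is its value at 0.
  factorG-mul : ∀ v r d δ → d ≡ δ + δ → (∀ j → degP (powP r j) ≡ j * d) → degP r ≡ d → ∀ f t →
    coeffN (mulN (factorG v r) f) t
      ≡ ∑ (upTo (suc (p ^ v))) (λ e → delay (e * d) (λ i → Δ (λ b → p ^ (b * δ)) e * coeffN f i) t)
  factorG-mul v r d δ d≡ degs deg f t = begin
    coeffN (mulN (factorG v r) f) t
      ≡⟨ coeff-mulN-1+monomials (p ^ v) (λ j → p ^ (degP (powP r j) / 2) ∸ p ^ ((degP (powP r j) ∸ degP r) / 2))
        (λ j → j * degP r) f t ⟩
    1 * coeffN f t + ∑ (upTo (p ^ v))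
      (λ j → delay (suc j * degP r) (λ i →
        (p ^ (degP (powP r (suc j)) / 2) ∸ p ^ ((degP (powP r (suc j)) ∸ degP r) / 2)) * coeffN f i) t)
      ≡⟨ cong (1 * coeffN f t +_) (∑-cong (upTo (p ^ v)) (λ j → cong₂ (λ k c → delay k (λ i → c * coeffN f i) t)
        (cong (suc j *_) deg) (increment j))) ⟩
    1 * coeffN f t + ∑ (upTo (p ^ v)) (λ j → delay (suc j * d) (λ i → (p ^ (suc j * δ) ∸ p ^ (j * δ)) * coeffN f i) t)
      ≡⟨ ∑-upTo-∷ (p ^ v) (λ e → delay (e * d) (λ i → Δ (λ b → p ^ (b * δ)) e * coeffN f i) t) ⟨
    ∑ (upTo (suc (p ^ v))) (λ e → delay (e * d) (λ i → Δ (λ b → p ^ (b * δ)) e * coeffN f i) t) ∎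
    where
    open ≡-Reasoning
    open SemiringSolver ℕP.+-*-commutativeSemiring using (solve; _:+_; _:*_; _:=_; con)
    half : ∀ j → j * d / 2 ≡ j * δ
    half j = trans (cong (_/ 2) (trans (cong (j *_) d≡) (solve 2 (λ j δ → j :* (δ :+ δ) := j :* δ :* con 2) refl j
        δ))) (m*n/n≡m (j * δ) 2)
    increment : ∀ j → p ^ (degP (powP r (suc j)) / 2) ∸ p ^ ((degP (powP r (suc j)) ∸ degP r) / 2)
        ≡ p ^ (suc j * δ) ∸ p ^ (j * δ)
    increment j = cong₂ (λ x y → p ^ x ∸ p ^ y) (trans (cong (_/ 2) (degs (suc j))) (half (suc j)))
      (trans (cong (_/ 2) (trans (cong₂ _∸_ (degs (suc j)) deg) (ℕP.m+n∸m≡n d (j * d)))) (half j))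

-- Finite fields: Frobenius, bounds on roots, the prime subfield.

prime∤! : ∀ {p} → Prime p → ∀ m → m < p → p ∤ m !
prime∤! {p} pp zero m<p d = ℕP.<⇒≱ (ℕ.nonTrivial⇒n>1 p {{prime⇒nonTrivial pp}}) (∣⇒≤ d)
prime∤! pp (suc m) m<p d with euclidsLemma (suc m) (m !) pp d
... | inj₁ d' = ℕP.<⇒≱ m<p (∣⇒≤ d')
... | inj₂ d' = prime∤! pp m (ℕP.<-trans (ℕP.n<1+n m) m<p) d'

-- `p` divides `p! = (p C k) k! (p - k)!` but neither of the two factorials.
prime∣binomial : ∀ {p} → Prime p → ∀ k → 0 < k → k < p → p ∣ p C k
prime∣binomial {p@(suc p')} pp k 0<k k<p with euclidsLemma (p C k) (k ! * (p ∸ k) !) pp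
  (subst (p ∣_) (sym product) (m∣m*n (p' !)))
  where
  instance nz = k ℕP.!* (p ∸ k) !≢0
  product : (p C k) * (k ! * (p ∸ k) !) ≡ p !
  product = trans (cong (_* (k ! * (p ∸ k) !)) (nCk≡n!/k![n-k]! (ℕP.<⇒≤ k<p))) (m/n*n≡m (k![n∸k]!∣n! (ℕP.<⇒≤ k<p)))
... | inj₁ d = d
... | inj₂ d with euclidsLemma (k !) ((p ∸ k) !) pp d
...   | inj₁ d' = ⊥-elim (prime∤! pp k k<p d')
...   | inj₂ d' = ⊥-elim (prime∤! pp (p ∸ k) (ℕP.∸-monoʳ-< 0<k (ℕP.<⇒≤ k<p)) d')

module FieldTheory {p n : ℕ} .{{_ : NonZero p}} (pp : Prime p) (K : FiniteField p n) where
  open FiniteField K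
  open Fp p
  open Residues p
  open OverField K

  KRing : CommutativeRing _ _
  KRing = record { isCommutativeRing = isCommutativeRing }

  module 𝕂 = CommutativeRing KRing
  module 𝕂P = RingP 𝕂.ring
  module +P = CommutativeSemigroupP 𝕂.+-commutativeSemigroup
  module *P = CommutativeSemigroupP 𝕂.*-commutativeSemigroup
  open SemiringSolver 𝕂.commutativeSemiring using (solve; _:+_; _:*_; _:=_; con)
  private
    module × = SemiringMult 𝕂.semiring
    module ×M = MonoidMult 𝕂.+-monoid
    module ^ = SemiringExp 𝕂.semiring

  K-enumeration : Enumeration F
  K-enumeration = record { list = elems ; complete = complete ; unique = unique ; _≟_ = _≟F_ }

  *F-zero-product : ∀ {x y} → x *F y ≡ 0F → x ≢ 0F → y ≡ 0F
  *F-zero-product {x} {y} e x≢0 with z , xz ← inverse x x≢0 = begin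
    y                ≡⟨ 𝕂.*-identityˡ y ⟨
    1F *F y          ≡⟨ cong (_*F y) (trans (sym xz) (𝕂.*-comm x z)) ⟩
    z *F x *F y      ≡⟨ 𝕂.*-assoc z x y ⟩
    z *F (x *F y)    ≡⟨ cong (z *F_) e ⟩
    z *F 0F          ≡⟨ 𝕂.zeroʳ z ⟩
    0F ∎
    where open ≡-Reasoning

  *F-≢0 : ∀ {x y} → x ≢ 0F → y ≢ 0F → x *F y ≢ 0F
  *F-≢0 x≢0 y≢0 e = y≢0 (*F-zero-product e x≢0)

  *F-cancelˡ : ∀ {a x y} → a ≢ 0F → a *F x ≡ a *F y → x ≡ y
  *F-cancelˡ {a} {x} {y} a≢0 e = 𝕂P.x∙y⁻¹≈ε⇒x≈y x y (*F-zero-product {a} {x 𝕂.- y}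
    (trans (𝕂P.x[y-z]≈xy-xz a x y) (trans (cong (𝕂._- (a *F y)) e) (𝕂.-‿inverseʳ (a *F y)))) a≢0)

  powF≡^ : ∀ x k → powF x k ≡ x ^.^ k
  powF≡^ x zero    = refl
  powF≡^ x (suc k) = cong (x *F_) (powF≡^ x k)

  powF-+ : ∀ x a b → powF x (a + b) ≡ powF x a *F powF x b
  powF-+ x zero    b = sym (𝕂.*-identityˡ _)
  powF-+ x (suc a) b = trans (cong (x *F_) (powF-+ x a b)) (sym (𝕂.*-assoc x _ _))

  powF-* : ∀ x a b → powF x (a * b) ≡ powF (powF x a) b
  powF-* x a zero    = cong (powF x) (ℕP.*-zeroʳ a)
  powF-* x a (suc b) = trans (cong (powF x) (ℕP.*-suc a b))
      (trans (powF-+ x a (a * b)) (cong (powF x a *F_) (powF-* x a b)))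

  powF-distrib : ∀ x y k → powF (x *F y) k ≡ powF x k *F powF y k
  powF-distrib x y zero    = sym (𝕂.*-identityˡ 1F)
  powF-distrib x y (suc k) = trans (cong (x *F y *F_) (powF-distrib x y k)) (*P.interchange x y (powF x k) (powF y k))

  powF-zero : ∀ k → .{{_ : NonZero k}} → powF 0F k ≡ 0F
  powF-zero (suc k) = 𝕂.zeroˡ _

  powF-one : ∀ k → powF 1F k ≡ 1F
  powF-one zero    = refl
  powF-one (suc k) = trans (𝕂.*-identityˡ _) (powF-one k)

  sumF-↭ : ∀ {xs ys} → xs ↭ ys → sumF xs ≡ sumF ys
  sumF-↭ ↭.refl = refl
  sumF-↭ (↭.prep x q) = cong (x +F_) (sumF-↭ q)
  sumF-↭ (↭.swap x y q) = trans (cong (λ s → x +F (y +F s)) (sumF-↭ q)) (+P.x∙yz≈y∙xz x y _)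
  sumF-↭ (↭.trans q r) = trans (sumF-↭ q) (sumF-↭ r)

  prodF : List F → F
  prodF = foldr _*F_ 1F

  prodF-↭ : ∀ {xs ys} → xs ↭ ys → prodF xs ≡ prodF ys
  prodF-↭ ↭.refl = refl
  prodF-↭ (↭.prep x q) = cong (x *F_) (prodF-↭ q)
  prodF-↭ (↭.swap x y q) = trans (cong (λ s → x *F (y *F s)) (prodF-↭ q)) (*P.x∙yz≈y∙xz x y _)
  prodF-↭ (↭.trans q r) = trans (prodF-↭ q) (prodF-↭ r)

  prodF-map : ∀ a xs → prodF (map (a *F_) xs) ≡ powF a (length xs) *F prodF xs
  prodF-map a []       = sym (𝕂.*-identityˡ 1F)
  prodF-map a (x ∷ xs) = trans (cong (a *F x *F_) (prodF-map a xs)) (*P.interchange a x _ _)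

  prodF-≢0 : ∀ {xs} → All (_≢ 0F) xs → prodF xs ≢ 0F
  prodF-≢0 []       e = 0≢1 (sym e)
  prodF-≢0 (h ∷ hs) = *F-≢0 h (prodF-≢0 hs)

  nonzeros : List F
  nonzeros = filter (λ x → ¬? (x ≟F 0F)) elems

  nonzeros-unique : Unique nonzeros
  nonzeros-unique = UniqueP.filter⁺ _ unique

  ∈-nonzeros : ∀ {x} → x ≢ 0F → x ∈ nonzeros
  ∈-nonzeros {x} h = ∈P.∈-filter⁺ _ (complete x) h

  nonzero : ∀ {x} → x ∈ nonzeros → x ≢ 0F
  nonzero m = proj₂ (∈P.∈-filter⁻ (λ x → ¬? (x ≟F 0F)) {xs = elems} m)

  length-nonzeros : length elems ≡ suc (length nonzeros)
  length-nonzeros = ↭P.↭-length (unique-↭ unique (All.tabulate (λ m e → nonzero m (sym e)) ∷ nonzeros-unique) to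
      (λ _ → complete _))
    where
    to : ∀ {x} → x ∈ elems → x ∈ 0F ∷ nonzeros
    to {x} _ with x ≟F 0F
    ... | yes refl = here refl
    ... | no x≢0   = there (∈-nonzeros x≢0)

  -- Multiplication by x ≠ 0 permutes the nonzero elements, so x^(p^n - 1) fixes their product.
  powF-card : ∀ x → powF x (p ^ n) ≡ x
  powF-card x with x ≟F 0F
  ... | yes refl = powF-zero (p ^ n) {{ℕP.m^n≢0 p n}}
  ... | no x≢0 = begin
      powF x (p ^ n)                 ≡⟨ cong (powF x) (trans (sym card) length-nonzeros) ⟩
      x *F powF x (length nonzeros)  ≡⟨ cong (x *F_) order ⟩
      x *F 1F                        ≡⟨ 𝕂.*-identityʳ x ⟩
      x                              ∎
    where
    open ≡-Reasoning
    P = prodF nonzeros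
    x⁻¹ = proj₁ (inverse x x≢0)
    permuted : map (x *F_) nonzeros ↭ nonzeros
    permuted = unique-↭ (UniqueP.map⁺ (*F-cancelˡ x≢0) nonzeros-unique) nonzeros-unique to from
      where
      to : ∀ {y} → y ∈ map (x *F_) nonzeros → y ∈ nonzeros
      to m with z , z∈ , refl ← ∈P.∈-map⁻ (x *F_) m = ∈-nonzeros (*F-≢0 x≢0 (nonzero z∈))
      from : ∀ {y} → y ∈ nonzeros → y ∈ map (x *F_) nonzeros
      from {y} m = subst (_∈ map (x *F_) nonzeros) back (∈P.∈-map⁺ (x *F_) (∈-nonzeros quotient≢0))
        where
        back : x *F (x⁻¹ *F y) ≡ y
        back = trans (sym (𝕂.*-assoc x x⁻¹ y)) (trans (cong (_*F y) (proj₂ (inverse x x≢0))) (𝕂.*-identityˡ y))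
        quotient≢0 : x⁻¹ *F y ≢ 0F
        quotient≢0 e = nonzero m (trans (sym back) (trans (cong (x *F_) e) (𝕂.zeroʳ x)))
    order : powF x (length nonzeros) ≡ 1F
    order = *F-cancelˡ (prodF-≢0 (All.tabulate nonzero)) (begin
      P *F powF x (length nonzeros)  ≡⟨ 𝕂.*-comm P _ ⟩
      powF x (length nonzeros) *F P  ≡⟨ prodF-map x nonzeros ⟨
      prodF (map (x *F_) nonzeros)   ≡⟨ prodF-↭ permuted ⟩
      P                              ≡⟨ 𝕂.*-identityʳ P ⟨
      P *F 1F                        ∎)

  nat : ℕ → F
  nat m = m ×.× 1F

  nat-+ : ∀ a b → nat (a + b) ≡ nat a +F nat b
  nat-+ a b = ×M.×-homo-+ 1F a b

  nat-* : ∀ a b → nat (a * b) ≡ nat a *F nat b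
  nat-* a b = ×.×1-homo-* a b

  sumF-map-+ : ∀ c xs → sumF (map (c +F_) xs) ≡ length xs ×.× c +F sumF xs
  sumF-map-+ c []       = sym (𝕂.+-identityˡ 0F)
  sumF-map-+ c (x ∷ xs) = trans (cong (c +F x +F_) (sumF-map-+ c xs)) (+P.interchange c x _ _)

  nat-^ : ∀ m k → nat m ≢ 0F → nat (m ^ k) ≢ 0F
  nat-^ m zero    h e = 0≢1 (sym (trans (sym (𝕂.+-identityʳ 1F)) e))
  nat-^ m (suc k) h e = *F-≢0 h (nat-^ m k h) (trans (sym (nat-* m (m ^ k))) e)

  -- Translation by 1 permutes K, so the sum of all elements shows p^n · 1 = 0.
  nat-p : nat p ≡ 0F
  nat-p with nat p ≟F 0F
  ... | yes e = e
  ... | no  h = ⊥-elim (nat-^ p n h (subst (λ m → nat m ≡ 0F) card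
      (𝕂P.+-cancelʳ (sumF elems) _ _
        (trans (sym (sumF-map-+ 1F elems)) (trans (sumF-↭ permuted) (sym (𝕂.+-identityˡ (sumF elems))))))))
    where
    permuted : map (1F +F_) elems ↭ elems
    permuted = unique-↭ (UniqueP.map⁺ (𝕂P.+-cancelˡ 1F _ _) unique) unique (λ _ → complete _)
      (λ {y} _ → subst (_∈ map (1F +F_) elems) (back y) (∈P.∈-map⁺ (1F +F_) (complete (-F 1F +F y))))
      where
      back : ∀ y → 1F +F (-F 1F +F y) ≡ y
      back y = trans (sym (𝕂.+-assoc 1F (-F 1F) y)) (trans (cong (_+F y) (𝕂.-‿inverseʳ 1F)) (𝕂.+-identityˡ y))

  p∣⇒×≡0 : ∀ m x → p ∣ m → m ×.× x ≡ 0F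
  p∣⇒×≡0 m x (divides q refl) = begin
    (q * p) ×.× x          ≡⟨ cong ((q * p) ×.×_) (𝕂.*-identityˡ x) ⟨
    (q * p) ×.× (1F *F x)  ≡⟨ ×.×-assoc-* (q * p) 1F x ⟨
    nat (q * p) *F x       ≡⟨ cong (_*F x) (trans (nat-* q p) (trans (cong (nat q *F_) nat-p) (𝕂.zeroʳ (nat q)))) ⟩
    0F *F x                ≡⟨ 𝕂.zeroˡ x ⟩
    0F                     ∎
    where open ≡-Reasoning

  -- In the binomial expansion the inner coefficients are multiples of `p`, hence act as 0; only the
  -- end terms remain.
  powF-p-+ : ∀ x y → powF (x +F y) p ≡ powF x p +F powF y p
  powF-p-+ x y = begin
    powF (x +F y) p                  ≡⟨ powF≡^ (x +F y) p ⟩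
    (x +F y) ^.^ p                   ≡⟨ Binomial.theorem 𝕂.commutativeSemiring p x y ⟩
    Binomial.binomialExpansion 𝕂.commutativeSemiring x y p  ≡⟨ ends p refl ⟩
    y ^.^ p +F x ^.^ p               ≡⟨ 𝕂.+-comm _ _ ⟩
    x ^.^ p +F y ^.^ p               ≡⟨ cong₂ _+F_ (powF≡^ x p) (powF≡^ y p) ⟨
    powF x p +F powF y p             ∎
    where
    open ≡-Reasoning
    module S = MonoidSum 𝕂.+-monoid
    term = Binomial.binomialTerm 𝕂.commutativeSemiring x y
    -- The exponent is generalized to `m` so that it can be split as a successor, which exposes the
    -- first and last terms of the sum.
    ends : ∀ m → m ≡ p → Binomial.binomialExpansion 𝕂.commutativeSemiring x y m ≡ y ^.^ m +F x ^.^ m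
    ends zero refl with () ← ℕ.>-nonZero⁻¹ p
    ends (suc m) refl = begin
      term (suc m) Fin.zero +F S.sum (λ i → term (suc m) (Fin.suc i))
        ≡⟨ cong₂ _+F_ first (S.sum-init-last (λ i → term (suc m) (Fin.suc i))) ⟩
      y ^.^ suc m +F (S.sum (λ i → term (suc m) (Fin.suc (Fin.inject₁ i))) +F term (suc m) (Fin.suc (Fin.fromℕ m)))
        ≡⟨ cong (y ^.^ suc m +F_) (cong₂ _+F_ (trans (S.sum-cong-≗ {n = m} middle) (S.sum-replicate-zero m)) last) ⟩
      y ^.^ suc m +F (0F +F x ^.^ suc m)
        ≡⟨ cong (y ^.^ suc m +F_) (𝕂.+-identityˡ _) ⟩
      y ^.^ suc m +F x ^.^ suc m ∎
      where
      first : term (suc m) Fin.zero ≡ y ^.^ suc m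
      first = trans (𝕂.+-identityʳ _) (𝕂.*-identityˡ _)
      middle : ∀ i → term (suc m) (Fin.suc (Fin.inject₁ i)) ≡ 0F
      middle i = p∣⇒×≡0 _ _ (prime∣binomial pp (suc (toℕ (Fin.inject₁ i))) (s≤s z≤n)
        (s≤s (subst (_< m) (sym (FinP.toℕ-inject₁ i)) (FinP.toℕ<n i))))
      last : term (suc m) (Fin.suc (Fin.fromℕ m)) ≡ x ^.^ suc m
      last = trans (cong (λ k → (suc m C suc k) ×.× (x ^.^ suc k *F y ^.^ (m ∸ k))) (FinP.toℕ-fromℕ m))
        (trans (cong₂ (λ c k → c ×.× (x ^.^ suc m *F y ^.^ k)) (nCn≡1 (suc m)) (ℕP.n∸n≡0 m))
          (trans (𝕂.+-identityʳ _) (𝕂.*-identityʳ _)))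

  frob : ℕ → F → F
  frob i x = powF x (p ^ i)

  frob-suc : ∀ i x → frob (suc i) x ≡ powF (frob i x) p
  frob-suc i x = trans (cong (powF x) (ℕP.*-comm p (p ^ i))) (powF-* x (p ^ i) p)

  frob-+ : ∀ i j x → frob (i + j) x ≡ frob j (frob i x)
  frob-+ i j x = trans (cong (powF x) (ℕP.^-distribˡ-+-* p i j)) (powF-* x (p ^ i) (p ^ j))

  frob-zero : ∀ x → frob 0 x ≡ x
  frob-zero x = 𝕂.*-identityʳ x

  frob-+F : ∀ i x y → frob i (x +F y) ≡ frob i x +F frob i y
  frob-+F zero    x y = trans (frob-zero _) (cong₂ _+F_ (sym (frob-zero x)) (sym (frob-zero y)))
  frob-+F (suc i) x y = begin
    frob (suc i) (x +F y)                    ≡⟨ frob-suc i (x +F y) ⟩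
    powF (frob i (x +F y)) p                 ≡⟨ cong (λ z → powF z p) (frob-+F i x y) ⟩
    powF (frob i x +F frob i y) p            ≡⟨ powF-p-+ _ _ ⟩
    powF (frob i x) p +F powF (frob i y) p   ≡⟨ cong₂ _+F_ (frob-suc i x) (frob-suc i y) ⟨
    frob (suc i) x +F frob (suc i) y         ∎
    where open ≡-Reasoning

  frob-*F : ∀ i x y → frob i (x *F y) ≡ frob i x *F frob i y
  frob-*F i x y = powF-distrib x y (p ^ i)

  frob-0F : ∀ i → frob i 0F ≡ 0F
  frob-0F i = powF-zero (p ^ i) {{ℕP.m^n≢0 p i}}

  frob-n : ∀ x → frob n x ≡ x
  frob-n = powF-card

  frob-nat : ∀ i m → frob i (nat m) ≡ nat m
  frob-nat i zero    = frob-0F i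
  frob-nat i (suc m) = trans (frob-+F i 1F (nat m)) (cong₂ _+F_ (powF-one (p ^ i)) (frob-nat i m))

  -- HasDegree N f c: f is a polynomial function of degree at most N whose coefficient of x^N is c,
  -- expressed through iterated divided differences.
  HasDegree : ℕ → (F → F) → F → Set
  HasDegree zero    f c = ∀ x → f x ≡ c
  HasDegree (suc N) f c = ∀ a → Σ (F → F) λ g → HasDegree N g c × (∀ x → f x ≡ f a +F (x 𝕂.- a) *F g x)

  HasDegree-cong : ∀ N {f g c} → (∀ x → f x ≡ g x) → HasDegree N f c → HasDegree N g c
  HasDegree-cong zero    e h x = trans (sym (e x)) (h x)
  HasDegree-cong (suc N) e h a with g , hg , q ← h a =
    g , hg , λ x → trans (sym (e x)) (trans (q x) (cong (_+F _) (e a)))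

  HasDegree-+ : ∀ N {f g c d} → HasDegree N f c → HasDegree N g d → HasDegree N (λ x → f x +F g x) (c +F d)
  HasDegree-+ zero    h h' x = cong₂ _+F_ (h x) (h' x)
  HasDegree-+ (suc N) {f} {g} h h' a with f' , hf , q ← h a | g' , hg , q' ← h' a =
    (λ x → f' x +F g' x) , HasDegree-+ N hf hg , λ x → trans (cong₂ _+F_ (q x) (q' x))
      (solve 5 (λ fa ga d f' g' → (fa :+ d :* f') :+ (ga :+ d :* g') := (fa :+ ga) :+ d :* (f' :+ g')) refl (f a)
        (g a) (x 𝕂.- a) (f' x) (g' x))

  HasDegree-scale : ∀ k N {f c} → HasDegree N f c → HasDegree N (λ x → k *F f x) (k *F c)
  HasDegree-scale k zero    h x = cong (k *F_) (h x)
  HasDegree-scale k (suc N) {f} h a with f' , hf , q ← h a =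
    (λ x → k *F f' x) , HasDegree-scale k N hf , λ x → trans (cong (k *F_) (q x))
      (solve 4 (λ k fa d f' → k :* (fa :+ d :* f') := k :* fa :+ d :* (k :* f')) refl k (f a) (x 𝕂.- a) (f' x))

  HasDegree-zero : ∀ N → HasDegree N (λ _ → 0F) 0F
  HasDegree-zero zero    x = refl
  HasDegree-zero (suc N) a = (λ _ → 0F) , HasDegree-zero N , λ x → sym (trans (𝕂.+-identityˡ _) (𝕂.zeroʳ _))

  HasDegree-raise : ∀ N {f c} → HasDegree N f c → HasDegree (suc N) f 0F
  HasDegree-raise zero    {f} {c} h a = (λ _ → 0F) , (λ _ → refl) , λ x →
    trans (h x) (trans (sym (h a)) (sym (trans (cong (f a +F_) (𝕂.zeroʳ _)) (𝕂.+-identityʳ _))))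
  HasDegree-raise (suc N) h a with g , hg , q ← h a = g , HasDegree-raise N hg , q

  HasDegree-mono : ∀ {M N f c} → M < N → HasDegree M f c → HasDegree N f 0F
  HasDegree-mono {M} {suc N} (s≤s le) h with ℕP.m≤n⇒m<n∨m≡n le
  ... | inj₂ refl = HasDegree-raise M h
  ... | inj₁ lt   = HasDegree-raise N (HasDegree-mono lt h)

  a+[x-a] : ∀ a x → x ≡ a +F (x 𝕂.- a)
  a+[x-a] a x = sym (trans (𝕂.+-comm a _)
      (trans (𝕂.+-assoc x (-F a) a) (trans (cong (x +F_) (𝕂.-‿inverseˡ a)) (𝕂.+-identityʳ x))))

  -- Product rule for divided differences: `x f(x) - a f(a) = (x - a)(f(x) + a g(x))`, where `g` is
  -- the divided difference of `f` at `a`. The term `a g` has lower degree, so the leading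
  -- coefficient stays `c`.
  HasDegree-x* : ∀ N {f c} → HasDegree N f c → HasDegree (suc N) (λ x → x *F f x) c
  HasDegree-x* zero {f} {c} h a = f , h , λ x → begin
    x *F f x                          ≡⟨ cong (x *F_) (h x) ⟩
    x *F c                            ≡⟨ cong (_*F c) (a+[x-a] a x) ⟩
    (a +F (x 𝕂.- a)) *F c             ≡⟨ 𝕂.distribʳ c a (x 𝕂.- a) ⟩
    a *F c +F (x 𝕂.- a) *F c          ≡⟨ cong₂ (λ u v → a *F u +F (x 𝕂.- a) *F v) (h a) (h x) ⟨
    a *F f a +F (x 𝕂.- a) *F f x      ∎
    where open ≡-Reasoning
  HasDegree-x* (suc N) {f} {c} h a with g , hg , q ← h a =
    (λ x → f x +F a *F g x) ,
    subst (HasDegree (suc N) _) (𝕂.+-identityʳ c) (HasDegree-+ (suc N) h (HasDegree-raise N (HasDegree-scale a N hg))) ,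
    λ x → begin
      x *F f x
        ≡⟨ cong₂ _*F_ (a+[x-a] a x) (q x) ⟩
      (a +F (x 𝕂.- a)) *F (f a +F (x 𝕂.- a) *F g x)
        ≡⟨ solve 4 (λ a d fa g → (a :+ d) :* (fa :+ d :* g) := a :* fa :+ d :* ((fa :+ d :* g) :+ a :* g)) refl a
          (x 𝕂.- a) (f a) (g x) ⟩
      a *F f a +F (x 𝕂.- a) *F ((f a +F (x 𝕂.- a) *F g x) +F a *F g x)
        ≡⟨ cong (λ z → a *F f a +F (x 𝕂.- a) *F (z +F a *F g x)) (q x) ⟨
      a *F f a +F (x 𝕂.- a) *F (f x +F a *F g x) ∎
    where open ≡-Reasoning

  HasDegree-powF : ∀ N → HasDegree N (λ x → powF x N) 1F
  HasDegree-powF zero    x = refl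
  HasDegree-powF (suc N) = HasDegree-x* N (HasDegree-powF N)

  -- At a root `a` the function is `(x - a) g(x)`, so every other root is a root of the divided
  -- difference `g`, of degree one less and with the same leading coefficient.
  roots-bound : ∀ N {f c xs} → HasDegree N f c → c ≢ 0F → Unique xs → All (λ x → f x ≡ 0F) xs → length xs ≤ N
  roots-bound N h c≢0 [] [] = z≤n
  roots-bound zero h c≢0 (_ ∷ _) (r ∷ _) = ⊥-elim (c≢0 (trans (sym (h _)) r))
  roots-bound (suc N) {f} {xs = a ∷ xs} h c≢0 (a∉ ∷ u) (r ∷ rs) with g , hg , q ← h a =
    s≤s (roots-bound N hg c≢0 u (All.tabulate root))
    where
    root : ∀ {x} → x ∈ xs → g x ≡ 0F
    root {x} m = *F-zero-product {x 𝕂.- a} (trans (sym (trans (q x) (trans (cong (_+F _) r) (𝕂.+-identityˡ _))))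
        (All.lookup rs m))
      (λ e → All.lookup a∉ m (sym (𝕂P.x∙y⁻¹≈ε⇒x≈y x a e)))

  roots-count : ∀ N {f c} → HasDegree N f c → c ≢ 0F → ∑ elems (λ x → iv (f x ≟F 0F)) ≤ N
  roots-count N {f} h c≢0 = subst (_≤ N) (length-filter-iv (λ x → f x ≟F 0F) elems)
    (roots-bound N h c≢0 (UniqueP.filter⁺ (λ x → f x ≟F 0F) unique) (AllP.all-filter (λ x → f x ≟F 0F) elems))

  mutual
    ι-nat : ∀ k → ι k ≡ nat (toℕ k)
    ι-nat k with toℕ k
    ... | m = ι-nat-go k m

    -- The recursion inside `ι` is local and has no name here; its use in `ι-nat` determines the
    -- omitted type.
    ι-nat-go : ∀ (k : Fin p) (m : ℕ) → _
    ι-nat-go k zero    = refl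
    ι-nat-go k (suc m) = cong (1F +F_) (ι-nat-go k m)

  nat-% : ∀ m → nat (m % p) ≡ nat m
  nat-% m = sym (begin
    nat m                          ≡⟨ cong nat (m≡m%n+[m/n]*n m p) ⟩
    nat (m % p + m / p * p)        ≡⟨ nat-+ (m % p) (m / p * p) ⟩
    nat (m % p) +F nat (m / p * p) ≡⟨ cong (nat (m % p) +F_) (p∣⇒×≡0 (m / p * p) 1F (divides (m / p) refl)) ⟩
    nat (m % p) +F 0F              ≡⟨ 𝕂.+-identityʳ _ ⟩
    nat (m % p)                    ∎)
    where open ≡-Reasoning

  ι-fromN : ∀ m → ι (fromN m) ≡ nat m
  ι-fromN m = trans (ι-nat (fromN m)) (trans (cong nat (toℕ-fromN m)) (nat-% m))

  ι-⊕ : ∀ x y → ι (x ⊕ y) ≡ ι x +F ι y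
  ι-⊕ x y = trans (ι-fromN (toℕ x + toℕ y)) (trans (nat-+ (toℕ x) (toℕ y)) (cong₂ _+F_ (sym (ι-nat x)) (sym (ι-nat y))))

  ι-⊗ : ∀ x y → ι (x ⊗ y) ≡ ι x *F ι y
  ι-⊗ x y = trans (ι-fromN (toℕ x * toℕ y)) (trans (nat-* (toℕ x) (toℕ y)) (cong₂ _*F_ (sym (ι-nat x)) (sym (ι-nat y))))

  ι-0 : ι 0p ≡ 0F
  ι-0 = ι-fromN 0

  ι-1 : ι 1p ≡ 1F
  ι-1 = trans (ι-fromN 1) (𝕂.+-identityʳ 1F)

  ι-⊖ : ∀ x → ι (⊖ x) ≡ -F ι x
  ι-⊖ x = 𝕂P.+-inverseˡ-unique (ι (⊖ x)) (ι x) (trans (sym (ι-⊕ (⊖ x) x)) (trans (cong ι (𝔽.-‿inverseˡ x)) ι-0))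

  ι≡0 : ∀ x → ι x ≡ 0F → x ≡ 0p
  ι≡0 x e with x Fin.≟ 0p
  ... | yes x≡0 = x≡0
  ... | no  x≢0 with y , xy ← ⊗-inverse pp x x≢0 = ⊥-elim (0≢1 (sym (begin
      1F             ≡⟨ ι-1 ⟨
      ι 1p           ≡⟨ cong ι xy ⟨
      ι (x ⊗ y)      ≡⟨ ι-⊗ x y ⟩
      ι x *F ι y     ≡⟨ cong (_*F ι y) e ⟩
      0F *F ι y      ≡⟨ 𝕂.zeroˡ _ ⟩
      0F             ∎)))
    where open ≡-Reasoning

  ι-injective : ∀ {x y} → ι x ≡ ι y → x ≡ y
  ι-injective {x} {y} e = 𝔽P.x∙y⁻¹≈ε⇒x≈y x y (ι≡0 (x ⊕ (⊖ y))
    (trans (ι-⊕ x (⊖ y)) (trans (cong₂ _+F_ e (ι-⊖ y)) (𝕂.-‿inverseʳ (ι y)))))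

  frob-ι : ∀ i k → frob i (ι k) ≡ ι k
  frob-ι i k = trans (cong (frob i) (ι-nat k)) (trans (frob-nat i (toℕ k)) (sym (ι-nat k)))

  1<p : 1 < p
  1<p = ℕ.nonTrivial⇒n>1 p {{prime⇒nonTrivial pp}}

  -- x^p - x has at most p roots, and the p elements ι k are roots.
  prime-subfield : ∀ y → powF y p ≡ y → Σ (Fin p) λ k → ι k ≡ y
  prime-subfield y fixed with FinP.any? (λ k → ι k ≟F y)
  ... | yes found = found
  ... | no ¬found = ⊥-elim (ℕP.<⇒≱
      (ℕP.≤-reflexive (cong suc (sym (trans (ListP.length-map ι (allFin p)) (ListP.length-tabulate id)))))
      (roots-bound p {f} {1F} {y ∷ map ι (allFin p)} degree (λ e → 0≢1 (sym e))
        (All.tabulate distinct ∷ UniqueP.map⁺ ι-injective (UniqueP.allFin⁺ p))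
        (trans (cong (_+F (-F 1F *F y)) fixed) (cancel y) ∷ All.tabulate root)))
    where
    f : F → F
    f x = powF x p +F (-F 1F) *F x
    cancel : ∀ x → x +F (-F 1F) *F x ≡ 0F
    cancel x = trans (cong (x +F_) (𝕂P.-1*x≈-x x)) (𝕂.-‿inverseʳ x)
    degree : HasDegree p f 1F
    degree = subst (HasDegree p f) (𝕂.+-identityʳ 1F) (HasDegree-+ p (HasDegree-powF p)
      (HasDegree-mono 1<p (HasDegree-scale (-F 1F) 1 (HasDegree-cong 1 𝕂.*-identityʳ (HasDegree-powF 1)))))
    distinct : ∀ {z} → z ∈ map ι (allFin p) → y ≢ z
    distinct m refl with k , _ , e ← ∈P.∈-map⁻ ι m = ¬found (k , sym e)
    root : ∀ {z} → z ∈ map ι (allFin p) → f z ≡ 0F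
    root m with k , _ , refl ← ∈P.∈-map⁻ ι m =
      trans (cong (_+F ((-F 1F) *F ι k)) (trans (cong (powF (ι k)) (sym (ℕP.*-identityʳ p))) (frob-ι 1 k))) (cancel (ι k))

  mutual
    ι-toFp : ∀ y → Σ (Fin p) (λ k → ι k ≡ y) → ι (toFp y) ≡ y
    ι-toFp y (k , e) with allFin p | ∈P.∈-allFin k
    ... | ks | m = ι-toFp-go y k e ks m

    ι-toFp-go : ∀ y k → ι k ≡ y → ∀ ks → k ∈ ks → _
    ι-toFp-go y k e (k' ∷ ks) m with ι k' ≟F y
    ... | yes e' = e'
    ι-toFp-go y k e (k' ∷ ks) (here refl) | no ¬e = ⊥-elim (¬e e)
    ι-toFp-go y k e (k' ∷ ks) (there m)   | no _  = ι-toFp-go y k e ks m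

-- The trace, and polynomials as operators in the Frobenius map.

module Trace {p n : ℕ} .{{_ : NonZero p}} (pp : Prime p) (K : FiniteField p n) (1≤n : 1 ≤ n) where
  open FiniteField K
  open Fp p
  open Residues p
  open Polynomials p
  open OverField K
  open FieldTheory pp K

  sumF-++ : ∀ xs ys → sumF (xs ++ ys) ≡ sumF xs +F sumF ys
  sumF-++ []       ys = sym (𝕂.+-identityˡ _)
  sumF-++ (x ∷ xs) ys = trans (cong (x +F_) (sumF-++ xs ys)) (sym (𝕂.+-assoc x _ _))

  module _ {I : Set} where
    sumF-cong : ∀ (is : List I) {f g : I → F} → (∀ i → f i ≡ g i) → sumF (map f is) ≡ sumF (map g is)
    sumF-cong []       e = refl
    sumF-cong (i ∷ is) e = cong₂ _+F_ (e i) (sumF-cong is e)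

    sumF-+ : ∀ (is : List I) (f g : I → F) → sumF (map (λ i → f i +F g i) is) ≡ sumF (map f is) +F sumF (map g is)
    sumF-+ []       f g = sym (𝕂.+-identityˡ 0F)
    sumF-+ (i ∷ is) f g = trans (cong (f i +F g i +F_) (sumF-+ is f g)) (+P.interchange (f i) (g i) _ _)

    sumF-homo : ∀ (h : F → F) → h 0F ≡ 0F → (∀ x y → h (x +F y) ≡ h x +F h y) →
                ∀ (is : List I) f → h (sumF (map f is)) ≡ sumF (map (h ∘ f) is)
    sumF-homo h h0 h+ []       f = h0
    sumF-homo h h0 h+ (i ∷ is) f = trans (h+ (f i) _) (cong (h (f i) +F_) (sumF-homo h h0 h+ is f))

  sumF-upTo-suc : ∀ m (f : ℕ → F) → sumF (map f (upTo (suc m))) ≡ sumF (map f (upTo m)) +F f m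
  sumF-upTo-suc m f = trans (cong (sumF ∘ map f) (sym (ListP.upTo-∷ʳ m)))
    (trans (cong sumF (ListP.map-++ f (upTo m) (m ∷ [])))
      (trans (sumF-++ (map f (upTo m)) _) (cong (sumF (map f (upTo m)) +F_) (𝕂.+-identityʳ (f m)))))

  partialTrace : ℕ → F → F
  partialTrace m x = sumF (map (λ i → frob i x) (upTo m))

  TrF-+ : ∀ x y → TrF (x +F y) ≡ TrF x +F TrF y
  TrF-+ x y = trans (sumF-cong (upTo n) (λ i → frob-+F i x y)) (sumF-+ (upTo n) (λ i → frob i x) (λ i → frob i y))

  TrF-scale : ∀ c x → TrF (ι c *F x) ≡ ι c *F TrF x
  TrF-scale c x = trans (sumF-cong (upTo n) (λ i → trans (frob-*F i (ι c) x) (cong (_*F frob i x) (frob-ι i c))))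
    (sym (sumF-homo (ι c *F_) (𝕂.zeroʳ (ι c)) (𝕂.distribˡ (ι c)) (upTo n) (λ i → frob i x)))

  TrF-0F : TrF 0F ≡ 0F
  TrF-0F = 𝕂P.x+x≈x⇒x≈0 (TrF 0F) (trans (sym (TrF-+ 0F 0F)) (cong TrF (𝕂.+-identityˡ 0F)))

  frob-1 : ∀ x → frob 1 x ≡ powF x p
  frob-1 x = cong (powF x) (ℕP.*-identityʳ p)

  -- Both sides are the sum of `x^(p^i)` over `i ≤ m`. At `m = n`, where `x^(p^n) = x`, this is the
  -- invariance of the trace under Frobenius.
  partialTrace-frob : ∀ m x → partialTrace m (frob 1 x) +F x ≡ partialTrace m x +F frob m x
  partialTrace-frob zero    x = cong (0F +F_) (sym (frob-zero x))
  partialTrace-frob (suc m) x = begin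
    partialTrace (suc m) (frob 1 x) +F x               ≡⟨ cong (_+F x) (sumF-upTo-suc m _) ⟩
    partialTrace m (frob 1 x) +F frob m (frob 1 x) +F x ≡⟨ +P.xy∙z≈xz∙y _ _ x ⟩
    partialTrace m (frob 1 x) +F x +F frob m (frob 1 x) ≡⟨ cong₂ _+F_ (partialTrace-frob m x) (sym (frob-+ 1 m x)) ⟩
    partialTrace m x +F frob m x +F frob (suc m) x     ≡⟨ cong (_+F frob (suc m) x) (sumF-upTo-suc m _) ⟨
    partialTrace (suc m) x +F frob (suc m) x           ∎
    where open ≡-Reasoning

  TrF-frob1 : ∀ x → TrF (frob 1 x) ≡ TrF x
  TrF-frob1 x = 𝕂P.+-cancelʳ x _ _ (trans (partialTrace-frob n x) (cong (TrF x +F_) (frob-n x)))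

  TrF-frob : ∀ i x → TrF (frob i x) ≡ TrF x
  TrF-frob zero    x = cong TrF (frob-zero x)
  TrF-frob (suc i) x = trans (cong TrF (frob-+ 1 i x)) (trans (TrF-frob i (frob 1 x)) (TrF-frob1 x))

  TrF-fixed : ∀ x → powF (TrF x) p ≡ TrF x
  TrF-fixed x = begin
    powF (TrF x) p                               ≡⟨ frob-1 (TrF x) ⟨
    frob 1 (TrF x)                               ≡⟨ sumF-homo (frob 1) (frob-0F 1) (frob-+F 1) (upTo n) (λ i → frob i x) ⟩
    sumF (map (λ i → frob 1 (frob i x)) (upTo n))
      ≡⟨ sumF-cong (upTo n) (λ i → trans (sym (frob-+ i 1 x))
        (trans (cong (λ k → frob k x) (ℕP.+-comm i 1)) (frob-+ 1 i x))) ⟩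
    TrF (frob 1 x)                               ≡⟨ TrF-frob1 x ⟩
    TrF x                                        ∎
    where open ≡-Reasoning

  -- The trace is fixed by Frobenius, so it lies in the prime subfield and the default value of
  -- `toFp` is not taken.
  ι-Tr : ∀ x → ι (Tr x) ≡ TrF x
  ι-Tr x = ι-toFp (TrF x) (prime-subfield (TrF x) (TrF-fixed x))

  Tr-+ : ∀ x y → Tr (x +F y) ≡ Tr x ⊕ Tr y
  Tr-+ x y = ι-injective (trans (ι-Tr (x +F y))
      (trans (TrF-+ x y) (trans (cong₂ _+F_ (sym (ι-Tr x)) (sym (ι-Tr y))) (sym (ι-⊕ (Tr x) (Tr y))))))

  Tr-0F : Tr 0F ≡ 0p
  Tr-0F = ι≡0 (Tr 0F) (trans (ι-Tr 0F) TrF-0F)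

  partialTrace-degree : ∀ m → HasDegree (p ^ m) (partialTrace (suc m)) 1F
  partialTrace-degree zero = HasDegree-cong 1
      (λ x → trans (𝕂.*-identityʳ x) (sym (trans (𝕂.+-identityʳ _) (frob-zero x)))) (HasDegree-powF 1)
  partialTrace-degree (suc m) = subst (HasDegree (p ^ suc m) (partialTrace (suc (suc m)))) (𝕂.+-identityˡ 1F)
    (HasDegree-cong (p ^ suc m) (λ x → sym (sumF-upTo-suc (suc m) (λ i → frob i x)))
      (HasDegree-+ (p ^ suc m) (HasDegree-mono (ℕP.^-monoʳ-< p 1<p (ℕP.n<1+n m)) (partialTrace-degree m))
        (HasDegree-powF (p ^ suc m))))

  -- Tr is a polynomial of degree p^(n-1) < |K|.
  Tr-nonzero : Σ F λ x → Tr x ≢ 0p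
  Tr-nonzero with Any.any? (λ x → ¬? (Tr x Fin.≟ 0p)) elems
  ... | yes found = Any.satisfied found
  ... | no ¬found = ⊥-elim (go n refl 1≤n)
    where
    zero-everywhere : ∀ x → TrF x ≡ 0F
    zero-everywhere x = trans (sym (ι-Tr x)) (trans (cong ι (decidable-stable (Tr x Fin.≟ 0p)
      (λ h → ¬found (Any.map (λ { refl → h }) (complete x))))) ι-0)
    go : ∀ k → k ≡ n → 1 ≤ k → ⊥
    go (suc m) refl _ = ℕP.<⇒≱ (ℕP.^-monoʳ-< p 1<p (ℕP.n<1+n m))
      (subst (_≤ p ^ m) card (roots-bound (p ^ m) (partialTrace-degree m) (λ e → 0≢1 (sym e)) unique
        (All.tabulate (λ {x} _ → zero-everywhere x))))

  Tr-nondegenerate : ∀ {c} → c ≢ 0F → Σ F λ x → Tr (x *F c) ≢ 0p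
  Tr-nondegenerate {c} c≢0 with x , h ← Tr-nonzero | c⁻¹ , cc ← inverse c c≢0 =
    x *F c⁻¹ , λ e → h (trans (cong Tr
      (sym (trans (𝕂.*-assoc x c⁻¹ c) (trans (cong (x *F_) (trans (𝕂.*-comm c⁻¹ c) cc)) (𝕂.*-identityʳ x))))) e)

  -- f acts as the operator f(φ) with φ the Frobenius map.
  act : Poly → F → F
  act []      x = 0F
  act (a ∷ f) x = ι a *F x +F act f (frob 1 x)

  act-+F : ∀ f x y → act f (x +F y) ≡ act f x +F act f y
  act-+F []      x y = sym (𝕂.+-identityˡ 0F)
  act-+F (a ∷ f) x y = trans (cong₂ _+F_ (𝕂.distribˡ (ι a) x y) (trans (cong (act f) (frob-+F 1 x y)) (act-+F f _ _)))
    (+P.interchange (ι a *F x) (ι a *F y) _ _)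

  act-0F : ∀ f → act f 0F ≡ 0F
  act-0F f = 𝕂P.x+x≈x⇒x≈0 (act f 0F) (trans (sym (act-+F f 0F 0F)) (cong (act f) (𝕂.+-identityˡ 0F)))

  act-frob : ∀ f x → act f (frob 1 x) ≡ frob 1 (act f x)
  act-frob []      x = sym (frob-0F 1)
  act-frob (a ∷ f) x = sym (trans (frob-+F 1 (ι a *F x) _) (cong₂ _+F_
    (trans (frob-*F 1 (ι a) x) (cong (_*F frob 1 x) (frob-ι 1 a))) (sym (act-frob f (frob 1 x)))))

  act-[] : ∀ f → f ≃ [] → ∀ x → act f x ≡ 0F
  act-[] []      e x = refl
  act-[] (a ∷ f) e x = trans (cong₂ _+F_ (trans (cong (λ a → ι a *F x) (at e 0)) (trans (cong (_*F x) ι-0) (𝕂.zeroˡ x)))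
    (act-[] f (tail-≃[] e) (frob 1 x))) (𝕂.+-identityˡ 0F)

  act-cong : ∀ f g → f ≃ g → ∀ x → act f x ≡ act g x
  act-cong []      g       e x = sym (act-[] g (≃-sym e) x)
  act-cong (a ∷ f) []      e x = act-[] (a ∷ f) e x
  act-cong (a ∷ f) (b ∷ g) e x = cong₂ _+F_ (cong (λ a → ι a *F x) (at e 0)) (act-cong f g (tail-≃ e) (frob 1 x))

  act-addP : ∀ f g x → act (addP f g) x ≡ act f x +F act g x
  act-addP []      g       x = sym (𝕂.+-identityˡ _)
  act-addP (a ∷ f) []      x = sym (𝕂.+-identityʳ _)
  act-addP (a ∷ f) (b ∷ g) x = trans (cong₂ _+F_ (trans (cong (_*F x) (ι-⊕ a b)) (𝕂.distribʳ x (ι a) (ι b)))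
      (act-addP f g (frob 1 x)))
    (+P.interchange (ι a *F x) (ι b *F x) _ _)

  act-scaleP : ∀ c f x → act (scaleP c f) x ≡ ι c *F act f x
  act-scaleP c []      x = sym (𝕂.zeroʳ (ι c))
  act-scaleP c (a ∷ f) x = trans (cong₂ _+F_ (trans (cong (_*F x) (ι-⊗ c a)) (𝕂.*-assoc (ι c) (ι a) x))
      (act-scaleP c f (frob 1 x)))
    (sym (𝕂.distribˡ (ι c) _ _))

  act-0∷ : ∀ f x → act (0p ∷ f) x ≡ act f (frob 1 x)
  act-0∷ f x = trans (cong (_+F act f (frob 1 x)) (trans (cong (_*F x) ι-0) (𝕂.zeroˡ x))) (𝕂.+-identityˡ _)

  -- The coefficients lie in the prime field and commute with Frobenius, so products of polynomials
  -- become compositions of operators.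
  act-mulP : ∀ f g x → act (mulP f g) x ≡ act f (act g x)
  act-mulP []      g x = refl
  act-mulP (a ∷ f) g x = trans (act-addP (scaleP a g) (0p ∷ mulP f g) x) (cong₂ _+F_ (act-scaleP a g x)
    (trans (act-0∷ (mulP f g) x) (trans (act-mulP f g (frob 1 x)) (cong (act f) (act-frob g x)))))

  act-oneP : ∀ x → act oneP x ≡ x
  act-oneP x = trans (𝕂.+-identityʳ _) (trans (cong (_*F x) ι-1) (𝕂.*-identityˡ x))

  act-∷ʳ : ∀ f a x → act (f ∷ʳ a) x ≡ act f x +F ι a *F frob (length f) x
  act-∷ʳ []      a x = trans (𝕂.+-comm _ 0F) (cong (λ z → 0F +F ι a *F z) (sym (frob-zero x)))
  act-∷ʳ (b ∷ f) a x = trans (cong (ι b *F x +F_)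
      (trans (act-∷ʳ f a (frob 1 x)) (cong (λ z → act f (frob 1 x) +F ι a *F z) (sym (frob-+ 1 (length f) x)))))
    (sym (𝕂.+-assoc _ _ _))

  act-monomialP : ∀ c k x → act (monomialP c k) x ≡ ι c *F frob k x
  act-monomialP c zero    x = trans (𝕂.+-identityʳ _) (cong (ι c *F_) (sym (frob-zero x)))
  act-monomialP c (suc k) x = trans (act-0∷ (monomialP c k) x)
      (trans (act-monomialP c k (frob 1 x)) (cong (ι c *F_) (sym (frob-+ 1 k x))))

  act-xPowMinus1 : ∀ x → act (xPowMinus1 n) x ≡ 0F
  act-xPowMinus1 x = begin
    act (xPowMinus1 n) x                             ≡⟨ act-addP (monomialP 1p n) ((⊖ 1p) ∷ []) x ⟩
    act (monomialP 1p n) x +F (ι (⊖ 1p) *F x +F 0F)  ≡⟨ cong₂ _+F_ (act-monomialP 1p n x) (𝕂.+-identityʳ _) ⟩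
    ι 1p *F frob n x +F ι (⊖ 1p) *F x
      ≡⟨ cong₂ _+F_ (cong₂ _*F_ ι-1 (frob-n x)) (cong (_*F x) (trans (ι-⊖ 1p) (cong -F_ ι-1))) ⟩
    1F *F x +F (-F 1F) *F x                          ≡⟨ cong₂ _+F_ (𝕂.*-identityˡ x) (𝕂P.-1*x≈-x x) ⟩
    x 𝕂.- x                                          ≡⟨ 𝕂.-‿inverseʳ x ⟩
    0F                                               ∎
    where open ≡-Reasoning

-- Sizes of kernels of operators in the Frobenius map.

module Kernel {p n : ℕ} .{{_ : NonZero p}} (pp : Prime p) (K : FiniteField p n) (1≤n : 1 ≤ n) where
  open FiniteField K
  open Fp p
  open Residues p
  open Polynomials p
  open Division p pp
  open OverField K
  open FieldTheory pp K
  open Trace pp K 1≤n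

  -- `f(φ) x` is the linearized polynomial with terms `a_i x^(p^i)`, hence of degree `p^d`. The
  -- offset `j` serves the induction, in which the tail of `f` acts on `φ x`.
  act-degree : ∀ f j {d c} → HasLead f d c → HasDegree (p ^ (j + d)) (λ x → act f (frob j x)) (ι c)
  act-degree [] j {d} {c} (h , _) = subst (HasDegree (p ^ (j + d)) _) (trans (sym ι-0) (cong ι h))
      (HasDegree-zero (p ^ (j + d)))
  act-degree (a ∷ f) j {zero} {c} (h , h') = subst (λ k → HasDegree (p ^ k) (λ x → act (a ∷ f) (frob j x)) (ι c))
      (sym (ℕP.+-identityʳ j))
    (subst (HasDegree (p ^ j) _) (trans (𝕂.*-identityʳ (ι a)) (cong ι h))
      (HasDegree-cong (p ^ j) (λ x → sym (trans (cong (ι a *F frob j x +F_) (act-[] f (Deg<0 f (Deg<-tail a f h')) _))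
        (𝕂.+-identityʳ _)))
        (HasDegree-scale (ι a) (p ^ j) (HasDegree-powF (p ^ j)))))
  act-degree (a ∷ f) j {suc d} {c} (h , h') = subst (HasDegree (p ^ (j + suc d)) _) (𝕂.+-identityˡ (ι c))
    (HasDegree-+ (p ^ (j + suc d))
      (HasDegree-mono (ℕP.^-monoʳ-< p 1<p (ℕP.m<m+n j (s≤s z≤n)))
        (HasDegree-scale (ι a) (p ^ j) (HasDegree-powF (p ^ j))))
      (subst (λ k → HasDegree (p ^ k) (λ x → act f (frob 1 (frob j x))) (ι c)) (sym (ℕP.+-suc j d))
        (HasDegree-cong (p ^ (suc j + d))
          (λ x → cong (act f) (trans (cong (λ k → frob k x) (ℕP.+-comm 1 j)) (frob-+ j 1 x)))
          (act-degree f (suc j) (h , Deg<-tail a f h')))))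

  ι≢0 : ∀ {c} → c ≢ 0p → ι c ≢ 0F
  ι≢0 h e = h (ι≡0 _ e)

  fibre-bound : ∀ {f d c} → c ≢ 0p → HasLead f d c → ∀ y → ∑ elems (λ x → iv (act f x ≟F y)) ≤ p ^ d
  fibre-bound {f} {d} {c} c≢0 h y = subst (_≤ p ^ d)
    (∑-cong elems (λ x → iv-cong {d = (act f x 𝕂.- y) ≟F 0F} {act f x ≟F y} (𝕂P.x∙y⁻¹≈ε⇒x≈y (act f x) y) 𝕂P.x≈y⇒x∙y⁻¹≈ε))
    (roots-count (p ^ d) degree (ι≢0 c≢0))
    where
    degree : HasDegree (p ^ d) (λ x → act f x 𝕂.- y) (ι c)
    degree = subst (HasDegree (p ^ d) _) (𝕂.+-identityʳ (ι c)) (HasDegree-+ (p ^ d)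
      (HasDegree-cong (p ^ d) (λ x → cong (act f) (frob-zero x)) (act-degree f 0 h))
      (HasDegree-mono {0} {p ^ d} {λ _ → -F y} { -F y} (ℕP.m^n>0 p d) (λ _ → refl)))

  kernelSize : Poly → ℕ
  kernelSize f = ∑ elems (λ x → iv (act f x ≟F 0F))

  -- E(φ) maps K into ker D(φ) with fibres of size at most p^e, which bounds ker D(φ) from below.
  kernel-divisor : ∀ {D E d e} → HasLead D d 1p → HasLead E e 1p → d + e ≡ n → xPowMinus1 n ≃ mulP D E →
                   kernelSize D ≡ p ^ d
  kernel-divisor {D} {E} {d} {e} hD hE d+e eq = ℕP.≤-antisym (fibre-bound {D} (1p≢0p pp) hD 0F)
    (ℕP.*-cancelʳ-≤ (p ^ d) (kernelSize D) (p ^ e) {{ℕP.m^n≢0 p e}} (begin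
      p ^ d * p ^ e            ≡⟨ ℕP.^-distribˡ-+-* p d e ⟨
      p ^ (d + e)              ≡⟨ cong (p ^_) d+e ⟩
      p ^ n                    ≡⟨ card ⟨
      length elems             ≡⟨ trans (∑-const elems 1) (ℕP.*-identityʳ _) ⟨
      ∑ elems (λ _ → 1)
        ≡⟨ ∑-cong elems (λ x → sym (trans (∑-δ _≟F_ unique (complete (act E x)) (λ y → iv (act D y ≟F 0F)))
          (iv-yes (act D (act E x) ≟F 0F) (killed x)))) ⟩
      ∑ elems (λ x → ∑ elems (λ y → iv (act E x ≟F y) * iv (act D y ≟F 0F)))
                               ≡⟨ ∑-swap elems elems _ ⟩
      ∑ elems (λ y → ∑ elems (λ x → iv (act E x ≟F y) * iv (act D y ≟F 0F)))
                               ≡⟨ ∑-cong elems (λ y → ∑-*ʳ (iv (act D y ≟F 0F)) elems (λ x → iv (act E x ≟F y))) ⟩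
      ∑ elems (λ y → ∑ elems (λ x → iv (act E x ≟F y)) * iv (act D y ≟F 0F))
                               ≤⟨ ∑-mono elems (λ y → ℕP.*-monoˡ-≤ (iv (act D y ≟F 0F))
                                 (fibre-bound {E} (1p≢0p pp) hE y)) ⟩
      ∑ elems (λ y → p ^ e * iv (act D y ≟F 0F))
                               ≡⟨ ∑-*ˡ (p ^ e) elems _ ⟩
      p ^ e * kernelSize D     ≡⟨ ℕP.*-comm (p ^ e) _ ⟩
      kernelSize D * p ^ e     ∎))
    where
    open ℕP.≤-Reasoning
    killed : ∀ x → act D (act E x) ≡ 0F
    killed x = trans (sym (act-mulP D E x)) (trans (sym (act-cong (xPowMinus1 n) (mulP D E) eq x)) (act-xPowMinus1 x))

  -- `P` and `D` have the same kernel. If `P(φ) x = 0`, apply `u k + v E = 1` to `D(φ) x`: `k D = P`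
  -- kills `x` by assumption, and `E D = x^n - 1` kills it because `φ^n` is the identity.
  kernelSize-gcd : ∀ {P d} → ExactGCD n P d → kernelSize P ≡ p ^ d
  kernelSize-gcd {P} {d} gcd = trans
    (∑-cong elems (λ x → iv-cong {d = act P x ≟F 0F} {act D x ≟F 0F} (to x) (from x)))
    (kernel-divisor {D} {E} D-lead E-lead degrees f≃)
    where
    open ≡-Reasoning
    open ExactGCD gcd
    u = proj₁ k-coprime
    v = proj₁ (proj₂ k-coprime)
    commute : ∀ f g x → act f (act g x) ≡ act g (act f x)
    commute f g x = trans (sym (act-mulP f g x)) (trans (act-cong (mulP f g) (mulP g f) (mulP-comm f g) x)
        (act-mulP g f x))
    from : ∀ x → act D x ≡ 0F → act P x ≡ 0F
    from x h = trans (act-cong P (mulP D k) P≃ x)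
        (trans (act-mulP D k x) (trans (commute D k x) (trans (cong (act k) h) (act-0F k))))
    to : ∀ x → act P x ≡ 0F → act D x ≡ 0F
    to x h = begin
      act D x                                              ≡⟨ act-oneP (act D x) ⟨
      act oneP (act D x)
        ≡⟨ act-cong (addP (mulP u k) (mulP v E)) oneP (proj₂ (proj₂ k-coprime)) (act D x) ⟨
      act (addP (mulP u k) (mulP v E)) (act D x)           ≡⟨ act-addP (mulP u k) (mulP v E) (act D x) ⟩
      act (mulP u k) (act D x) +F act (mulP v E) (act D x)
        ≡⟨ cong₂ _+F_ (act-mulP u k (act D x)) (act-mulP v E (act D x)) ⟩
      act u (act k (act D x)) +F act v (act E (act D x))   ≡⟨ cong₂ (λ y z → act u y +F act v z) first second ⟩
      act u 0F +F act v 0F                                 ≡⟨ cong₂ _+F_ (act-0F u) (act-0F v) ⟩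
      0F +F 0F                                             ≡⟨ 𝕂.+-identityˡ 0F ⟩
      0F                                                   ∎
      where
      first : act k (act D x) ≡ 0F
      first = trans (commute k D x) (trans (sym (act-mulP D k x)) (trans (sym (act-cong P (mulP D k) P≃ x)) h))
      second : act E (act D x) ≡ 0F
      second = trans (commute E D x)
          (trans (sym (act-mulP D E x)) (trans (sym (act-cong (xPowMinus1 n) (mulP D E) f≃ x)) (act-xPowMinus1 x)))

-- Symmetric words, their parameters, and multiples of a symmetric divisor.

module Words (p : ℕ) .{{_ : NonZero p}} (pp : Prime p) (odd : ¬ (2 ∣ p)) where
  open Fp p
  open Residues p
  open Polynomials p
  open Division p pp
  open Reversal p pp
  open SymmetricPrimes p pp odd

  allVecs-product : ∀ m → allVecs (suc m) ≡ cartesianProductWith Vec._∷_ (allFin p) (allVecs m)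
  allVecs-product m = go (allFin p)
    where
    go : ∀ xs → List.concatMap (λ a → map (a Vec.∷_) (allVecs m)) xs ≡ cartesianProductWith Vec._∷_ xs (allVecs m)
    go []       = refl
    go (x ∷ xs) = cong (map (x Vec.∷_) (allVecs m) ++_) (go xs)

  allVecs-complete : ∀ {m} (v : Vec (Fin p) m) → v ∈ allVecs m
  allVecs-complete Vec.[] = here refl
  allVecs-complete {suc m} (x Vec.∷ v) = subst ((x Vec.∷ v) ∈_) (sym (allVecs-product m))
    (∈P.∈-cartesianProductWith⁺ Vec._∷_ (∈P.∈-allFin x) (allVecs-complete v))

  allVecs-unique : ∀ m → Unique (allVecs m)
  allVecs-unique zero    = [] ∷ []
  allVecs-unique (suc m) = subst Unique (sym (allVecs-product m))
    (UniqueP.cartesianProductWith⁺ Vec._∷_ VecP.∷-injective (UniqueP.allFin⁺ p) (allVecs-unique m))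

  length-allVecs : ∀ m → length (allVecs m) ≡ p ^ m
  length-allVecs zero    = refl
  length-allVecs (suc m) = trans (go (allFin p)) (cong₂ _*_ {length (allFin p)} {p} (ListP.length-tabulate {n = p} id)
      (length-allVecs m))
    where
    go : ∀ xs → length (List.concatMap (λ a → map (a Vec.∷_) (allVecs m)) xs) ≡ length xs * length (allVecs m)
    go []       = refl
    go (x ∷ xs) = trans (ListP.length-++ (map (x Vec.∷_) (allVecs m)))
        (cong₂ _+_ (ListP.length-map (x Vec.∷_) (allVecs m)) (go xs))

  Vec-enumeration : ∀ m → Enumeration (Vec (Fin p) m)
  Vec-enumeration m = record
    { list = allVecs m ; complete = allVecs-complete ; unique = allVecs-unique m ; _≟_ = VecP.≡-dec Fin._≟_ }

  tabulate : ∀ h → (ℕ → Fin p) → Vec (Fin p) h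
  tabulate zero    c = Vec.[]
  tabulate (suc h) c = c 0 Vec.∷ tabulate h (c ∘ suc)

  entry : ∀ {h} → Vec (Fin p) h → ℕ → Fin p
  entry v = coeffP (Vec.toList v)

  entry-tabulate : ∀ h c {i} → i < h → entry (tabulate h c) i ≡ c i
  entry-tabulate (suc h) c {zero}  l       = refl
  entry-tabulate (suc h) c {suc i} (s≤s l) = entry-tabulate h (c ∘ suc) l

  tabulate-entry : ∀ {h} (v : Vec (Fin p) h) {c} → (∀ i → i < h → c i ≡ entry v i) → tabulate h c ≡ v
  tabulate-entry Vec.[]      e = refl
  tabulate-entry (x Vec.∷ v) e = cong₂ Vec._∷_ (e 0 (s≤s z≤n)) (tabulate-entry v (λ i l → e (suc i) (s≤s l)))

  -- The s-symmetric word of length e whose second half is c 0, c 1, …; in odd length c 0 is the middle letter.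
  word : Fin p → (ℕ → Fin p) → ℕ → Poly
  word s c zero          = []
  word s c (suc zero)    = c 0 ∷ []
  word s c (suc (suc e)) = (s ⊗ c ⌈ e /2⌉) ∷ (word s c e ∷ʳ c ⌈ e /2⌉)

  -- In odd length the middle letter satisfies `c = s c`. It is free only for `s = 1`, so this is
  -- the condition under which all choices of a second half give a symmetric word.
  Compatible : Fin p → ℕ → Set
  Compatible s zero          = ⊤
  Compatible s (suc zero)    = s ≡ 1p
  Compatible s (suc (suc e)) = Compatible s e

  length-∷ʳ : ∀ (f : Poly) a → length (f ∷ʳ a) ≡ suc (length f)
  length-∷ʳ f a = trans (ListP.length-++ f) (ℕP.+-comm (length f) 1)

  length-word : ∀ s c e → length (word s c e) ≡ e
  length-word s c zero          = refl
  length-word s c (suc zero)    = refl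
  length-word s c (suc (suc e)) = cong suc (trans (length-∷ʳ (word s c e) _) (cong suc (length-word s c e)))

  word-cong : ∀ s e {c c'} → (∀ i → i < ⌈ e /2⌉ → c i ≡ c' i) → word s c e ≡ word s c' e
  word-cong s zero          h = refl
  word-cong s (suc zero)    h = cong (_∷ []) (h 0 (s≤s z≤n))
  word-cong s (suc (suc e)) h = cong₂ (λ x w → (s ⊗ x) ∷ (w ∷ʳ x)) (h ⌈ e /2⌉ ℕP.≤-refl)
      (word-cong s e (λ i l → h i (ℕP.m<n⇒m<1+n l)))

  coeff-∷ʳ-< : ∀ f a {i} → i < length f → coeffP (f ∷ʳ a) i ≡ coeffP f i
  coeff-∷ʳ-< (b ∷ f) a {zero}  l       = refl
  coeff-∷ʳ-< (b ∷ f) a {suc i} (s≤s l) = coeff-∷ʳ-< f a l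

  halves : ∀ e → ⌊ e /2⌋ + ⌈ e /2⌉ ≡ e
  halves = ℕP.⌊n/2⌋+⌈n/2⌉≡n

  coeff-word : ∀ s c e {i} → i < ⌈ e /2⌉ → coeffP (word s c e) (⌊ e /2⌋ + i) ≡ c i
  coeff-word s c (suc zero) {zero} l = refl
  coeff-word s c (suc zero) {suc i} (s≤s ())
  coeff-word s c (suc (suc e)) {i} (s≤s l) with ℕP.m≤n⇒m<n∨m≡n l
  ... | inj₁ l' = trans (coeff-∷ʳ-< (word s c e) (c ⌈ e /2⌉)
      (subst (⌊ e /2⌋ + i <_) (trans (halves e) (sym (length-word s c e))) (ℕP.+-monoʳ-< ⌊ e /2⌋ l')))
                    (coeff-word s c e l')
  ... | inj₂ refl = trans (cong (coeffP (word s c e ∷ʳ c ⌈ e /2⌉)) (trans (halves e) (sym (length-word s c e))))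
      (coeff-∷ʳ (word s c e) (c ⌈ e /2⌉))

  reverse-ends : ∀ (x : Fin p) w y → reverse (x ∷ (w ∷ʳ y)) ≡ y ∷ (reverse w ∷ʳ x)
  reverse-ends x w y = trans (ListP.unfold-reverse x (w ∷ʳ y)) (cong (_∷ʳ x) (ListP.reverse-++ w (y ∷ [])))

  scaleP-∷ʳ : ∀ s w y → scaleP s (w ∷ʳ y) ≡ scaleP s w ∷ʳ (s ⊗ y)
  scaleP-∷ʳ s w y = ListP.map-++ (s ⊗_) w (y ∷ [])

  sign-twice : ∀ {s} → s ⊗ s ≡ 1p → ∀ x → s ⊗ (s ⊗ x) ≡ x
  sign-twice {s} ss x = trans (sym (⊗-assoc s s x)) (trans (cong (_⊗ x) ss) (𝔽.*-identityˡ x))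

  reverse-word : ∀ {s} → s ⊗ s ≡ 1p → ∀ c e → Compatible s e → reverse (word s c e) ≡ scaleP s (word s c e)
  reverse-word ss c zero          k    = refl
  reverse-word ss c (suc zero)    refl = cong (_∷ []) (sym (𝔽.*-identityˡ (c 0)))
  reverse-word {s} ss c (suc (suc e)) k = trans (reverse-ends _ (word s c e) x) (cong₂ _∷_ (sym (sign-twice {s} ss x))
      (trans (cong (_∷ʳ (s ⊗ x)) (reverse-word ss c e k)) (sym (scaleP-∷ʳ s (word s c e) x))))
    where x = c ⌈ e /2⌉

  word-symmetric : ∀ {s} → s ⊗ s ≡ 1p → ∀ c e → Compatible s e → Symmetric e s (word s c e)
  word-symmetric {s} ss c e k = symmetric
    (subst (Deg< (word s c e)) (length-word s c e) (Deg<-length (word s c e)))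
    (ℙ.reflexive (trans (cong reverse (subst (λ m → fit m (word s c e) ≡ word s c e) (length-word s c e)
      (fit-length (word s c e))))
      (reverse-word ss c e k)))

  -- Both ends are peeled off at once: the symmetry makes the first letter `s` times the last and
  -- leaves a symmetric inner word.
  symmetric-list-word : ∀ {s} e (L : Poly) → length L ≡ e → reverse L ≡ scaleP s L → L
      ≡ word s (λ i → coeffP L (⌊ e /2⌋ + i)) e
  symmetric-list-word zero [] l r = refl
  symmetric-list-word (suc zero) (x ∷ []) l r = refl
  symmetric-list-word {s} (suc (suc e)) (x ∷ L) l r with List.initLast L
  ... | List.[] with () ← l
  ... | L' List.∷ʳ′ y = cong₂ _∷_ x≡ (cong₂ _∷ʳ_ L'≡ y≡)
    where
    l' : length L' ≡ e
    l' = ℕP.suc-injective (trans (sym (length-∷ʳ L' y)) (ℕP.suc-injective l))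
    r' : y ∷ (reverse L' ∷ʳ x) ≡ (s ⊗ x) ∷ (scaleP s L' ∷ʳ (s ⊗ y))
    r' = trans (sym (reverse-ends x L' y)) (trans r (cong ((s ⊗ x) ∷_) (scaleP-∷ʳ s L' y)))
    inner : reverse L' ≡ scaleP s L' × x ≡ s ⊗ y
    inner = ListP.∷ʳ-injective (reverse L') (scaleP s L') (ListP.∷-injectiveʳ r')
    y≡ : y ≡ coeffP (L' ∷ʳ y) (⌊ e /2⌋ + ⌈ e /2⌉)
    y≡ = sym (trans (cong (coeffP (L' ∷ʳ y)) (trans (halves e) (sym l'))) (coeff-∷ʳ L' y))
    x≡ : x ≡ s ⊗ coeffP (L' ∷ʳ y) (⌊ e /2⌋ + ⌈ e /2⌉)
    x≡ = trans (proj₂ inner) (cong (s ⊗_) y≡)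
    L'≡ : L' ≡ word s (λ i → coeffP (L' ∷ʳ y) (⌊ e /2⌋ + i)) e
    L'≡ = trans (symmetric-list-word e L' l' (proj₁ inner))
      (word-cong s e (λ i q → sym (coeff-∷ʳ-< L' y (subst (⌊ e /2⌋ + i <_) (trans (halves e) (sym l'))
        (ℕP.+-monoʳ-< ⌊ e /2⌋ q)))))

  symmetric-word : ∀ {s} e {k} → Symmetric e s k → k ≃ word s (λ i → coeffP k (⌊ e /2⌋ + i)) e
  symmetric-word {s} e {k} (symmetric b r) = ≃-trans (≃-sym (fit-≃ k b)) (ℙ.reflexive (trans
    (symmetric-list-word e (fit e k) (length-fit e k) (≃⇒≡ (reverse (fit e k)) (scaleP s (fit e k))
      (trans (length-rev e k) (sym (trans (ListP.length-map (s ⊗_) (fit e k)) (length-fit e k))))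
      (≃-trans r (scaleP-cong {s} refl (≃-sym (fit-≃ k b))))))
    (word-cong s e (λ i _ → at (fit-≃ k b) (⌊ e /2⌋ + i)))))

  word-param : ∀ {s e} {k} (v : Vec (Fin p) ⌈ e /2⌉) → k ≃ word s (entry v) e →
               tabulate ⌈ e /2⌉ (λ i → coeffP k (⌊ e /2⌋ + i)) ≡ v
  word-param {s} {e} v eq = tabulate-entry v (λ i l → trans (at eq (⌊ e /2⌋ + i)) (coeff-word s (entry v) e l))

  half : Fin p
  half = proj₁ (⊗-inverse pp (1p ⊕ 1p) 1⊕1≢0)

  half-double : ∀ x → half ⊗ (x ⊕ x) ≡ x
  half-double x = trans (cong (half ⊗_) (double x)) (trans (sym (⊗-assoc half (1p ⊕ 1p) x))
    (trans (cong (_⊗ x) (trans (⊗-comm half (1p ⊕ 1p)) (proj₂ (⊗-inverse pp (1p ⊕ 1p) 1⊕1≢0)))) (𝔽.*-identityˡ x)))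

  double-half : ∀ x → (half ⊗ x) ⊕ (half ⊗ x) ≡ x
  double-half x = trans (sym (⊗-distribˡ half x x)) (half-double x)

  -- For `i = 0` the two monomials `x^(m+i)` and `x^(m-i)` coincide, so the middle letter is
  -- `2 a_0`. Doubling loses no information because `p` is odd.
  doubleHead halveHead : ∀ {m} → Vec (Fin p) (suc m) → Vec (Fin p) (suc m)
  doubleHead (x Vec.∷ v) = (x ⊕ x) Vec.∷ v
  halveHead  (x Vec.∷ v) = (half ⊗ x) Vec.∷ v

  halve-double : ∀ {m} (v : Vec (Fin p) (suc m)) → halveHead (doubleHead v) ≡ v
  halve-double (x Vec.∷ v) = cong (Vec._∷ v) (half-double x)

  double-halve : ∀ {m} (v : Vec (Fin p) (suc m)) → doubleHead (halveHead v) ≡ v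
  double-halve (x Vec.∷ v) = cong (Vec._∷ v) (double-half x)

  -- x^m Σ a_i (x^i + x^(-i)) modulo x^n - 1, for n = 2m + 1.
  associate : ∀ {m} → Vec (Fin p) (suc m) → Poly
  associate {m} a = word 1p (entry (doubleHead a)) (suc (m + m))

  compatible-1 : ∀ e → Compatible 1p e
  compatible-1 zero          = tt
  compatible-1 (suc zero)    = refl
  compatible-1 (suc (suc e)) = compatible-1 e

  associate-symmetric : ∀ {m} (a : Vec (Fin p) (suc m)) → Symmetric (suc (m + m)) 1p (associate a)
  associate-symmetric {m} a = word-symmetric 1⊗1≡1 (entry (doubleHead a)) (suc (m + m)) (compatible-1 (suc (m + m)))

  ⌊n/2⌋ : ∀ m → ⌊ suc (m + m) /2⌋ ≡ m
  ⌊n/2⌋ zero = refl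
  ⌊n/2⌋ (suc m) rewrite ℕP.+-suc m m = cong suc (⌊n/2⌋ m)

  ⌈n/2⌉ : ∀ m → ⌈ suc (m + m) /2⌉ ≡ suc m
  ⌈n/2⌉ zero = refl
  ⌈n/2⌉ (suc m) rewrite ℕP.+-suc m m = cong suc (⌈n/2⌉ m)

  dissociate : ∀ m → Poly → Vec (Fin p) (suc m)
  dissociate m k = halveHead (tabulate (suc m) (λ i → coeffP k (m + i)))

  dissociate-associate : ∀ {m k} (a : Vec (Fin p) (suc m)) → k ≃ associate a → dissociate m k ≡ a
  dissociate-associate {m} {k} a eq = trans (cong halveHead (tabulate-entry (doubleHead a) λ i l →
      trans (at eq (m + i)) (subst (λ j → coeffP (associate a) (j + i) ≡ entry (doubleHead a) i) (⌊n/2⌋ m)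
        (coeff-word 1p (entry (doubleHead a)) (suc (m + m)) (subst (i <_) (sym (⌈n/2⌉ m)) l)))))
    (halve-double a)

  associate-dissociate : ∀ {m k} → Symmetric (suc (m + m)) 1p k → k ≃ associate (dissociate m k)
  associate-dissociate {m} {k} σ = ≃-trans (symmetric-word (suc (m + m)) σ)
      (ℙ.reflexive (word-cong 1p (suc (m + m)) λ i l →
    trans (cong (λ j → coeffP k (j + i)) (⌊n/2⌋ m))
      (sym (trans (cong (λ v → entry v i) (double-halve (tabulate (suc m) (λ i → coeffP k (m + i)))))
      (entry-tabulate (suc m) (λ i → coeffP k (m + i)) (subst (i <_) (⌈n/2⌉ m) l))))))

  -- The quotient of an associate by D is an s-symmetric word of length e, and conversely.
  count-divisible : ∀ {D d e s m} (hD : HasLead D d 1p) → s ⊗ s ≡ 1p → Symmetric (suc d) s D → Compatible s e →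
    d + e ≡ suc (m + m) → ∑ (allVecs (suc m)) (λ a → iv (∣P? {D} (1p≢0p pp) hD (associate a))) ≡ p ^ ⌈ e /2⌉
  count-divisible {D} {d} {e} {s} {m} hD ss σD comp d+e = trans
    (∑-bijection (Vec-enumeration (suc m)) (Vec-enumeration ⌈ e /2⌉) (λ a → ∣P? {D} (1p≢0p pp) hD (associate a))
      (λ _ → yes tt) φ ψ fwd bwd)
    (trans (∑-const (allVecs ⌈ e /2⌉) 1) (trans (ℕP.*-identityʳ _) (length-allVecs ⌈ e /2⌉)))
    where
    quotient : Poly → Poly
    quotient f = proj₁ (divide {D} (1p≢0p pp) hD f)
    φ : Vec (Fin p) (suc m) → Vec (Fin p) ⌈ e /2⌉
    φ a = tabulate ⌈ e /2⌉ (λ i → coeffP (quotient (associate a)) (⌊ e /2⌋ + i))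
    ψ : Vec (Fin p) ⌈ e /2⌉ → Vec (Fin p) (suc m)
    ψ b = dissociate m (mulP D (word s (entry b) e))
    quotient-unique : ∀ f k → f ≃ mulP D k → quotient f ≃ k
    quotient-unique f k eq = ≃-sym (divide-unique {D} (1p≢0p pp) hD {f} {quotient f} {ρ} k (proj₁ spec) (proj₂ spec) eq)
      where
      ρ = proj₁ (proj₂ (divide {D} (1p≢0p pp) hD f))
      spec = proj₂ (proj₂ (divide {D} (1p≢0p pp) hD f))
    fwd : ∀ a → D ∣P associate a → ⊤ × ψ (φ a) ≡ a
    fwd a (k , eq) = tt , dissociate-associate a
        (≃-sym (≃-trans eq (mulP-congʳ D (≃-trans (≃-sym k≃) (≃-trans (symmetric-word e σk)
        (ℙ.reflexive (word-cong s e (λ i l → sym (entry-tabulate ⌈ e /2⌉ (λ i → coeffP q (⌊ e /2⌋ + i)) l)))))))))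
      where
      q = quotient (associate a)
      k≃ : q ≃ k
      k≃ = quotient-unique (associate a) k eq
      σk : Symmetric e s q
      σk = Symmetric-cong (≃-sym k≃) (subst (λ t → Symmetric e t k) (𝔽.*-identityʳ s)
        (Symmetric-quotient {d} {e} {s} {1p} {D} {k} {associate a} (1p≢0p pp) hD ss σD
          (subst (λ N → Symmetric N 1p (associate a)) (sym d+e) (associate-symmetric a)) eq))
    bwd : ∀ b → ⊤ → D ∣P associate (ψ b) × φ (ψ b) ≡ b
    bwd b _ = (w , ≃-sym restored) , word-param {s} {e} b (quotient-unique (associate (ψ b)) w (≃-sym restored))
      where
      w = word s (entry b) e
      restored : mulP D w ≃ associate (ψ b)
      -- The word carries the same sign as `D` and signs square to 1, so the product is a palindrome
      -- and therefore an associate.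
      restored = associate-dissociate {m} {mulP D w} (subst (λ N → Symmetric N 1p (mulP D w)) d+e
        (subst (λ t → Symmetric (d + e) t (mulP D w)) ss
          (Symmetric-mulP {d} {e} {s} {s} {D} {w} σD (word-symmetric ss (entry b) e comp))))

-- The quadratic form and its polar form.

module QuadraticForm {p n : ℕ} .{{_ : NonZero p}} (pp : Prime p) (odd : ¬ (2 ∣ p)) (K : FiniteField p n) (1≤n : 1 ≤ n) where
  open FiniteField K
  open Fp p
  open Residues p
  open Words p pp odd
  open OverField K
  open FieldTheory pp K
  open Trace pp K 1≤n
  open SemiringSolver 𝕂.commutativeSemiring using (solve; _:+_; _:*_; _:=_)

  ∑F : ℕ → (ℕ → F) → F
  ∑F k f = sumF (map f (upTo k))

  ∑F-cong : ∀ k {f g} → (∀ i → i < k → f i ≡ g i) → ∑F k f ≡ ∑F k g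
  ∑F-cong zero    e = refl
  ∑F-cong (suc k) {f} {g} e = trans (sumF-upTo-suc k f) (trans
    (cong₂ _+F_ (∑F-cong k (λ i l → e i (ℕP.m<n⇒m<1+n l))) (e k ℕP.≤-refl)) (sym (sumF-upTo-suc k g)))

  tabulate-applyUpTo : ∀ {A : Set} k (g : ℕ → A) → List.tabulate {n = k} (g ∘ toℕ) ≡ applyUpTo g k
  tabulate-applyUpTo zero    g = refl
  tabulate-applyUpTo (suc k) g = cong (g 0 ∷_) (tabulate-applyUpTo k (g ∘ suc))

  lookup-entry : ∀ {k} (a : Vec (Fin p) k) i → lookup a i ≡ entry a (toℕ i)
  lookup-entry (x Vec.∷ a) Fin.zero    = refl
  lookup-entry (x Vec.∷ a) (Fin.suc i) = lookup-entry a i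

  allFin⇒upTo : ∀ {k} (a : Vec (Fin p) k) (H : Fin p → ℕ → F) →
    sumF (map (λ i → H (lookup a i) (toℕ i)) (allFin k)) ≡ ∑F k (λ i → H (entry a i) i)
  allFin⇒upTo {k} a H = trans (sumF-cong (allFin k) (λ i → cong (λ c → H c (toℕ i)) (lookup-entry a i)))
    (cong sumF (trans (ListP.map-tabulate id (λ i → H (entry a (toℕ i)) (toℕ i)))
      (trans (tabulate-applyUpTo k (λ i → H (entry a i) i)) (sym (ListP.map-upTo (λ i → H (entry a i) i) k)))))

  frob-shift : ∀ i z → frob i (frob 1 z) ≡ frob (suc i) z
  frob-shift i z = sym (frob-+ 1 i z)

  -- Induction outwards from the middle: two new outer letters contribute `z` and `φ^(2m+2) z`, and
  -- the inner word, now shifted by one place, acts on `φ z`. The sequence `c'` is `c` with the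
  -- middle letter doubled.
  act-word : ∀ m (c c' : ℕ → Fin p) → c' 0 ≡ c 0 ⊕ c 0 → (∀ i → c' (suc i) ≡ c (suc i)) → ∀ z →
    act (word 1p c' (suc (m + m))) z ≡ ∑F (suc m) (λ i → ι (c i) *F (frob (m + i) z +F frob (m ∸ i) z))
  act-word zero c c' e0 e+ z = cong (_+F 0F) (begin
    ι (c' 0) *F z                        ≡⟨ cong (λ x → ι x *F z) e0 ⟩
    ι (c 0 ⊕ c 0) *F z                   ≡⟨ cong (_*F z) (ι-⊕ (c 0) (c 0)) ⟩
    (ι (c 0) +F ι (c 0)) *F z            ≡⟨ solve 2 (λ a z → (a :+ a) :* z := a :* (z :+ z)) refl (ι (c 0)) z ⟩
    ι (c 0) *F (z +F z)                  ≡⟨ cong (λ z → ι (c 0) *F (z +F z)) (frob-zero z) ⟨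
    ι (c 0) *F (frob 0 z +F frob 0 z)    ∎)
    where open ≡-Reasoning
  act-word (suc m) c c' e0 e+ z rewrite ℕP.+-suc m m | ⌈n/2⌉ m = begin
    ι (1p ⊗ c' (suc m)) *F z +F act (w ∷ʳ c' (suc m)) (frob 1 z)
      ≡⟨ cong₂ (λ a b → ι a *F z +F b) (trans (𝔽.*-identityˡ (c' (suc m))) (e+ m)) (act-∷ʳ w (c' (suc m)) (frob 1 z)) ⟩
    x *F z +F (act w (frob 1 z) +F ι (c' (suc m)) *F frob (length w) (frob 1 z))
      ≡⟨ cong₂ (λ a b → x *F z +F (a +F b)) (act-word m c c' e0 e+ (frob 1 z))
           (cong₂ (λ a k → ι a *F frob k (frob 1 z)) (e+ m) (length-word 1p c' (suc (m + m)))) ⟩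
    x *F z +F (∑F (suc m) (λ i → ι (c i) *F (frob (m + i) (frob 1 z) +F frob (m ∸ i) (frob 1 z))) +F x *F frob
      (suc (m + m)) (frob 1 z))
      ≡⟨ cong₂ (λ a b → x *F z +F (a +F x *F b)) (∑F-cong (suc m) shifted)
           (trans (frob-shift (suc (m + m)) z) (cong (λ k → frob (suc k) z) (sym (ℕP.+-suc m m)))) ⟩
    x *F z +F (∑F (suc m) G +F x *F frob (suc m + suc m) z)
      ≡⟨ solve 4 (λ x z s f → x :* z :+ (s :+ x :* f) := s :+ x :* (f :+ z)) refl x z (∑F (suc m) G)
        (frob (suc m + suc m) z) ⟩
    ∑F (suc m) G +F x *F (frob (suc m + suc m) z +F z)
      ≡⟨ cong (λ y → ∑F (suc m) G +F x *F (frob (suc m + suc m) z +F y))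
           (trans (sym (frob-zero z)) (cong (λ k → frob k z) (sym (ℕP.n∸n≡0 m)))) ⟩
    ∑F (suc m) G +F G (suc m)
      ≡⟨ sumF-upTo-suc (suc m) G ⟨
    ∑F (suc (suc m)) G ∎
    where
    open ≡-Reasoning
    w = word 1p c' (suc (m + m))
    x = ι (c (suc m))
    G : ℕ → F
    G i = ι (c i) *F (frob (suc m + i) z +F frob (suc m ∸ i) z)
    shifted : ∀ i → i < suc m → ι (c i) *F (frob (m + i) (frob 1 z) +F frob (m ∸ i) (frob 1 z)) ≡ G i
    shifted i (s≤s l) = cong (ι (c i) *F_) (cong₂ _+F_ (frob-shift (m + i) z)
      (trans (frob-shift (m ∸ i) z) (cong (λ k → frob k z) (sym (ℕP.+-∸-assoc 1 l)))))

  act-associate : ∀ {m} (a : Vec (Fin p) (suc m)) z →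
    act (associate a) z ≡ ∑F (suc m) (λ i → ι (entry a i) *F (frob (m + i) z +F frob (m ∸ i) z))
  act-associate {m} a@(x Vec.∷ v) z = act-word m (entry a) (entry (doubleHead a)) refl (λ i → refl) z

  quadratic : ∀ {m} → Vec (Fin p) (suc m) → F → F
  quadratic {m} a x = ∑F (suc m) (λ i → ι (entry a i) *F (frob i x *F x))

  Q≡Tr-quadratic : ∀ a x → Q a x ≡ Tr (quadratic a x)
  Q≡Tr-quadratic a x = cong Tr (trans
    (sumF-cong (allFin _) (λ i → cong (ι (lookup a i) *F_)
      (trans (powF-+ x (p ^ toℕ i) 1) (cong (frob (toℕ i) x *F_) (𝕂.*-identityʳ x)))))
    (allFin⇒upTo a (λ c i → ι c *F (frob i x *F x))))

  module _ {m : ℕ} (a : Vec (Fin p) (suc m)) where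
    polar : F → F → F
    polar y z = ∑F (suc m) (λ i → ι (entry a i) *F (frob i y *F z +F frob i z *F y))

    -- The polar form normalized so that `z` enters only through `P_a(φ) z`. Since `φ^m` is
    -- bijective and the trace form nondegenerate, the radical is visibly the kernel of `P_a(φ)`.
    bilinear : F → F → Fin p
    bilinear y z = Tr (frob m y *F act (associate a) z)

    quadratic-+ : ∀ y z → quadratic a (y +F z) ≡ quadratic a y +F quadratic a z +F polar y z
    quadratic-+ y z = trans (sumF-cong (upTo (suc m)) (λ i → trans
        (cong (λ u → ι (entry a i) *F (u *F (y +F z))) (frob-+F i y z))
        (solve 5 (λ c fy fz y z → c :* ((fy :+ fz) :* (y :+ z)) := c :* (fy :* y) :+ c :* (fz :* z) :+ c :*
          (fy :* z :+ fz :* y)) refl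
          (ι (entry a i)) (frob i y) (frob i z) y z)))
      (trans (sumF-+ (upTo (suc m)) (λ i → ι (entry a i) *F (frob i y *F y) +F ι (entry a i) *F (frob i z *F z))
        (λ i → ι (entry a i) *F (frob i y *F z +F frob i z *F y)))
        (cong (_+F polar y z) (sumF-+ (upTo (suc m)) (λ i → ι (entry a i) *F (frob i y *F y))
          (λ i → ι (entry a i) *F (frob i z *F z)))))

    TrF-∑F : ∀ k f → TrF (∑F k f) ≡ ∑F k (TrF ∘ f)
    TrF-∑F k f = sumF-homo TrF TrF-0F TrF-+ (upTo k) f

    -- Tr(y^(p^i) z) = Tr(y^(p^m) z^(p^(m-i))) and Tr(y z^(p^i)) = Tr(y^(p^m) z^(p^(m+i))).
    TrF-polar : ∀ y z → TrF (polar y z) ≡ TrF (frob m y *F act (associate a) z)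
    TrF-polar y z = begin
      TrF (polar y z)
        ≡⟨ TrF-∑F (suc m) _ ⟩
      ∑F (suc m) (λ i → TrF (ι (entry a i) *F (frob i y *F z +F frob i z *F y)))
        ≡⟨ ∑F-cong (suc m) (λ i l → term i (ℕP.≤-pred l)) ⟩
      ∑F (suc m) (λ i → TrF (frob m y *F (ι (entry a i) *F (frob (m + i) z +F frob (m ∸ i) z))))
        ≡⟨ TrF-∑F (suc m) _ ⟨
      TrF (∑F (suc m) (λ i → frob m y *F (ι (entry a i) *F (frob (m + i) z +F frob (m ∸ i) z))))
        ≡⟨ cong TrF (sumF-homo (frob m y *F_) (𝕂.zeroʳ _) (𝕂.distribˡ (frob m y)) (upTo (suc m)) _) ⟨
      TrF (frob m y *F ∑F (suc m) (λ i → ι (entry a i) *F (frob (m + i) z +F frob (m ∸ i) z)))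
        ≡⟨ cong (λ u → TrF (frob m y *F u)) (act-associate a z) ⟨
      TrF (frob m y *F act (associate a) z) ∎
      where
      open ≡-Reasoning
      term : ∀ i → i ≤ m → TrF (ι (entry a i) *F (frob i y *F z +F frob i z *F y))
                         ≡ TrF (frob m y *F (ι (entry a i) *F (frob (m + i) z +F frob (m ∸ i) z)))
      term i i≤m = begin
        TrF (c *F (frob i y *F z +F frob i z *F y))
          ≡⟨ TrF-scale (entry a i) _ ⟩
        c *F TrF (frob i y *F z +F frob i z *F y)
          ≡⟨ cong (c *F_) (TrF-+ _ _) ⟩
        c *F (TrF (frob i y *F z) +F TrF (frob i z *F y))
          ≡⟨ cong (c *F_) (cong₂ _+F_ (left i i≤m) (right i)) ⟩
        c *F (TrF (frob m y *F frob (m ∸ i) z) +F TrF (frob m y *F frob (m + i) z))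
          ≡⟨ cong (c *F_) (TrF-+ _ _) ⟨
        c *F TrF (frob m y *F frob (m ∸ i) z +F frob m y *F frob (m + i) z)
          ≡⟨ TrF-scale (entry a i) _ ⟨
        TrF (c *F (frob m y *F frob (m ∸ i) z +F frob m y *F frob (m + i) z))
          ≡⟨ cong TrF (solve 4 (λ c y u v → c :* (y :* u :+ y :* v) := y :* (c :* (v :+ u))) refl c (frob m y)
            (frob (m ∸ i) z) (frob (m + i) z)) ⟩
        TrF (frob m y *F (c *F (frob (m + i) z +F frob (m ∸ i) z))) ∎
        where
        c = ι (entry a i)
        left : ∀ i → i ≤ m → TrF (frob i y *F z) ≡ TrF (frob m y *F frob (m ∸ i) z)
        left i i≤m = trans (sym (TrF-frob (m ∸ i) _)) (cong TrF (trans (frob-*F (m ∸ i) _ z)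
          (cong (_*F frob (m ∸ i) z) (trans (sym (frob-+ i (m ∸ i) y)) (cong (λ k → frob k y) (ℕP.m+[n∸m]≡n i≤m))))))
        right : ∀ i → TrF (frob i z *F y) ≡ TrF (frob m y *F frob (m + i) z)
        right i = trans (sym (TrF-frob m _)) (cong TrF (trans (frob-*F m _ y) (trans (𝕂.*-comm _ _)
          (cong (frob m y *F_) (trans (sym (frob-+ i m z)) (cong (λ k → frob k z) (ℕP.+-comm i m)))))))

    Tr-polar : ∀ y z → Tr (polar y z) ≡ bilinear y z
    Tr-polar y z = ι-injective (trans (ι-Tr _) (trans (TrF-polar y z) (sym (ι-Tr _))))

    Tr-quadratic-+ : ∀ y z → Tr (quadratic a (y +F z)) ≡ (Tr (quadratic a y) ⊕ Tr (quadratic a z)) ⊕ bilinear y z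
    Tr-quadratic-+ y z = trans (cong Tr (quadratic-+ y z))
        (trans (Tr-+ _ (polar y z)) (cong₂ _⊕_ (Tr-+ (quadratic a y) (quadratic a z)) (Tr-polar y z)))

    bilinear-diagonal : ∀ z → bilinear z z ≡ Tr (quadratic a z) ⊕ Tr (quadratic a z)
    bilinear-diagonal z = trans (sym (Tr-polar z z)) (trans (cong Tr (trans
      (sumF-cong (upTo (suc m)) (λ i → 𝕂.distribˡ (ι (entry a i)) _ _))
        (sumF-+ (upTo (suc m)) (λ i → ι (entry a i) *F (frob i z *F z)) (λ i → ι (entry a i) *F (frob i z *F z)))))
      (Tr-+ (quadratic a z) (quadratic a z)))

    bilinear-+ˡ : ∀ x y z → bilinear (x +F y) z ≡ bilinear x z ⊕ bilinear y z
    bilinear-+ˡ x y z = trans (cong Tr (trans (cong (_*F act (associate a) z) (frob-+F m x y)) (𝕂.distribʳ _ _ _)))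
        (Tr-+ _ _)

    bilinear-+ʳ : ∀ x y z → bilinear x (y +F z) ≡ bilinear x y ⊕ bilinear x z
    bilinear-+ʳ x y z = trans (cong Tr (trans (cong (frob m x *F_) (act-+F (associate a) y z)) (𝕂.distribˡ _ _ _)))
        (Tr-+ _ _)

    radical⇒bilinear≡0 : ∀ {z} → act (associate a) z ≡ 0F → ∀ y → bilinear y z ≡ 0p
    radical⇒bilinear≡0 e y = trans (cong Tr (trans (cong (frob m y *F_) e) (𝕂.zeroʳ _))) Tr-0F

    -- `φ^m` has the inverse `φ^(n-m)`, so its value at `y` can be prescribed to be a witness of
    -- nondegeneracy of the trace.
    bilinear-nondegenerate : m ≤ n → ∀ {z} → act (associate a) z ≢ 0F → Σ F λ y → bilinear y z ≢ 0p
    bilinear-nondegenerate m≤n {z} h with w , wh ← Tr-nondegenerate h =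
      frob (n ∸ m) w , λ e → wh (trans (cong (λ u → Tr (u *F act (associate a) z)) (sym back)) e)
      where
      back : frob m (frob (n ∸ m) w) ≡ w
      back = trans (sym (frob-+ (n ∸ m) m w)) (trans (cong (λ k → frob k w) (ℕP.m∸n+n≡m m≤n)) (frob-n w))

-- The Walsh spectrum of a quadratic form.

module WalshSpectrum {p n : ℕ} .{{_ : NonZero p}} (pp : Prime p) (K : FiniteField p n) (1≤n : 1 ≤ n) where
  open import Data.Integer using (+_)
  open FiniteField K
  open Fp p
  open Residues p
  open OverField K
  open FieldTheory pp K
  open Trace pp K 1≤n
  private module ⊕P = CommutativeSemigroupP 𝔽.+-commutativeSemigroup

  +-cong : ∀ {a b} → a ≡ b → + a ≡ + b
  +-cong refl = refl

  ^-injective : ∀ a b → p ^ a ≡ p ^ b → a ≡ b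
  ^-injective a b e = ℕP.≤-antisym (ℕP.≮⇒≥ λ l → ℕP.<⇒≢ (ℕP.^-monoʳ-< p 1<p l) (sym e))
      (ℕP.≮⇒≥ λ l → ℕP.<⇒≢ (ℕP.^-monoʳ-< p 1<p l) e)

  -- A nonzero `h` generates the additive group: `y ↦ f (y h)` is invariant under `y ↦ y + 1`.
  shift-invariant : ∀ {A : Set} (f : Fin p → A) {h} → h ≢ 0p → (∀ x → f (x ⊕ h) ≡ f x) → ∀ x → f x ≡ f 0p
  shift-invariant f {h} h≢0 inv x with h⁻¹ , hh ← ⊗-inverse pp h h≢0 = begin
    f x                 ≡⟨ cong f (trans (⊗-assoc x h⁻¹ h)
      (trans (cong (x ⊗_) (trans (⊗-comm h⁻¹ h) hh)) (𝔽.*-identityʳ x))) ⟨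
    f ((x ⊗ h⁻¹) ⊗ h)   ≡⟨ shift-invariant⇒constant (λ y → f (y ⊗ h)) step (x ⊗ h⁻¹) ⟩
    f (0p ⊗ h)          ≡⟨ cong f (𝔽.zeroˡ h) ⟩
    f 0p                ∎
    where
    open ≡-Reasoning
    step : ∀ y → f ((y ⊕ 1p) ⊗ h) ≡ f (y ⊗ h)
    step y = trans (cong f (trans (𝔽.distribʳ h y 1p) (cong ((y ⊗ h) ⊕_) (𝔽.*-identityˡ h)))) (inv (y ⊗ h))

  sumZ-∑ : ∀ {A : Set} (xs : List A) (f : A → ℕ) → sumZ (map (λ x → + f x) xs) ≡ + ∑ xs f
  sumZ-∑ []       f = refl
  sumZ-∑ (x ∷ xs) f = cong (λ y → + f x ℤ.+ y) (sumZ-∑ xs f)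

  ε-iv : ∀ k j → ε^ j k ≡ + iv (k Fin.≟ j)
  ε-iv k j with k Fin.≟ j
  ... | yes _ = refl
  ... | no _  = refl

  sumC-ε : ∀ {A : Set} (xs : List A) (g : A → Fin p) k → sumC (map (λ x → ε^ (g x)) xs) k
      ≡ + ∑ xs (λ x → iv (k Fin.≟ g x))
  sumC-ε []       g k = refl
  sumC-ε (x ∷ xs) g k = cong₂ ℤ._+_ (ε-iv k (g x)) (sumC-ε xs g k)

  level : (F → Fin p) → Fin p → ℕ
  level g k = ∑ elems (λ x → iv (k Fin.≟ g x))

  sumZ-cong : ∀ {A : Set} (xs : List A) {f g : A → ℤ} → (∀ x → f x ≡ g x) → sumZ (map f xs) ≡ sumZ (map g xs)
  sumZ-cong []       e = refl
  sumZ-cong (x ∷ xs) e = cong₂ ℤ._+_ (e x) (sumZ-cong xs e)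

  -- The coefficient of `ε^m` in `w conj(w)` counts the pairs `(x , y)` with `g x - g y = m`;
  -- `level` performs the count over `y`.
  normSq-level : ∀ (w : Cyc) g → (∀ k → w k ≡ + level g k) → ∀ m →
    normSq w m ≡ + ∑ elems (λ x → level g (⊖ (m ⊕ (⊖ g x))))
  normSq-level w g e m = begin
    sumZ (map (λ k → w k ℤ.* w (⊖ (m ⊕ (⊖ k)))) (allFin p))
      ≡⟨ sumZ-cong (allFin p) (λ k → trans (cong₂ ℤ._*_ (e k) (e (⊖ (m ⊕ (⊖ k)))))
        (sym (ℤP.pos-* (level g k) (level g (⊖ (m ⊕ (⊖ k))))))) ⟩
    sumZ (map (λ k → + (level g k * level g (⊖ (m ⊕ (⊖ k))))) (allFin p))
      ≡⟨ sumZ-∑ (allFin p) _ ⟩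
    + ∑ (allFin p) (λ k → level g k * level g (⊖ (m ⊕ (⊖ k))))
      ≡⟨ +-cong (∑-cong (allFin p) (λ k → sym (∑-*ʳ (level g (⊖ (m ⊕ (⊖ k)))) elems (λ x → iv (k Fin.≟ g x))))) ⟩
    + ∑ (allFin p) (λ k → ∑ elems (λ x → iv (k Fin.≟ g x) * level g (⊖ (m ⊕ (⊖ k)))))
      ≡⟨ +-cong (∑-swap (allFin p) elems _) ⟩
    + ∑ elems (λ x → ∑ (allFin p) (λ k → iv (k Fin.≟ g x) * level g (⊖ (m ⊕ (⊖ k)))))
      ≡⟨ +-cong (∑-cong elems (λ x → trans
           (∑-cong (allFin p) (λ k → cong (_* level g (⊖ (m ⊕ (⊖ k)))) (iv-cong {d = k Fin.≟ g x} {g x Fin.≟ k} sym sym)))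
           (∑-δ Fin._≟_ FpE.unique (FpE.complete (g x)) (λ k → level g (⊖ (m ⊕ (⊖ k))))))) ⟩
    + ∑ elems (λ x → level g (⊖ (m ⊕ (⊖ g x)))) ∎
    where
    open ≡-Reasoning
    module FpE = Enumeration Fp-enumeration

  ∑-translate : ∀ z (f : F → ℕ) → ∑ elems (λ x → f (x +F z)) ≡ ∑ elems f
  ∑-translate z f = ∑-reindex K-enumeration (_+F z) (λ x → x 𝕂.- z)
    (λ x → trans (𝕂.+-assoc x z (-F z)) (trans (cong (x +F_) (𝕂.-‿inverseʳ z)) (𝕂.+-identityʳ x)))
    (λ x → trans (𝕂.+-assoc x (-F z) z) (trans (cong (x +F_) (𝕂.-‿inverseˡ z)) (𝕂.+-identityʳ x))) f

  ⊕-cancelʳ : ∀ h x y → x ⊕ h ≡ y ⊕ h → x ≡ y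
  ⊕-cancelʳ = 𝔽P.+-cancelʳ

  -- The Walsh argument uses only a form `f`, its polar form `β` and the radical. Subtracting the
  -- linear form `Tr(b x)` changes `f` but not `β`, so the same radical governs all `b`.
  module _ (f : F → Fin p) (β : F → F → Fin p)
           (f-+ : ∀ y z → f (y +F z) ≡ (f y ⊕ f z) ⊕ β y z)
           (β-+ˡ : ∀ x y z → β (x +F y) z ≡ β x z ⊕ β y z)
           (β-+ʳ : ∀ x y z → β x (y +F z) ≡ β x y ⊕ β x z)
           {rad : F → Set} (rad? : ∀ z → Dec (rad z))
           (β-rad : ∀ {z} → rad z → ∀ y → β y z ≡ 0p)
           (β-¬rad : ∀ {z} → ¬ rad z → Σ F λ y → β y z ≢ 0p)
           (f-rad : ∀ {z} → rad z → f z ≡ 0p) where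

    radicalSize : ℕ
    radicalSize = ∑ elems (λ z → iv (rad? z))

    module _ (b : F) where
      g : F → Fin p
      g x = f x ⊕ (⊖ Tr (b *F x))

      g-+ : ∀ y z → g (y +F z) ≡ (g y ⊕ g z) ⊕ β y z
      g-+ y z = begin
        f (y +F z) ⊕ (⊖ Tr (b *F (y +F z)))
          ≡⟨ cong₂ (λ u v → u ⊕ (⊖ v)) (f-+ y z) (trans (cong Tr (𝕂.distribˡ b y z)) (Tr-+ (b *F y) (b *F z))) ⟩
        ((f y ⊕ f z) ⊕ β y z) ⊕ (⊖ (Tr (b *F y) ⊕ Tr (b *F z)))
          ≡⟨ cong (((f y ⊕ f z) ⊕ β y z) ⊕_) (sym (𝔽P.-‿+-comm (Tr (b *F y)) (Tr (b *F z)))) ⟩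
        ((f y ⊕ f z) ⊕ β y z) ⊕ ((⊖ Tr (b *F y)) ⊕ (⊖ Tr (b *F z)))
          ≡⟨ ⊕P.xy∙z≈xz∙y (f y ⊕ f z) (β y z) ((⊖ Tr (b *F y)) ⊕ (⊖ Tr (b *F z))) ⟩
        ((f y ⊕ f z) ⊕ ((⊖ Tr (b *F y)) ⊕ (⊖ Tr (b *F z)))) ⊕ β y z
          ≡⟨ cong (_⊕ β y z) (⊕P.interchange (f y) (f z) (⊖ Tr (b *F y)) (⊖ Tr (b *F z))) ⟩
        (g y ⊕ g z) ⊕ β y z ∎
        where open ≡-Reasoning

      -- The number of y with g (y + z) - g y = m.
      derivative : F → Fin p → ℕ
      derivative z m = ∑ elems (λ y → iv (m Fin.≟ g z ⊕ β y z))

      -- Substituting `x = z + y` in the pairs turns `g x - g y` into `g z + β y z`, so the count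
      -- splits over the directions `z`.
      spectrum : ∀ m → normSq (walsh f b) m ≡ + ∑ elems (λ z → derivative z m)
      spectrum m = trans (normSq-level (walsh f b) g (λ k → sumC-ε elems g k) m) (+-cong (begin
        ∑ elems (λ x → ∑ elems (λ y → iv ((⊖ (m ⊕ (⊖ g x))) Fin.≟ g y)))
          ≡⟨ ∑-swap elems elems _ ⟩
        ∑ elems (λ y → ∑ elems (λ x → iv ((⊖ (m ⊕ (⊖ g x))) Fin.≟ g y)))
          ≡⟨ ∑-cong elems (λ y → sym (∑-translate y (λ x → iv ((⊖ (m ⊕ (⊖ g x))) Fin.≟ g y)))) ⟩
        ∑ elems (λ y → ∑ elems (λ z → iv ((⊖ (m ⊕ (⊖ g (z +F y)))) Fin.≟ g y)))
          ≡⟨ ∑-cong elems (λ y → ∑-cong elems (λ z → iv-cong (to y z) (from y z))) ⟩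
        ∑ elems (λ y → ∑ elems (λ z → iv (m Fin.≟ g z ⊕ β y z)))
          ≡⟨ ∑-swap elems elems _ ⟩
        ∑ elems (λ z → derivative z m) ∎))
        where
        open ≡-Reasoning
        expand : ∀ y z → g (z +F y) ≡ g y ⊕ (g z ⊕ β y z)
        expand y z = trans (cong g (𝕂.+-comm z y)) (trans (g-+ y z) (⊕-assoc (g y) (g z) (β y z)))
        negated : ∀ a x → ⊖ (a ⊕ (⊖ x)) ≡ x ⊕ (⊖ a)
        negated a x = AbelianGroupP.⁻¹-anti-homo‿- 𝔽.+-abelianGroup a x
        to : ∀ y z → ⊖ (m ⊕ (⊖ g (z +F y))) ≡ g y → m ≡ g z ⊕ β y z
        to y z e = sym (⊕-cancelʳ (g y) (g z ⊕ β y z) m (begin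
          (g z ⊕ β y z) ⊕ g y           ≡⟨ ⊕-comm (g z ⊕ β y z) (g y) ⟩
          g y ⊕ (g z ⊕ β y z)           ≡⟨ expand y z ⟨
          g (z +F y)                    ≡⟨ 𝔽.+-identityʳ (g (z +F y)) ⟨
          g (z +F y) ⊕ 0p               ≡⟨ cong (g (z +F y) ⊕_) (𝔽.-‿inverseˡ m) ⟨
          g (z +F y) ⊕ ((⊖ m) ⊕ m)      ≡⟨ ⊕-assoc (g (z +F y)) (⊖ m) m ⟨
          (g (z +F y) ⊕ (⊖ m)) ⊕ m      ≡⟨ cong (_⊕ m) (trans (sym (negated m (g (z +F y)))) e) ⟩
          g y ⊕ m                       ≡⟨ ⊕-comm (g y) m ⟩
          m ⊕ g y                       ∎))
        from : ∀ y z → m ≡ g z ⊕ β y z → ⊖ (m ⊕ (⊖ g (z +F y))) ≡ g y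
        from y z e = begin
          ⊖ (m ⊕ (⊖ g (z +F y)))        ≡⟨ negated m (g (z +F y)) ⟩
          g (z +F y) ⊕ (⊖ m)            ≡⟨ cong (_⊕ (⊖ m)) (trans (expand y z) (cong (g y ⊕_) (sym e))) ⟩
          (g y ⊕ m) ⊕ (⊖ m)             ≡⟨ ⊕-assoc (g y) m (⊖ m) ⟩
          g y ⊕ (m ⊕ (⊖ m))             ≡⟨ cong (g y ⊕_) (𝔽.-‿inverseʳ m) ⟩
          g y ⊕ 0p                      ≡⟨ 𝔽.+-identityʳ (g y) ⟩
          g y                           ∎

      -- `y ↦ β y z` is additive and nonzero. Translating `y` by `y₀` shifts its values by `β y₀ z`,
      -- so every value is taken equally often.
      derivative-¬rad : ∀ {z} → ¬ rad z → ∀ m → derivative z m ≡ derivative z 0p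
      derivative-¬rad {z} h with y₀ , β≢0 ← β-¬rad h = shift-invariant (derivative z) {β y₀ z} β≢0 λ m → begin
        ∑ elems (λ y → iv ((m ⊕ β y₀ z) Fin.≟ g z ⊕ β y z))
          ≡⟨ ∑-translate y₀ (λ y → iv ((m ⊕ β y₀ z) Fin.≟ g z ⊕ β y z)) ⟨
        ∑ elems (λ y → iv ((m ⊕ β y₀ z) Fin.≟ g z ⊕ β (y +F y₀) z))
          ≡⟨ ∑-cong elems (λ y → iv-cong
               (λ e → ⊕-cancelʳ (β y₀ z) m (g z ⊕ β y z) (trans e (regroup y)))
               (λ e → trans (cong (_⊕ β y₀ z) e) (sym (regroup y)))) ⟩
        ∑ elems (λ y → iv (m Fin.≟ g z ⊕ β y z)) ∎
        where
        open ≡-Reasoning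
        regroup : ∀ y → g z ⊕ β (y +F y₀) z ≡ (g z ⊕ β y z) ⊕ β y₀ z
        regroup y = trans (cong (g z ⊕_) (β-+ˡ y y₀ z)) (sym (⊕-assoc (g z) (β y z) (β y₀ z)))

      derivative-rad : ∀ {z} → rad z → ∀ m → derivative z m ≡ p ^ n * iv (m Fin.≟ g z)
      derivative-rad {z} h m = trans
          (∑-cong elems (λ y → cong (λ x → iv (m Fin.≟ x)) (trans (cong (g z ⊕_) (β-rad h y)) (𝔽.+-identityʳ (g z)))))
        (trans (∑-const elems (iv (m Fin.≟ g z))) (cong (_* iv (m Fin.≟ g z)) card))

      -- Translating the direction `z` by the radical element `z₀` shifts every value by `g z₀`, and
      -- a nonzero shift reaches all residues.
      flat : ∀ {z₀} → rad z₀ → g z₀ ≢ 0p → ∀ m → ∑ elems (λ z → derivative z m) ≡ ∑ elems (λ z → derivative z 0p)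
      flat {z₀} h g≢0 = shift-invariant (λ m → ∑ elems (λ z → derivative z m)) {g z₀} g≢0 λ m → begin
        ∑ elems (λ z → derivative z (m ⊕ g z₀))
          ≡⟨ ∑-translate z₀ (λ z → derivative z (m ⊕ g z₀)) ⟨
        ∑ elems (λ z → derivative (z +F z₀) (m ⊕ g z₀))
          ≡⟨ ∑-cong elems (λ z → ∑-cong elems (λ y → iv-cong
               (λ e → ⊕-cancelʳ (g z₀) m (g z ⊕ β y z) (trans e (regroup y z)))
               (λ e → trans (cong (_⊕ g z₀) e) (sym (regroup y z))))) ⟩
        ∑ elems (λ z → derivative z m) ∎
        where
        open ≡-Reasoning
        regroup : ∀ y z → g (z +F z₀) ⊕ β y (z +F z₀) ≡ (g z ⊕ β y z) ⊕ g z₀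
        regroup y z = begin
          g (z +F z₀) ⊕ β y (z +F z₀)
            ≡⟨ cong₂ _⊕_ (trans (g-+ z z₀) (trans (cong ((g z ⊕ g z₀) ⊕_) (β-rad h z)) (𝔽.+-identityʳ (g z ⊕ g z₀))))
                         (trans (β-+ʳ y z z₀) (trans (cong (β y z ⊕_) (β-rad h y)) (𝔽.+-identityʳ (β y z)))) ⟩
          (g z ⊕ g z₀) ⊕ β y z   ≡⟨ ⊕P.xy∙z≈xz∙y (g z) (g z₀) (β y z) ⟩
          (g z ⊕ β y z) ⊕ g z₀   ∎

      background : ℕ
      background = ∑ elems (λ z → iv (¬? (rad? z)) * derivative z 0p)

      -- A direction in the radical contributes `p ^ n` at `m = 0` and nothing elsewhere; all other
      -- directions contribute the same amount at each `m`, collected in `background`.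
      peaked : (∀ {z} → rad z → g z ≡ 0p) → ∀ m → ∑ elems (λ z → derivative z m)
          ≡ p ^ n * radicalSize * iv (m Fin.≟ 0p) + background
      peaked h m = begin
        ∑ elems (λ z → derivative z m)
          ≡⟨ ∑-cong elems split ⟩
        ∑ elems (λ z → p ^ n * iv (m Fin.≟ 0p) * iv (rad? z) + iv (¬? (rad? z)) * derivative z 0p)
          ≡⟨ ∑-+ elems (λ z → p ^ n * iv (m Fin.≟ 0p) * iv (rad? z)) (λ z → iv (¬? (rad? z)) * derivative z 0p) ⟩
        ∑ elems (λ z → p ^ n * iv (m Fin.≟ 0p) * iv (rad? z)) + background
          ≡⟨ cong (_+ background) (trans (∑-*ˡ (p ^ n * iv (m Fin.≟ 0p)) elems (λ z → iv (rad? z)))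
            (ℕ*P.xy∙z≈xz∙y (p ^ n) (iv (m Fin.≟ 0p)) radicalSize)) ⟩
        p ^ n * radicalSize * iv (m Fin.≟ 0p) + background ∎
        where
        open ≡-Reasoning
        module ℕ*P = CommutativeSemigroupP ℕP.*-commutativeSemigroup
        split : ∀ z → derivative z m ≡ p ^ n * iv (m Fin.≟ 0p) * iv (rad? z) + iv (¬? (rad? z)) * derivative z 0p
        split z with rad? z
        ... | yes r = trans (derivative-rad r m) (trans (cong (λ x → p ^ n * iv (m Fin.≟ x)) (h r))
            (sym (trans (ℕP.+-identityʳ _) (ℕP.*-identityʳ _))))
        ... | no ¬r = trans (derivative-¬rad ¬r m)
            (sym (trans (cong (_+ 1 * derivative z 0p) (ℕP.*-zeroʳ (p ^ n * iv (m Fin.≟ 0p)))) (ℕP.+-identityʳ _)))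

      -- A constant coefficient vector represents 0, since the powers of `ε_p` sum to 0.
      flat⇒≈0 : ∀ {z₀} → rad z₀ → g z₀ ≢ 0p → normSq (walsh f b) ≈C intC (+ 0)
      flat⇒≈0 r h i j = cong₂ ℤ._-_ (trans (constant i) (sym (constant j))) (trans (zeros i) (sym (zeros j)))
        where
        constant : ∀ i → normSq (walsh f b) i ≡ + ∑ elems (λ z → derivative z 0p)
        constant i = trans (spectrum i) (+-cong (flat r h i))
        zeros : ∀ i → intC (+ 0) i ≡ + 0
        zeros i with i Fin.≟ 0p
        ... | yes _ = refl
        ... | no _  = refl

      peaked⇒≈ : (∀ {z} → rad z → g z ≡ 0p) → normSq (walsh f b) ≈C intC (+ (p ^ n * radicalSize))
      peaked⇒≈ h i j = trans (difference i) (sym (difference j))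
        where
        open ≡-Reasoning
        c = p ^ n * radicalSize
        intC-iv : ∀ i → intC (+ c) i ≡ + (c * iv (i Fin.≟ 0p))
        intC-iv i with i Fin.≟ 0p
        ... | yes _ = +-cong (sym (ℕP.*-identityʳ c))
        ... | no _  = +-cong (sym (ℕP.*-zeroʳ c))
        difference : ∀ i → normSq (walsh f b) i ℤ.- intC (+ c) i ≡ + background
        difference i = begin
          normSq (walsh f b) i ℤ.- intC (+ c) i
            ≡⟨ cong₂ ℤ._-_ (trans (spectrum i) (+-cong (peaked h i))) (intC-iv i) ⟩
          + (c * iv (i Fin.≟ 0p) + background) ℤ.- + (c * iv (i Fin.≟ 0p))
            ≡⟨ cong (ℤ._- + (c * iv (i Fin.≟ 0p))) (ℤP.pos-+ (c * iv (i Fin.≟ 0p)) background) ⟩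
          + (c * iv (i Fin.≟ 0p)) ℤ.+ + background ℤ.- + (c * iv (i Fin.≟ 0p))
            ≡⟨ AbelianGroupP.xyx⁻¹≈y ℤP.+-0-abelianGroup (+ (c * iv (i Fin.≟ 0p))) (+ background) ⟩
          + background ∎

    -- A representative is known only up to a constant vector; the difference of its coordinates at
    -- 0 and 1 eliminates that constant and recovers the integer.
    ≈C-injective : ∀ {u : Cyc} {c d} → u ≈C intC (+ c) → u ≈C intC (+ d) → c ≡ d
    ≈C-injective {u} {c} {d} hc hd = ℤP.+-injective (ℤP.neg-injective (begin
      ℤ.- (+ c)                            ≡⟨ shift (+ c) ⟩
      ℤ.- u 0p ℤ.+ (u 0p ℤ.- + c)
        ≡⟨ cong (λ x → ℤ.- u 0p ℤ.+ x) (trans (trans (cong (λ x → u 0p ℤ.- x) (sym (at0 (+ c)))) (hc 0p 1p))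
          (cong (λ x → u 1p ℤ.- x) (at1 (+ c)))) ⟩
      ℤ.- u 0p ℤ.+ (u 1p ℤ.- + 0)
        ≡⟨ cong (λ x → ℤ.- u 0p ℤ.+ x)
          (sym (trans (trans (cong (λ x → u 0p ℤ.- x) (sym (at0 (+ d)))) (hd 0p 1p))
            (cong (λ x → u 1p ℤ.- x) (at1 (+ d))))) ⟩
      ℤ.- u 0p ℤ.+ (u 0p ℤ.- + d)          ≡⟨ shift (+ d) ⟨
      ℤ.- (+ d)                            ∎))
      where
      open ≡-Reasoning
      at0 : ∀ x → intC x 0p ≡ x
      at0 x with 0p Fin.≟ 0p
      ... | yes _ = refl
      ... | no ¬e = ⊥-elim (¬e refl)
      at1 : ∀ x → intC x 1p ≡ + 0
      at1 x with 1p Fin.≟ 0p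
      ... | yes e = ⊥-elim (1p≢0p pp e)
      ... | no _  = refl
      shift : ∀ x → ℤ.- x ≡ ℤ.- u 0p ℤ.+ (u 0p ℤ.- x)
      shift x = sym (trans (sym (ℤP.+-assoc (ℤ.- u 0p) (u 0p) (ℤ.- x)))
          (trans (cong (ℤ._+ (ℤ.- x)) (ℤP.+-inverseˡ (u 0p))) (ℤP.+-identityˡ (ℤ.- x))))

    -- For each `b` either `g` is nonzero somewhere on the radical and the norm vanishes, or `g` is
    -- zero there and the norm is `p ^ n` times the size of the radical.
    plateaued⇐ : ∀ {s} → radicalSize ≡ p ^ s → Plateaued s f
    plateaued⇐ {s} size b with Any.any? (λ z → rad? z ×-dec ¬? (g b z Fin.≟ 0p)) elems
    ... | yes found with z , r , h ← Any.satisfied found = inj₁ (flat⇒≈0 b r h)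
    ... | no ¬found = inj₂ (subst (λ c → normSq (walsh f b) ≈C intC (+ c))
        (trans (cong (p ^ n *_) size) (sym (ℕP.^-distribˡ-+-* p n s)))
        (peaked⇒≈ b (λ {z} r → decidable-stable (g b z Fin.≟ 0p)
          (λ h → ¬found (Any.map (λ { refl → r , h }) (complete z))))))

    -- At `b = 0` the norm is nonzero because `f` vanishes on the radical, so this one value
    -- determines `s`.
    plateaued⇒ : ∀ {s r} → radicalSize ≡ p ^ r → Plateaued s f → s ≡ r
    plateaued⇒ {s} {r} size h = from (h 0F)
      where
      at-zero : ∀ {z} → rad z → g 0F z ≡ 0p
      at-zero {z} ρ = trans (cong₂ (λ u v → u ⊕ (⊖ v)) (f-rad ρ) (trans (cong Tr (𝕂.zeroˡ z)) Tr-0F)) (𝔽.-‿inverseʳ 0p)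
      value : normSq (walsh f 0F) ≈C intC (+ (p ^ (n + r)))
      value = subst (λ c → normSq (walsh f 0F) ≈C intC (+ c))
          (trans (cong (p ^ n *_) size) (sym (ℕP.^-distribˡ-+-* p n r))) (peaked⇒≈ 0F at-zero)
      from : PlateauedAt s f 0F → s ≡ r
      from (inj₁ e) = ⊥-elim (ℕP.n≮n 0 (subst (0 <_) (≈C-injective {normSq (walsh f 0F)} value e) (ℕP.m^n>0 p (n + r))))
      from (inj₂ e) = ℕP.+-cancelˡ-≡ n s r (^-injective (n + s) (n + r) (≈C-injective {normSq (walsh f 0F)} e value))

-- Divisors of `x^n - 1` built from symmetric primes, and valuations.

parity : ∀ n → (Σ ℕ λ k → n ≡ k + k) ⊎ (Σ ℕ λ k → n ≡ suc (k + k))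
parity zero = inj₁ (0 , refl)
parity (suc n) with parity n
... | inj₁ (k , refl) = inj₂ (k , refl)
... | inj₂ (k , refl) = inj₁ (suc k , cong suc (sym (ℕP.+-suc k k)))

even≢odd : ∀ a b → a + a ≢ suc (b + b)
even≢odd (suc a) zero e with () ← trans (sym (ℕP.+-suc a a)) (ℕP.suc-injective e)
even≢odd (suc a) (suc b) e = even≢odd a b
    (ℕP.suc-injective (trans (sym (ℕP.+-suc a a)) (trans (ℕP.suc-injective e) (cong suc (ℕP.+-suc b b)))))

⌈+even/2⌉ : ∀ b k → ⌈ b + (k + k) /2⌉ ≡ ⌈ b /2⌉ + k
⌈+even/2⌉ b zero = trans (cong ⌈_/2⌉ (ℕP.+-identityʳ b)) (sym (ℕP.+-identityʳ _))
⌈+even/2⌉ b (suc k) = trans (cong ⌈_/2⌉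
    (trans (cong (b +_) (cong suc (ℕP.+-suc k k))) (trans (ℕP.+-suc b _) (cong suc (ℕP.+-suc b _)))))
  (trans (cong suc (⌈+even/2⌉ b k)) (sym (ℕP.+-suc _ k)))

module Factorization (p : ℕ) .{{_ : NonZero p}} (pp : Prime p) (odd : ¬ (2 ∣ p)) (q : ℕ) where
  open Fp p
  open Residues p
  open Polynomials p
  open Division p pp
  open Reversal p pp
  open SymmetricPrimes p pp odd
  open Words p pp odd

  powP-+ : ∀ r a b → powP r (a + b) ≃ mulP (powP r a) (powP r b)
  powP-+ r zero    b = ≃-sym (mulP-identityˡ (powP r b))
  powP-+ r (suc a) b = ≃-trans (mulP-congʳ r (powP-+ r a b)) (≃-sym (mulP-assoc r (powP r a) (powP r b)))

  oneP-lead : HasLead oneP 0 1p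
  oneP-lead = refl , Deg<-length oneP

  mulP-monic : ∀ {f g d e} → HasLead f d 1p → HasLead g e 1p → HasLead (mulP f g) (d + e) 1p
  mulP-monic {f} {g} {d} {e} hf hg = subst (HasLead (mulP f g) (d + e)) 1⊗1≡1 (HasLead-mulP {f} {g} hf hg)

  powP-lead : ∀ {r d} → HasLead r d 1p → ∀ e → HasLead (powP r e) (e * d) 1p
  powP-lead h zero    = oneP-lead
  powP-lead {r} h (suc e) = mulP-monic {r} {powP r e} h (powP-lead {r} h e)

  powP-∣P : ∀ r {a b} → a ≤ b → powP r a ∣P powP r b
  powP-∣P r {a} l with c , refl ← ℕP.m≤n⇒∃[o]m+o≡n l = powP r c , powP-+ r a c

  signPow : Fin p → ℕ → Fin p
  signPow s zero    = 1p
  signPow s (suc e) = s ⊗ signPow s e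

  Sign : Fin p → Set
  Sign s = s ⊗ s ≡ 1p

  ⊗-sign : ∀ {s t} → Sign s → Sign t → Sign (s ⊗ t)
  ⊗-sign {s} {t} hs ht = trans (interchange s t s t) (trans (cong₂ _⊗_ hs ht) 1⊗1≡1)
    where open CommutativeSemigroupP 𝔽.*-commutativeSemigroup using (interchange)

  signPow-sign : ∀ {s} → Sign s → ∀ e → Sign (signPow s e)
  signPow-sign     h zero    = 1⊗1≡1
  signPow-sign {s} h (suc e) = ⊗-sign {s} {signPow s e} h (signPow-sign {s} h e)

  signPow-even : ∀ {s} → Sign s → ∀ k → signPow s (k + k) ≡ 1p
  signPow-even h zero = refl
  signPow-even {s} h (suc k) rewrite ℕP.+-suc k k = trans (sign-twice {s} h (signPow s (k + k))) (signPow-even {s} h k)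

  signPow-1 : ∀ e → signPow 1p e ≡ 1p
  signPow-1 zero    = refl
  signPow-1 (suc e) = trans (𝔽.*-identityˡ (signPow 1p e)) (signPow-1 e)

  Symmetric-* : ∀ {d e s t f g} → Symmetric (suc d) s f → Symmetric (suc e) t g → Symmetric (suc (d + e)) (s ⊗ t)
      (mulP f g)
  Symmetric-* {d} {e} {s} {t} {f} {g} σ τ = subst (λ N → Symmetric N (s ⊗ t) (mulP f g)) (ℕP.+-suc d e)
      (Symmetric-mulP {d} {suc e} {s} {t} {f} {g} σ τ)

  oneP-symmetric : Symmetric 1 1p oneP
  oneP-symmetric = symmetric (Deg<-length oneP) (≃-sym (scaleP-1 oneP))

  powP-symmetric : ∀ {r d s} → Symmetric (suc d) s r → ∀ e → Symmetric (suc (e * d)) (signPow s e) (powP r e)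
  powP-symmetric σ zero = oneP-symmetric
  powP-symmetric {r} {d} {s} σ (suc e) = Symmetric-* {d} {e * d} {s} {signPow s e} {r} {powP r e} σ
      (powP-symmetric {r} {d} {s} σ e)

  record Factor : Set where
    field
      r     : Poly
      d     : ℕ
      s     : Fin p
      prime : SymmetricPrime r d s
    open SymmetricPrime prime public

  open Factor

  -- Each factor is symmetric, so the dichotomy of one applies to the other. If they divide each
  -- other, their degrees agree and monicity makes them equal.
  coprime-distinct : ∀ (f g : Factor) → ¬ (r f ≃ r g) → Coprime (r f) (r g)
  coprime-distinct f g f≄g = decide (dichotomy f (sign g) (isSymmetric g)) (dichotomy g (sign f) (isSymmetric f))
    where
    decide : r f ∣P r g ⊎ Coprime (r f) (r g) → r g ∣P r f ⊎ Coprime (r g) (r f) → Coprime (r f) (r g)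
    decide (inj₂ c) _        = c
    decide (inj₁ _) (inj₂ c) = coprime-sym {r g} {r f} c
    decide (inj₁ (k , eq)) (inj₁ (l , eq')) = ⊥-elim (f≄g (≃-sym (≃-trans eq (≃-trans (mulP-comm (r f) k)
        (≃-trans (mulP-congˡ (r f) k≃1) (mulP-identityˡ (r f)))))))
      where
      d≤ : ∀ (f g : Factor) k → r g ≃ mulP (r f) k → d f ≤ d g
      d≤ f g k eq with zero-or-lead k
      ... | inj₁ z = ⊥-elim (lead≢0⇒≄[] {r g} (1p≢0p pp) (lead g)
          (≃-trans eq (≃-trans (mulP-congʳ (r f) z) (mulP-zeroʳ (r f)))))
      ... | inj₂ (j , c , c≢0 , hk) = subst (d f ≤_) (lead-unique {r g} (⊗-≢0 (1p≢0p pp) c≢0) (1p≢0p pp)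
              (HasLead-cong {mulP (r f) k} (≃-sym eq) (HasLead-mulP {r f} {k} (lead f) hk)) (lead g)) (ℕP.m≤m+n (d f) j)
      d≡ : d f ≡ d g
      d≡ = ℕP.≤-antisym (d≤ f g k eq) (d≤ g f l eq')
      k< : Deg< k 1
      k< = mulP-Deg<-lead {r f} {d f} k {1} (1p≢0p pp) (lead f)
          (subst (Deg< (mulP (r f) k)) (trans (cong suc (sym d≡)) (ℕP.+-comm 1 (d f)))
        (Deg<-cong {r g} eq (proj₂ (lead g))))
      k0 : coeffP k 0 ≡ 1p
      k0 = trans (sym (𝔽.*-identityˡ (coeffP k 0))) (trans (sym (proj₁ (HasLead-mulP {r f} {k} (lead f) (refl , k<))))
        (trans (sym (at eq (d f + 0))) (trans (cong (coeffP (r g)) (trans (ℕP.+-identityʳ (d f)) d≡)) (proj₁ (lead g)))))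
      k≃1 : k ≃ oneP
      k≃1 = pointwise λ { zero → k0 ; (suc i) → k< (suc i) (s≤s z≤n) }

  -- For exponents b_i ≤ q, the complementary divisors ∏ r_i^(q - b_i) and ∏ r_i^(b_i) of ∏ r_i^q.
  divisor codivisor : List Factor → List ℕ → Poly
  divisor   (f ∷ fs) (b ∷ bs) = mulP (powP (r f) (q ∸ b)) (divisor fs bs)
  divisor   _        _        = oneP
  codivisor (f ∷ fs) (b ∷ bs) = mulP (powP (r f) b) (codivisor fs bs)
  codivisor _        _        = oneP

  codegree degree : List Factor → List ℕ → ℕ
  degree   (f ∷ fs) (b ∷ bs) = (q ∸ b) * d f + degree fs bs
  degree   _        _        = 0
  codegree (f ∷ fs) (b ∷ bs) = b * d f + codegree fs bs
  codegree _        _        = 0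

  divisorSign : List Factor → List ℕ → Fin p
  divisorSign (f ∷ fs) (b ∷ bs) = signPow (s f) (q ∸ b) ⊗ divisorSign fs bs
  divisorSign _        _        = 1p

  divisor-lead : ∀ fs bs → HasLead (divisor fs bs) (degree fs bs) 1p
  divisor-lead []       bs       = oneP-lead
  divisor-lead (f ∷ fs) []       = oneP-lead
  divisor-lead (f ∷ fs) (b ∷ bs) = mulP-monic {powP (r f) (q ∸ b)} {divisor fs bs} (powP-lead {r f} (lead f) (q ∸ b))
      (divisor-lead fs bs)

  codivisor-lead : ∀ fs bs → HasLead (codivisor fs bs) (codegree fs bs) 1p
  codivisor-lead []       bs       = oneP-lead
  codivisor-lead (f ∷ fs) []       = oneP-lead
  codivisor-lead (f ∷ fs) (b ∷ bs) = mulP-monic {powP (r f) b} {codivisor fs bs} (powP-lead {r f} (lead f) b)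
      (codivisor-lead fs bs)

  divisor-symmetric : ∀ fs bs → Symmetric (suc (degree fs bs)) (divisorSign fs bs) (divisor fs bs)
  divisor-symmetric []       bs       = oneP-symmetric
  divisor-symmetric (f ∷ fs) []       = oneP-symmetric
  divisor-symmetric (f ∷ fs) (b ∷ bs) = Symmetric-* {(q ∸ b) * d f} {degree fs bs} {signPow (s f) (q ∸ b)}
      {divisorSign fs bs} {powP (r f) (q ∸ b)} {divisor fs bs}
    (powP-symmetric {r f} {d f} {s f} (isSymmetric f) (q ∸ b)) (divisor-symmetric fs bs)

  divisorSign-sign : ∀ fs bs → Sign (divisorSign fs bs)
  divisorSign-sign []       bs       = 1⊗1≡1
  divisorSign-sign (f ∷ fs) []       = 1⊗1≡1
  divisorSign-sign (f ∷ fs) (b ∷ bs) = ⊗-sign {signPow (s f) (q ∸ b)} {divisorSign fs bs}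
      (signPow-sign {s f} (sign f) (q ∸ b)) (divisorSign-sign fs bs)

  Admissible : List Factor → List ℕ → Set
  Admissible []       []       = ⊤
  Admissible (f ∷ fs) (b ∷ bs) = b ≤ q × Admissible fs bs
  Admissible _        _        = ⊥

  fullProduct : List Factor → Poly
  fullProduct fs = prodP (map (λ f → powP (r f) q) fs)

  divisor*codivisor : ∀ fs bs → Admissible fs bs → fullProduct fs ≃ mulP (divisor fs bs) (codivisor fs bs)
  divisor*codivisor []       []       _          = ≃-sym (mulP-identityˡ oneP)
  divisor*codivisor (f ∷ fs) (b ∷ bs) (b≤q , adm) = begin
    mulP (powP (r f) q) (fullProduct fs)
      ≈⟨ mulP-cong (≃-trans (ℙ.reflexive (cong (powP (r f)) (sym (ℕP.m∸n+n≡m b≤q)))) (powP-+ (r f) (q ∸ b) b))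
        (divisor*codivisor fs bs adm) ⟩
    mulP (mulP (powP (r f) (q ∸ b)) (powP (r f) b)) (mulP (divisor fs bs) (codivisor fs bs))
      ≈⟨ solve 4 (λ x y z w → (x :* y) :* (z :* w) := (x :* z) :* (y :* w)) ≃-refl (powP (r f) (q ∸ b)) (powP (r f) b)
        (divisor fs bs) (codivisor fs bs) ⟩
    mulP (mulP (powP (r f) (q ∸ b)) (divisor fs bs)) (mulP (powP (r f) b) (codivisor fs bs)) ∎
    where
    open ≃-Reasoning
    open SemiringSolver ℙ.commutativeSemiring using (solve; _:*_; _:=_)

  Distinct : List Factor → Set
  Distinct = AllPairs (λ f g → Coprime (r f) (r g))

  coprime-divisor : ∀ {h} fs bs → All (λ f → Coprime h (r f)) fs → Coprime h (divisor fs bs)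
  coprime-divisor {h} []       bs       _        = coprime-sym {oneP} {h} (coprime-one h)
  coprime-divisor {h} (f ∷ fs) []       _        = coprime-sym {oneP} {h} (coprime-one h)
  coprime-divisor {h} (f ∷ fs) (b ∷ bs) (c ∷ cs) = coprime-sym {divisor (f ∷ fs) (b ∷ bs)} {h}
    (coprime-mulP {powP (r f) (q ∸ b)} {divisor fs bs} (coprime-powP {r f} (q ∸ b) (coprime-sym {h} {r f} c))
      (coprime-sym {h} {divisor fs bs} (coprime-divisor fs bs cs)))

  module _ (P : Poly) where
    divides? : ∀ f e → Dec (powP (r f) e ∣P P)
    divides? f e = ∣P? {powP (r f) e} (1p≢0p pp) (powP-lead {r f} (lead f) e) P

    -- The search stops at the cap `k`, taken to be `q` later on: only the multiplicity shared with
    -- `x^n - 1` matters, and `P = 0` receives the finite value `k`.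
    valuation : Factor → ℕ → ℕ
    valuation f zero = 0
    valuation f (suc k) with divides? f (suc k)
    ... | yes _ = suc k
    ... | no _  = valuation f k

    valuation-≤ : ∀ f k → valuation f k ≤ k
    valuation-≤ f zero = z≤n
    valuation-≤ f (suc k) with divides? f (suc k)
    ... | yes _ = ℕP.≤-refl
    ... | no _  = ℕP.m≤n⇒m≤1+n (valuation-≤ f k)

    valuation-∣P : ∀ f k → powP (r f) (valuation f k) ∣P P
    valuation-∣P f zero = P , ≃-sym (mulP-identityˡ P)
    valuation-∣P f (suc k) with divides? f (suc k)
    ... | yes h = h
    ... | no _  = valuation-∣P f k

    valuation-max : ∀ f k {e} → e ≤ k → powP (r f) e ∣P P → e ≤ valuation f k
    valuation-max f zero l h = l
    valuation-max f (suc k) l h with divides? f (suc k)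
    ... | yes _ = l
    ... | no ¬h with ℕP.m≤n⇒m<n∨m≡n l
    ...   | inj₁ l'   = valuation-max f k (ℕP.≤-pred l') h
    ...   | inj₂ refl = ⊥-elim (¬h h)

    -- The defect is used instead of the valuation because `corank ≤ b` is then divisibility by the
    -- power `q ∸ b`, and because the defects weighted by degrees add up to `n` minus the degree of
    -- the gcd.
    corank : Factor → ℕ
    corank f = q ∸ valuation f q

    corank≤q : ∀ f → corank f ≤ q
    corank≤q f = ℕP.m∸n≤m q (valuation f q)

    corank≤⇒∣P : ∀ f {b} → corank f ≤ b → powP (r f) (q ∸ b) ∣P P
    corank≤⇒∣P f {b} l = ∣P-trans {powP (r f) (q ∸ b)} {powP (r f) (valuation f q)} {P} (powP-∣P (r f)
      (ℕP.≤-trans (ℕP.∸-monoʳ-≤ q l) (ℕP.≤-reflexive (ℕP.m∸[m∸n]≡n (valuation-≤ f q))))) (valuation-∣P f q)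

    ∣P⇒corank≤ : ∀ f {b} → b ≤ q → powP (r f) (q ∸ b) ∣P P → corank f ≤ b
    ∣P⇒corank≤ f {b} b≤q h = ℕP.≤-trans (ℕP.∸-monoʳ-≤ q (valuation-max f q (ℕP.m∸n≤m q b) h))
        (ℕP.≤-reflexive (ℕP.m∸[m∸n]≡n b≤q))

    coranks : List Factor → List ℕ
    coranks = map corank

    coranks-admissible : ∀ fs → Admissible fs (coranks fs)
    coranks-admissible []       = tt
    coranks-admissible (f ∷ fs) = corank≤q f , coranks-admissible fs

    AllBelow : List Factor → List ℕ → Set
    AllBelow (f ∷ fs) (b ∷ bs) = corank f ≤ b × AllBelow fs bs
    AllBelow _        _        = ⊤

    divisor-∣P⇒ : ∀ fs bs → Admissible fs bs → divisor fs bs ∣P P → AllBelow fs bs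
    divisor-∣P⇒ []       []       _           h = tt
    divisor-∣P⇒ (f ∷ fs) (b ∷ bs) (b≤q , adm) h =
      ∣P⇒corank≤ f b≤q (∣P-trans {powP (r f) (q ∸ b)} {divisor (f ∷ fs) (b ∷ bs)} {P} (divisor fs bs , ≃-refl) h) ,
      divisor-∣P⇒ fs bs adm (∣P-trans {divisor fs bs} {divisor (f ∷ fs) (b ∷ bs)} {P}
        (powP (r f) (q ∸ b) , mulP-comm (powP (r f) (q ∸ b)) (divisor fs bs)) h)

    ⇒divisor-∣P : ∀ fs bs → Distinct fs → AllBelow fs bs → divisor fs bs ∣P P
    ⇒divisor-∣P []       bs       _        _       = P , ≃-sym (mulP-identityˡ P)
    ⇒divisor-∣P (f ∷ fs) []       _        _       = P , ≃-sym (mulP-identityˡ P)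
    ⇒divisor-∣P (f ∷ fs) (b ∷ bs) (c ∷ cs) (l , h) = coprime-∣P {powP (r f) (q ∸ b)} {divisor fs bs} {P}
      (coprime-powP {r f} (q ∸ b) (coprime-divisor fs bs c)) (corank≤⇒∣P f l) (⇒divisor-∣P fs bs cs h)

    allBelow-coranks : ∀ fs → AllBelow fs (coranks fs)
    allBelow-coranks []       = tt
    allBelow-coranks (f ∷ fs) = ℕP.≤-refl , allBelow-coranks fs

    powP-∣P-divisor : ∀ {f} fs → f ∈ fs → powP (r f) (q ∸ corank f) ∣P divisor fs (coranks fs)
    powP-∣P-divisor (f ∷ fs) (here refl) = divisor fs (coranks fs) , ≃-refl
    powP-∣P-divisor {f} (g ∷ fs) (there m) = ∣P-trans {powP (r f) (q ∸ corank f)} {divisor fs (coranks fs)}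
        {divisor (g ∷ fs) (coranks (g ∷ fs))}
      (powP-∣P-divisor fs m) (powP (r g) (q ∸ corank g) , mulP-comm (powP (r g) (q ∸ corank g)) (divisor fs (coranks fs)))

    coprime-codivisor : ∀ {k} fs → All (λ f → Coprime (powP (r f) (corank f)) k) fs →
        Coprime (codivisor fs (coranks fs)) k
    coprime-codivisor {k} []       _        = coprime-one k
    coprime-codivisor {k} (f ∷ fs) (c ∷ cs) = coprime-mulP {powP (r f) (corank f)} {codivisor fs (coranks fs)} c
        (coprime-codivisor fs cs)

    -- If r still divided the symmetric cofactor k, the valuation of P at r would be larger.
    cofactor-coprime : ∀ {N t k} fs → Sign t → Symmetric N t k → P
        ≃ mulP (divisor fs (coranks fs)) k → Coprime (codivisor fs (coranks fs)) k
    cofactor-coprime {N} {t} {k} fs ht σ eq = coprime-codivisor {k} fs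
        (All.tabulate λ {f} m → at-factor f m (corank f) refl)
      where
      at-factor : ∀ f → f ∈ fs → ∀ b → b ≡ corank f → Coprime (powP (r f) b) k
      at-factor f m zero    e = coprime-one k
      at-factor f m (suc b) e = coprime-powP {r f} (suc b) (Sum.fromInj₂ (λ h → ⊥-elim (too-large h)) (dichotomy f ht σ))
        where
        1+b≤q : suc b ≤ q
        1+b≤q = subst (_≤ q) (sym e) (corank≤q f)
        too-large : r f ∣P k → ⊥
        too-large h = ℕP.<⇒≱ (ℕP.n<1+n b) (subst (_≤ b) (sym e) (∣P⇒corank≤ f (ℕP.≤-trans (ℕP.n≤1+n b) 1+b≤q)
          (∣P-congʳ {powP (r f) (q ∸ b)} (≃-sym eq)
            (∣P-congˡ {mulP (powP (r f) (q ∸ corank f)) (r f)} {powP (r f) (q ∸ b)}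
            (≃-trans (mulP-comm _ (r f)) (ℙ.reflexive
              (cong (powP (r f)) (trans (cong (λ c → suc (q ∸ c)) (sym e)) (sym (ℕP.+-∸-assoc 1 1+b≤q))))))
            (mulP-mono-∣P {powP (r f) (q ∸ corank f)} {divisor fs (coranks fs)} {r f} {k} (powP-∣P-divisor fs m) h)))))

-- Joint distribution of the defects.

module Counting (p : ℕ) .{{_ : NonZero p}} (pp : Prime p) (odd : ¬ (2 ∣ p)) (v h : ℕ) (q≡ : p ^ v ≡ suc (h + h)) where
  open Fp p
  open Residues p
  open Polynomials p
  open Division p pp
  open Reversal p pp
  open SymmetricPrimes p pp odd
  open Words p pp odd
  open GeneratingFunctions p
  open Factorization p pp odd (p ^ v)
  open Factor
  open Statistic

  record EvenFactor : Set where
    field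
      factor : Factor
      δ      : ℕ
      even   : d factor ≡ δ + δ
      sign≡1 : s factor ≡ 1p

  open EvenFactor

  first : Factor
  first = record { r = x-1 ; d = 1 ; s = ⊖ 1p ; prime = x-1-symmetricPrime }

  factors : List EvenFactor → List Factor
  factors es = first ∷ map factor es

  allBelow? : ∀ P fs bs → Dec (AllBelow P fs bs)
  allBelow? P []       bs       = yes tt
  allBelow? P (f ∷ fs) []       = yes tt
  allBelow? P (f ∷ fs) (b ∷ bs) = (corank P f ℕ.≤? b) ×-dec allBelow? P fs bs

  halfDegree : List EvenFactor → List ℕ → ℕ
  halfDegree (e ∷ es) (b ∷ bs) = b * δ e + halfDegree es bs
  halfDegree _        _        = 0

  codegree-even : ∀ es bs → codegree (map factor es) bs ≡ halfDegree es bs + halfDegree es bs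
  codegree-even []       bs       = refl
  codegree-even (e ∷ es) []       = refl
  codegree-even (e ∷ es) (b ∷ bs) = trans (cong₂ (λ x y → b * x + y) (even e) (codegree-even es bs))
    (solve 3 (λ b x y → b :* (x :+ x) :+ (y :+ y) := (b :* x :+ y) :+ (b :* x :+ y)) refl b (δ e) (halfDegree es bs))
    where open SemiringSolver ℕP.+-*-commutativeSemiring using (solve; _:+_; _:*_; _:=_)

  divisorSign-even : ∀ es bs → divisorSign (map factor es) bs ≡ 1p
  divisorSign-even []       bs       = refl
  divisorSign-even (e ∷ es) []       = refl
  divisorSign-even (e ∷ es) (b ∷ bs) =
      trans (cong₂ (λ s t → signPow s (p ^ v ∸ b) ⊗ t) (sign≡1 e) (divisorSign-even es bs))
    (trans (𝔽.*-identityʳ (signPow 1p (p ^ v ∸ b))) (signPow-1 (p ^ v ∸ b)))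

  compatible-+even : ∀ s b k → Compatible s b → Compatible s (b + (k + k))
  compatible-+even s zero zero          c = c
  compatible-+even s zero (suc k)       c rewrite ℕP.+-suc k k = compatible-+even s zero k c
  compatible-+even s (suc zero) zero    c = c
  compatible-+even s (suc zero) (suc k) c rewrite ℕP.+-suc k k = compatible-+even s (suc zero) k c
  compatible-+even s (suc (suc b)) k    c = compatible-+even s b k c

  -- The sign of (x - 1)^(q - b) is 1 whenever b is odd, because q is odd.
  compatible-first : ∀ b → b ≤ p ^ v → Compatible (signPow (⊖ 1p) (p ^ v ∸ b)) b
  compatible-first b b≤q with parity b | parity (p ^ v ∸ b)
  ... | inj₁ (k , refl) | _ = compatible-+even _ 0 k tt
  ... | inj₂ (k , refl) | inj₁ (j , e) = compatible-+even (signPow (⊖ 1p) (p ^ v ∸ suc (k + k))) 1 k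
        (trans (cong (signPow (⊖ 1p)) e) (signPow-even {⊖ 1p} ⊖1⊗⊖1≡1 j))
  ... | inj₂ (k , refl) | inj₂ (j , e) = ⊥-elim (even≢odd (suc (j + k)) h (begin
        suc (j + k) + suc (j + k)
          ≡⟨ solve 2 (λ j k → (con 1 :+ (j :+ k)) :+ (con 1 :+ (j :+ k)) := (con 1 :+ (j :+ j)) :+
            (con 1 :+ (k :+ k))) refl j k ⟩
        suc (j + j) + suc (k + k)           ≡⟨ cong (_+ suc (k + k)) e ⟨
        p ^ v ∸ suc (k + k) + suc (k + k)   ≡⟨ ℕP.m∸n+n≡m b≤q ⟩
        p ^ v                               ≡⟨ q≡ ⟩
        suc (h + h)                         ∎))
    where
    open ≡-Reasoning
    open SemiringSolver ℕP.+-*-commutativeSemiring using (solve; _:+_; _:=_; con)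

  -- The factors other than `x - 1` contribute sign 1 and even codegree, so the condition depends on
  -- the exponent of `x - 1` alone.
  compatible : ∀ es b bs → b ≤ p ^ v → Compatible (divisorSign (factors es) (b ∷ bs)) (codegree (factors es) (b ∷ bs))
  compatible es b bs b≤q = subst (λ s → Compatible s (codegree (factors es) (b ∷ bs)))
    (sym (trans (cong (signPow (⊖ 1p) (p ^ v ∸ b) ⊗_) (divisorSign-even es bs))
      (𝔽.*-identityʳ (signPow (⊖ 1p) (p ^ v ∸ b)))))
    (subst (Compatible (signPow (⊖ 1p) (p ^ v ∸ b))) (cong₂ _+_ (sym (ℕP.*-identityʳ b)) (sym (codegree-even es bs)))
      (compatible-+even (signPow (⊖ 1p) (p ^ v ∸ b)) b (halfDegree es bs) (compatible-first b b≤q)))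

  xPowMinus1-lead : ∀ k → HasLead (xPowMinus1 (suc k)) (suc k) 1p
  xPowMinus1-lead k = HasLead-cong {(0p ⊕ (⊖ 1p)) ∷ monomialP 1p k}
      (∷-cong refl (≃-sym (addP-identityʳ (monomialP 1p k))))
    (proj₁ (mono k) , Deg<-∷ (0p ⊕ (⊖ 1p)) (monomialP 1p k) (proj₂ (mono k)))
    where
    mono : ∀ k → HasLead (monomialP 1p k) k 1p
    mono zero    = oneP-lead
    mono (suc k) = proj₁ (mono k) , Deg<-∷ 0p (monomialP 1p k) (proj₂ (mono k))

  module _ {m : ℕ} where
    firstStatistic : Statistic (Vec (Fin p) (suc m)) (p ^ v)
    firstStatistic = record
      { rank = λ a → corank (associate a) first ; S = halfPower ; d = 1 ; G = factorA v
      ; rank≤q = λ a → corank≤q (associate a) first ; G-mul = factorA-mul v h q≡ }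

    evenStatistic : EvenFactor → Statistic (Vec (Fin p) (suc m)) (p ^ v)
    evenStatistic e = record
      { rank = λ a → corank (associate a) (factor e) ; S = λ b → p ^ (b * δ e) ; d = d (factor e) ; G =
          factorG v (r (factor e))
      ; rank≤q = λ a → corank≤q (associate a) (factor e)
      ; G-mul = factorG-mul v (r (factor e)) (d (factor e)) (δ e) (even e)
          (λ j → degP-lead {powP (r (factor e)) j} (1p≢0p pp) (powP-lead {r (factor e)} (lead (factor e)) j))
          (degP-lead {r (factor e)} (1p≢0p pp) (lead (factor e))) }

    statistics : List EvenFactor → List (Statistic (Vec (Fin p) (suc m)) (p ^ v))
    statistics es = firstStatistic ∷ map evenStatistic es

    below-iv : ∀ es bs a → below (map evenStatistic es) bs a ≡ iv (allBelow? (associate a) (map factor es) bs)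
    below-iv []       bs       a = refl
    below-iv (e ∷ es) []       a = refl
    below-iv (e ∷ es) (b ∷ bs) a = trans (cong (iv (corank (associate a) (factor e) ℕ.≤? b) *_) (below-iv es bs a))
      (sym (iv-× (corank (associate a) (factor e) ℕ.≤? b) (allBelow? (associate a) (map factor es) bs)))

    bounds⇒admissible : ∀ es bs → Bounds (map evenStatistic es) bs → Admissible (map factor es) bs
    bounds⇒admissible []       []       _       = tt
    bounds⇒admissible (e ∷ es) (b ∷ bs) (l , h) = l , bounds⇒admissible es bs h

    tails-power : ∀ es bs → Bounds (map evenStatistic es) bs → tails (map evenStatistic es) bs ≡ p ^ halfDegree es bs
    tails-power []       []       _       = refl
    tails-power (e ∷ es) (b ∷ bs) (_ , h) = trans (cong (p ^ (b * δ e) *_) (tails-power es bs h))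
        (sym (ℕP.^-distribˡ-+-* p (b * δ e) (halfDegree es bs)))

    totalRank-codegree : ∀ es a → totalRank (map evenStatistic es) a
        ≡ codegree (map factor es) (coranks (associate a) (map factor es))
    totalRank-codegree []       a = refl
    totalRank-codegree (e ∷ es) a = cong (corank (associate a) (factor e) * d (factor e) +_) (totalRank-codegree es a)

    module _ (es : List EvenFactor) (distinct : Distinct (factors es)) (factorization : xPowMinus1 (suc (m + m)) ≃ fullProduct (factors es)) where
      degrees : ∀ bs → Admissible (factors es) bs → degree (factors es) bs + codegree (factors es) bs ≡ suc (m + m)
      degrees bs adm = lead-unique {mulP (divisor (factors es) bs) (codivisor (factors es) bs)} (1p≢0p pp) (1p≢0p pp)
        (mulP-monic {divisor (factors es) bs} {codivisor (factors es) bs} (divisor-lead (factors es) bs)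
          (codivisor-lead (factors es) bs))
        (HasLead-cong {xPowMinus1 (suc (m + m))} (≃-trans factorization (divisor*codivisor (factors es) bs adm))
          (xPowMinus1-lead (m + m)))

      -- All defects are within the bounds exactly when one divisor of `x^n - 1` divides the
      -- associate. The quotients are symmetric words of length `b + 2 H`, with `H` the total half
      -- degree, and the even part leaves the ceiling: the count is `p^⌈b/2⌉ p^H`.
      joint-tails : ∀ bs → Bounds (statistics es) bs →
        ∑ (allVecs (suc m)) (λ a → 1 * below (statistics es) bs a) ≡ 1 * tails (statistics es) bs
      joint-tails (b ∷ bs) (b≤q , bounds) = begin
        ∑ (allVecs (suc m)) (λ a → 1 * below (statistics es) (b ∷ bs) a)
          ≡⟨ ∑-cong (allVecs (suc m)) indicator ⟩
        ∑ (allVecs (suc m)) (λ a → iv (∣P? {divisor fs (b ∷ bs)} (1p≢0p pp) (divisor-lead fs (b ∷ bs)) (associate a)))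
          ≡⟨ count-divisible {divisor fs (b ∷ bs)} {degree fs (b ∷ bs)} {codegree fs (b ∷ bs)}
            {divisorSign fs (b ∷ bs)} {m}
               (divisor-lead fs (b ∷ bs)) (divisorSign-sign fs (b ∷ bs)) (divisor-symmetric fs (b ∷ bs))
                 (compatible es b bs b≤q) (degrees (b ∷ bs) adm) ⟩
        p ^ ⌈ b * 1 + codegree (map factor es) bs /2⌉
          ≡⟨ cong (λ k → p ^ ⌈ k /2⌉) (cong₂ _+_ (ℕP.*-identityʳ b) (codegree-even es bs)) ⟩
        p ^ ⌈ b + (halfDegree es bs + halfDegree es bs) /2⌉
          ≡⟨ cong (p ^_) (⌈+even/2⌉ b (halfDegree es bs)) ⟩
        p ^ (⌈ b /2⌉ + halfDegree es bs)
          ≡⟨ ℕP.^-distribˡ-+-* p ⌈ b /2⌉ (halfDegree es bs) ⟩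
        halfPower b * p ^ halfDegree es bs
          ≡⟨ cong (halfPower b *_) (tails-power es bs bounds) ⟨
        tails (statistics es) (b ∷ bs)
          ≡⟨ ℕP.*-identityˡ _ ⟨
        1 * tails (statistics es) (b ∷ bs) ∎
        where
        open ≡-Reasoning
        fs = factors es
        adm : Admissible fs (b ∷ bs)
        adm = b≤q , bounds⇒admissible es bs bounds
        indicator : ∀ a → 1 * below (statistics es) (b ∷ bs) a
            ≡ iv (∣P? {divisor fs (b ∷ bs)} (1p≢0p pp) (divisor-lead fs (b ∷ bs)) (associate a))
        indicator a = trans (ℕP.*-identityˡ _)
            (trans (cong (iv (corank (associate a) first ℕ.≤? b) *_) (below-iv es bs a))
          (trans (sym (iv-× (corank (associate a) first ℕ.≤? b) (allBelow? (associate a) (map factor es) bs)))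
            (iv-cong {d = allBelow? (associate a) fs (b ∷ bs)}
                {∣P? {divisor fs (b ∷ bs)} (1p≢0p pp) (divisor-lead fs (b ∷ bs)) (associate a)}
              (⇒divisor-∣P (associate a) fs (b ∷ bs) distinct) (divisor-∣P⇒ (associate a) fs (b ∷ bs) adm))))

      rank-count : ∀ t → ∑ (allVecs (suc m)) (λ a → iv (totalRank (statistics es) a ℕ.≟ t))
          ≡ coeffN (prodN (map G (statistics es))) t
      rank-count t = trans (∑-cong (allVecs (suc m)) (λ a → sym (ℕP.*-identityˡ _)))
        (trans (independent⇒product (statistics es) (allVecs (suc m)) (λ _ → 1) 1 joint-tails t) (ℕP.*-identityˡ _))

      module _ (a : Vec (Fin p) (suc m)) where
        private
          fs = factors es
          bs = coranks (associate a) fs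
          D = divisor fs bs
          adm : Admissible fs bs
          adm = coranks-admissible (associate a) fs

        -- The degree of `gcd(P_a, x^n - 1)`.
        nullity : ℕ
        nullity = degree fs bs

        nullity+rank : nullity + totalRank (statistics es) a ≡ suc (m + m)
        nullity+rank = trans (cong (λ x → nullity + (corank (associate a) first * 1 + x)) (totalRank-codegree es a))
            (degrees bs adm)

        gcd-associate : ExactGCD (suc (m + m)) (associate a) nullity
        gcd-associate = exact (⇒divisor-∣P (associate a) fs bs distinct (allBelow-coranks (associate a) fs))
          where
          exact : D ∣P associate a → ExactGCD (suc (m + m)) (associate a) nullity
          exact (k , eq) = record
            { D = D ; E = codivisor fs bs ; k = k ; e = codegree fs bs
            ; D-lead = divisor-lead fs bs ; E-lead = codivisor-lead fs bs ; degrees = degrees bs adm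
            ; f≃ = ≃-trans factorization (divisor*codivisor fs bs adm) ; P≃ = eq
            -- The cofactor is a quotient of a palindrome by a symmetric divisor, hence symmetric,
            -- so the dichotomies apply to it.
            ; k-coprime = coprime-sym {codivisor fs bs} {k}
                (cofactor-coprime (associate a) {codegree fs bs} {divisorSign fs bs ⊗ 1p} {k} fs
                (subst Sign (sym (𝔽.*-identityʳ (divisorSign fs bs))) (divisorSign-sign fs bs))
                (Symmetric-quotient {nullity} {codegree fs bs} {divisorSign fs bs} {1p} {D} {k} {associate a} (1p≢0p pp)
                  (divisor-lead fs bs) (divisorSign-sign fs bs) (divisor-symmetric fs bs)
                  (subst (λ N → Symmetric N 1p (associate a)) (sym (degrees bs adm)) (associate-symmetric a)) eq)
                eq) }

  -- `x - 1` has odd degree and every other factor has even degree, so they are distinct.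
  coprime-first : ∀ es → All (λ f → Coprime x-1 (r f)) (map factor es)
  coprime-first es = AllP.map⁺ (All.tabulate λ {e} _ → coprime-distinct first (factor e) (λ eq →
    even≢odd (δ e) 0 (trans (sym (even e))
      (sym (lead-unique {r (factor e)} (1p≢0p pp) (1p≢0p pp) (HasLead-cong {x-1} eq x-1-lead) (lead (factor e)))))))

  distinct-factors : ∀ es → AllPairs (λ f g → ¬ (f ≈P g)) (map (r ∘ factor) es) → Distinct (factors es)
  distinct-factors es ps = coprime-first es ∷ AllPairsP.map⁺
      (AllPairs.map (λ {e} {e'} ne → coprime-distinct (factor e) (factor e') (λ eq → ne (at eq))) (AllPairsP.map⁻ ps))

  even-factors : ∀ k (rs : List Poly) → All PrimeSelfReciprocal rs → All (_∣P xPowMinus1 (suc (k + k))) rs →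
                 Σ (List EvenFactor) λ es → map (r ∘ factor) es ≡ rs
  even-factors k []       []         []       = [] , refl
  even-factors k (r ∷ rs) (psr ∷ ps) (d ∷ ds) with es , refl ← even-factors k rs ps ds =
    record { factor = record { r = r ; d = degP r ; s = 1p ; prime = sp } ; δ = proj₁ ev ; even = proj₂ ev ; sign≡1 =
        refl } ∷ es , refl
    where
    sp = primeSelfReciprocal⇒symmetricPrime {r} psr
    ev = even-degree {degP r} {r} k (SymmetricPrime.isSymmetric sp) d

  ∣P-prodP : ∀ rs → All (_∣P prodP (map (λ r → powP r (p ^ v)) rs)) rs
  ∣P-prodP []       = []
  ∣P-prodP (r ∷ rs) = ∣P-mulʳ {r} {powP r (p ^ v)} (prodP (map (λ r → powP r (p ^ v)) rs))
      (subst (λ q → r ∣P powP r q) (sym q≡) (powP r (h + h) , ≃-refl)) ∷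
    All.map (λ {s} d → ∣P-trans {s} {prodP (map (λ r → powP r (p ^ v)) rs)} d
      (powP r (p ^ v) , mulP-comm (powP r (p ^ v)) (prodP (map (λ r → powP r (p ^ v)) rs)))) (∣P-prodP rs)

-- From kernels to plateaus and the generating function.

module Plateaus {p n : ℕ} .{{_ : NonZero p}} (pp : Prime p) (odd : ¬ (2 ∣ p)) (K : FiniteField p n) (1≤n : 1 ≤ n) (n≡ : n ≡ suc (n / 2 + n / 2)) where
  open FiniteField K
  open Fp p
  open Polynomials p
  open Division p pp
  open SymmetricPrimes p pp odd using (x⊕x≡0⇒x≡0)
  open Words p pp odd
  open OverField K
  open Trace pp K 1≤n
  open Kernel pp K 1≤n
  open QuadraticForm pp odd K 1≤n
  open WalshSpectrum pp K 1≤n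

  module _ (a : Vec (Fin p) (suc (n / 2))) where
    private
      rad? : ∀ z → Dec (act (associate a) z ≡ 0F)
      rad? z = act (associate a) z ≟F 0F

      Q-+ : ∀ y z → Q a (y +F z) ≡ (Q a y ⊕ Q a z) ⊕ bilinear a y z
      Q-+ y z = trans (Q≡Tr-quadratic a (y +F z)) (trans (Tr-quadratic-+ a y z)
        (cong₂ (λ u v → (u ⊕ v) ⊕ bilinear a y z) (sym (Q≡Tr-quadratic a y)) (sym (Q≡Tr-quadratic a z))))

      m≤n : n / 2 ≤ n
      m≤n = subst (n / 2 ≤_) (sym n≡) (ℕP.m≤n⇒m≤1+n (ℕP.m≤m+n (n / 2) (n / 2)))

      -- 2 Q(z) = B(z, z) = 0 on the radical, and p is odd.
      Q-radical : ∀ {z} → act (associate a) z ≡ 0F → Q a z ≡ 0p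
      Q-radical {z} e = trans (Q≡Tr-quadratic a z)
          (x⊕x≡0⇒x≡0 (Tr (quadratic a z)) (trans (sym (bilinear-diagonal a z)) (radical⇒bilinear≡0 a e z)))

    kernel⇒plateaued : ∀ {s} → kernelSize (associate a) ≡ p ^ s → Plateaued s (Q a)
    kernel⇒plateaued = plateaued⇐ (Q a) (bilinear a) Q-+ (bilinear-+ˡ a) (bilinear-+ʳ a) rad?
      (radical⇒bilinear≡0 a) (bilinear-nondegenerate a m≤n) Q-radical

    plateaued⇒kernel : ∀ {s k} → kernelSize (associate a) ≡ p ^ k → Plateaued s (Q a) → s ≡ k
    plateaued⇒kernel = plateaued⇒ (Q a) (bilinear a) Q-+ (bilinear-+ˡ a) (bilinear-+ʳ a) rad?
      (radical⇒bilinear≡0 a) (bilinear-nondegenerate a m≤n) Q-radical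

  coeff-applyUpTo : ∀ k (g : ℕ → ℕ) t → t < k → coeffN (applyUpTo g k) t ≡ g t
  coeff-applyUpTo (suc k) g zero    l       = refl
  coeff-applyUpTo (suc k) g (suc t) (s≤s l) = coeff-applyUpTo k (g ∘ suc) t l

  coeff-applyUpTo-≥ : ∀ k (g : ℕ → ℕ) t → k ≤ t → coeffN (applyUpTo g k) t ≡ 0
  coeff-applyUpTo-≥ zero    g t       l       = refl
  coeff-applyUpTo-≥ (suc k) g (suc t) (s≤s l) = coeff-applyUpTo-≥ k (g ∘ suc) t l

  module _ (v h : ℕ) (q≡ : p ^ v ≡ suc (h + h)) where
    open Counting p pp odd v h q≡
    open Factorization p pp odd (p ^ v)
    open GeneratingFunctions p
    open Statistic using (G)

    module _ (es : List EvenFactor) (distinct : Distinct (factors es)) (factorization : xPowMinus1 (suc (n / 2 + n / 2)) ≃ fullProduct (factors es)) where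
      private
        rk : Vec (Fin p) (suc (n / 2)) → ℕ
        rk = totalRank (statistics es)
        nul : Vec (Fin p) (suc (n / 2)) → ℕ
        nul = nullity es distinct factorization

      nul+rk : ∀ a → nul a + rk a ≡ n
      nul+rk a = trans (nullity+rank es distinct factorization a) (sym n≡)

      kernel-nullity : ∀ a → kernelSize (associate a) ≡ p ^ nul a
      kernel-nullity a = kernelSize-gcd {associate a} {nul a} (subst (λ N → ExactGCD N (associate a) (nul a)) (sym n≡)
          (gcd-associate es distinct factorization a))

      -- Nullity and total defect add up to `n`, so being `(n - t)`-plateaued means having total
      -- defect `t`. The bound on `t` keeps the truncated subtraction exact.
      𝒩-rank : ∀ t → t ≤ n → 𝒩 (n ∸ t) ≡ ∑ (allVecs (suc (n / 2))) (λ a → iv (rk a ℕ.≟ t))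
      𝒩-rank t t≤n = trans (length-filter-iv (λ a → plateaued? (n ∸ t) (Q a)) (allVecs (suc (n / 2))))
        (∑-cong (allVecs (suc (n / 2))) (λ a → iv-cong (to a) (from a)))
        where
        to : ∀ a → Plateaued (n ∸ t) (Q a) → rk a ≡ t
        to a pl = ℕP.+-cancelˡ-≡ (nul a) (rk a) t
            (trans (nul+rk a) (sym (trans (cong (_+ t)
              (sym (plateaued⇒kernel a {n ∸ t} {nul a} (kernel-nullity a) pl))) (ℕP.m∸n+n≡m t≤n))))
        from : ∀ a → rk a ≡ t → Plateaued (n ∸ t) (Q a)
        from a e = kernel⇒plateaued a {n ∸ t}
            (trans (kernel-nullity a) (cong (p ^_)
              (sym (trans (cong₂ _∸_ (sym (nul+rk a)) (sym e)) (ℕP.m+n∸n≡m (nul a) (rk a))))))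

      generating-function : ∀ t → coeffN 𝒢 t ≡ coeffN (prodN (map G (statistics {n / 2} es))) t
      generating-function t = trans (cong (λ f → coeffN f t) (ListP.map-upTo (λ t → 𝒩 (n ∸ t)) (suc n)))
          (trans (cases (t ℕ.≤? n)) (rank-count es distinct factorization t))
        where
        cases : Dec (t ≤ n) → coeffN (applyUpTo (λ t → 𝒩 (n ∸ t)) (suc n)) t
            ≡ ∑ (allVecs (suc (n / 2))) (λ a → iv (rk a ℕ.≟ t))
        cases (yes t≤n) = trans (coeff-applyUpTo (suc n) (λ t → 𝒩 (n ∸ t)) t (s≤s t≤n)) (𝒩-rank t t≤n)
        -- Beyond degree `n` the list `𝒢` has ended, and no total defect exceeds `n`.
        cases (no t≰n)  = trans (coeff-applyUpTo-≥ (suc n) (λ t → 𝒩 (n ∸ t)) t (ℕP.≰⇒> t≰n))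
          (sym (trans (∑-cong (allVecs (suc (n / 2)))
            (λ a → iv-no (rk a ℕ.≟ t) (λ e →
              t≰n (subst (_≤ n) e (subst (rk a ≤_) (nul+rk a) (ℕP.m≤n+m (rk a) (nul a)))))))
            (∑-zero (allVecs (suc (n / 2))))))

-- Parity hypotheses and assembly of the product formula.

odd⇒ : ∀ {n} → ¬ (2 ∣ n) → Σ ℕ λ k → n ≡ suc (k + k)
odd⇒ {n} h with parity n
... | inj₂ o = o
... | inj₁ (k , refl) = ⊥-elim (h (divides k (trans (cong (k +_) (sym (ℕP.+-identityʳ k))) (ℕP.*-comm 2 k))))

odd-^ : ∀ {p} → ¬ (2 ∣ p) → ∀ v → ¬ (2 ∣ p ^ v)
odd-^ h zero    d with () ← ∣1⇒≡1 d
odd-^ {p} h (suc v) d with euclidsLemma p (p ^ v) prime[2] d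
... | inj₁ d' = h d'
... | inj₂ d' = odd-^ h v d'

odd-half : ∀ n → ¬ (2 ∣ n) → n ≡ suc (n / 2 + n / 2)
odd-half n h with n % 2 | m≡m%n+[m/n]*n n 2 | m%n<n n 2
... | 0           | e | _ = ⊥-elim (h (divides (n / 2) e))
... | 1           | e | _ = trans e (cong suc (trans (ℕP.*-comm (n / 2) 2) (cong (n / 2 +_) (ℕP.+-identityʳ (n / 2)))))
... | suc (suc _) | _ | s≤s (s≤s ())

module _ {p n : ℕ} .{{_ : NonZero p}} (pp : Prime p) (odd : ¬ (2 ∣ p)) (K : FiniteField p n) (1≤n : 1 ≤ n) (n-odd : ¬ (2 ∣ n))
         (v h : ℕ) (q≡ : p ^ v ≡ suc (h + h)) where
  open Fp p
  open Polynomials p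
  open Division p pp
  open GeneratingFunctions p
  open Counting p pp odd v h q≡
  open Factorization p pp odd (p ^ v)
  open Factor
  open EvenFactor
  open Plateaus pp odd K 1≤n (odd-half n n-odd)

  generating-function-product : ∀ rs → All PrimeSelfReciprocal rs → AllPairs (λ f g → ¬ (f ≈P g)) rs →
    xPowMinus1 n ≈P mulP (powP (xPowMinus1 1) (p ^ v)) (prodP (map (λ r → powP r (p ^ v)) rs)) →
    ∀ t → coeffN (OverField.𝒢 K) t ≡ coeffN (mulN (factorA v) (prodN (map (factorG v) rs))) t
  generating-function-product rs psr distinct factorization t =
    -- Each `r` divides `x^n - 1`, which for odd `n` forces its degree to be even.
    conclude (even-factors m rs psr
      (All.map (λ {r} d → ∣P-trans {r} {product} d
        (powP x-1 (p ^ v) , ≃-trans f≃ (mulP-comm (powP x-1 (p ^ v)) product))) (∣P-prodP rs)))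
    where
    open SymmetricPrimes p pp odd using (x-1)
    m = n / 2
    product = prodP (map (λ r → powP r (p ^ v)) rs)
    f≃ : xPowMinus1 (suc (m + m)) ≃ mulP (powP x-1 (p ^ v)) product
    f≃ = pointwise (subst (λ N → xPowMinus1 N ≈P mulP (powP x-1 (p ^ v)) product) (odd-half n n-odd) factorization)
    conclude : (Σ (List EvenFactor) λ es → map (r ∘ factor) es ≡ rs) →
               coeffN (OverField.𝒢 K) t ≡ coeffN (mulN (factorA v) (prodN (map (factorG v) rs))) t
    conclude (es , refl) = trans (generating-function v h q≡ es (distinct-factors es distinct) f≃' t)
      (cong (λ fs → coeffN (mulN (factorA v) (prodN fs)) t)
        (trans (sym (ListP.map-∘ {g = Statistic.G} {f = evenStatistic} es))
            (ListP.map-∘ {g = factorG v} {f = r ∘ factor} es)))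
      where
      f≃' : xPowMinus1 (suc (m + m)) ≃ fullProduct (factors es)
      f≃' = ≃-trans f≃ (mulP-congʳ (powP x-1 (p ^ v)) (ℙ.reflexive (cong prodP
        (trans (sym (ListP.map-∘ {g = λ r → powP r (p ^ v)} {f = r ∘ factor} es))
            (ListP.map-∘ {g = λ f → powP (r f) (p ^ v)} {f = factor} es)))))

theorem3 : (p : ℕ) .{{_ : NonZero p}} → Prime p → ¬ (2 ∣ p) →
    (n : ℕ) → 1 ≤ n → ¬ (2 ∣ n) →
    (K : FiniteField p n) →
    (v : ℕ) → p ^ v ∣ n → ¬ (p ^ suc v ∣ n) →
    (rs : List (Fp.Poly p)) →
    All (Fp.PrimeSelfReciprocal p) rs →
    AllPairs (λ f g → ¬ (Fp._≈P_ p f g)) rs →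
    Fp._≈P_ p (Fp.xPowMinus1 p n)
    (Fp.mulP p (Fp.powP p (Fp.xPowMinus1 p 1) (p ^ v))
    (Fp.prodP p (map (λ r → Fp.powP p r (p ^ v)) rs))) →
    ∀ t → Fp.coeffN p (OverField.𝒢 K) t
    ≡ Fp.coeffN p (Fp.mulN p (Fp.factorA p v) (Fp.prodN p (map (Fp.factorG p v) rs))) t
theorem3 p pp odd n 1≤n n-odd K v _ _ rs psr distinct factorization t =
  generating-function-product pp odd K 1≤n n-odd v (proj₁ q-odd) (proj₂ q-odd) rs psr distinct factorization t
  where q-odd = odd⇒ (odd-^ odd v)
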